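{- Let $q$ be a prime power and let $v,d,k$ be integers with $2\le k\le v-2$, $d$ even and $4\le d\le 2\min\{k,v-k\}$. If $k\le v/2$, then $$\left\lfloor\frac{q^v-1}{q^k-1}\,A_q(v-1,d;k-1)\right\rfloor\ \le\ \left\lfloor\frac{q^v-1}{q^{v-k}-1}\,A_q(v-1,d;k)\right\rfloor,$$ where equality holds if and only if $v=2k$.
   Context: $A_q(v,d;k)$ denotes the maximum cardinality of a set of $k$-dimensional subspaces of $\mathbb{F}_q^v$ such that any two distinct members $U,W$ satisfy $\mathrm{d}_{\mathrm s}(U,W)\ge d$, where $\mathrm{d}_{\mathrm s}(U,W)=\dim(U)+\dim(W)-2\dim(U\cap W)$ (a set with a single element is always admissible). -}

module Defs where

open import Level using (Level; _⊔_) renaming (suc to lsuc)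
open import Algebra.Apartness.Bundles using (HeytingField; HeytingCommutativeRing)
open import Algebra.Bundles using (CommutativeRing)
open import Data.Empty using (⊥-elim)
open import Data.Fin.Base using (Fin; zero; suc; combine; finToFun; funToFin)
open import Data.Fin.Properties using (any?; all?; injective⇒≤; finToFun-funToFin; funToFin-finToFin)
  renaming (_≟_ to _≟ᶠ_)
open import Data.Nat.Base as ℕ using (ℕ; _≤_; _<_; _∸_; _^_; z≤n; s≤s; NonZero)
import Data.Nat.Properties as ℕₚ
open import Data.Nat.Primality using (Prime; prime⇒nonTrivial)
open import Data.Product using (∃; ∃-syntax; _×_; _,_; proj₁; proj₂)
open import Data.Vec.Functional using (Vector)
open import Function.Base using (_∘_)
open import Function.Bundles using (Inverse)
open import Function.Definitions using (Injective)
open import Relation.Binary.PropositionalEquality as ≡ using (_≡_; _≢_)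
open import Relation.Nullary using (¬_; Dec; yes; no)
open import Relation.Nullary.Decidable using (map′; _×-dec_; _→-dec_; ¬?)
open import Relation.Unary using (Pred; Decidable; _⊆_; _≐_; _∩_)

PrimePower : ℕ → Set
PrimePower q = ∃[ p ] ∃[ e ] (Prime p × 1 ≤ e × q ≡ p ^ e)

primePower⇒1< : ∀ {q} → PrimePower q → 1 < q
primePower⇒1< (p , e , p-prime , 1≤e , ≡.refl) =
  ℕₚ.^-monoʳ-< p (ℕ.nonTrivial⇒n>1 p {{prime⇒nonTrivial p-prime}}) 1≤e

q^m∸1-nonZero : ∀ {q m} → PrimePower q → 2 ≤ m → NonZero (q ^ m ∸ 1)
q^m∸1-nonZero {q} pp 2≤m = ℕ.>-nonZero
  (ℕₚ.m<n⇒0<n∸m (ℕₚ.^-monoʳ-< q (primePower⇒1< pp) (ℕₚ.<-trans (s≤s z≤n) 2≤m)))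

-- A Heyting field whose setoid of elements is finite automatically has
-- decidable equality, with apartness being inequality.
record FiniteField (c ℓ₁ ℓ₂ : Level) (q : ℕ) : Set (lsuc (c ⊔ ℓ₁ ⊔ ℓ₂)) where
  field
    heytingField : HeytingField c ℓ₁ ℓ₂

  commutativeRing : CommutativeRing c ℓ₁
  commutativeRing = HeytingCommutativeRing.commutativeRing
    (HeytingField.heytingCommutativeRing heytingField)

  field
    enumeration : Inverse (CommutativeRing.setoid commutativeRing) (≡.setoid (Fin q))

private
  funToFin-cong : ∀ {m n} {f g : Fin m → Fin n} → (∀ k → f k ≡ g k) →
                  funToFin f ≡ funToFin g
  funToFin-cong {ℕ.zero}  p = ≡.refl
  funToFin-cong {ℕ.suc m} p = ≡.cong₂ combine (p zero) (funToFin-cong (p ∘ suc))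

  boundedMax : ∀ {ℓ} {P : Pred ℕ ℓ} → Decidable P → P 0 →
               ∀ N → (∀ m → P m → m ≤ N) →
               ∃[ n ] (P n × (∀ m → P m → m ≤ n))
  boundedMax P? P0 ℕ.zero    bound = 0 , P0 , bound
  boundedMax P? P0 (ℕ.suc N) bound with P? (ℕ.suc N)
  ... | yes p = ℕ.suc N , p , bound
  ... | no ¬p = boundedMax P? P0 N λ m Pm →
    ℕₚ.m<1+n⇒m≤n (ℕₚ.≤∧≢⇒< (bound m Pm) λ { ≡.refl → ¬p Pm })

module ConstantDimensionCodes {c ℓ₁ ℓ₂ q} (F : FiniteField c ℓ₁ ℓ₂ q) where

  open FiniteField F
  open CommutativeRing commutativeRing hiding (zero)
  open import Algebra.Properties.CommutativeMonoid.Sum +-commutativeMonoid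
    using (sum-syntax; sum-cong-≋; sum-replicate-zero; ∑-distrib-+)
  open import Algebra.Properties.Semiring.Sum semiring using (*-distribˡ-sum)
  open import Algebra.Properties.Ring ring using (-‿distribˡ-*)
  open import Algebra.Properties.Group +-group using (x∙y⁻¹≈ε⇒x≈y)
  open import Data.Vec.Functional.Relation.Binary.Equality.Setoid setoid
    using (_≋_)

  𝔽 : Set c
  𝔽 = Carrier

  record Subspace (v : ℕ) : Set (lsuc (c ⊔ ℓ₁)) where
    field
      member   : Pred (Vector 𝔽 v) (c ⊔ ℓ₁)
      resp     : ∀ {x y} → x ≋ y → member x → member y
      0-closed : member (λ _ → 0#)
      +-closed : ∀ {x y} → member x → member y → member (λ j → x j + y j)
      *-closed : ∀ a {x} → member x → member (λ j → a * x j)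

  open Subspace public

  infix 4 _≈ₛ_
  _≈ₛ_ : ∀ {v} → Subspace v → Subspace v → Set (c ⊔ ℓ₁)
  U ≈ₛ W = member U ≐ member W

  infixr 7 _∩ₛ_
  _∩ₛ_ : ∀ {v} → Subspace v → Subspace v → Subspace v
  U ∩ₛ W = record
    { member   = member U ∩ member W
    ; resp     = λ x≋y (p , r) → resp U x≋y p , resp W x≋y r
    ; 0-closed = 0-closed U , 0-closed W
    ; +-closed = λ (p , r) (p′ , r′) → +-closed U p p′ , +-closed W r r′
    ; *-closed = λ a (p , r) → *-closed U a p , *-closed W a r
    }

  combination : ∀ {m v} → Vector 𝔽 m → Vector (Vector 𝔽 v) m → Vector 𝔽 v
  combination {m} a b j = ∑[ i < m ] (a i * b i j)

  Span : ∀ {m v} → Vector (Vector 𝔽 v) m → Pred (Vector 𝔽 v) (c ⊔ ℓ₁)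
  Span b x = ∃[ a ] (combination a b ≋ x)

  Independent : ∀ {m v} → Vector (Vector 𝔽 v) m → Set (c ⊔ ℓ₁)
  Independent b = ∀ a → combination a b ≋ (λ _ → 0#) → ∀ i → a i ≈ 0#

  -- dim U = m
  HasDim : ∀ {v} → Subspace v → ℕ → Set (c ⊔ ℓ₁)
  HasDim {v} U m = ∃[ b ] (Independent {m} {v} b × member U ≐ Span b)

  -- d_s(U,W) = δ.  The truncated subtraction is exact, since both dimensions
  -- are at least dim (U ∩ W).
  Distance : ∀ {v} → Subspace v → Subspace v → ℕ → Set (c ⊔ ℓ₁)
  Distance U W δ = ∃[ m ] ∃[ n ] ∃[ s ]
    (HasDim U m × HasDim W n × HasDim (U ∩ₛ W) s × δ ≡ m ℕ.+ n ∸ 2 ℕ.* s)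

  -- A set of n subspaces, presented as an injective family.
  record Code (v d k n : ℕ) : Set (lsuc (c ⊔ ℓ₁)) where
    field
      codeword  : Fin n → Subspace v
      injective : Injective _≡_ _≈ₛ_ codeword
      dimension : ∀ i → HasDim (codeword i) k
      distance  : ∀ {i j} → i ≢ j →
                  ∃[ δ ] (Distance (codeword i) (codeword j) δ × d ≤ δ)

  IsMaximum : (v d k n : ℕ) → Set (lsuc (c ⊔ ℓ₁))
  IsMaximum v d k n = Code v d k n × (∀ m → Code v d k m → m ≤ n)

  -- The maximum exists: every code can be presented by bases, and there are
  -- finitely many of these to search through.
  module Finiteness where
    open Inverse enumeration using (to; from; to-cong; from-cong; strictlyInverseˡ; strictlyInverseʳ)

    infix 4 _≟_
    _≟_ : ∀ x y → Dec (x ≈ y)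
    x ≟ y = map′ to-injective to-cong (to x ≟ᶠ to y)
      where
      to-injective : to x ≡ to y → x ≈ y
      to-injective e =
        trans (sym (strictlyInverseʳ x)) (trans (from-cong e) (strictlyInverseʳ y))

    _≋?_ : ∀ {n} (x y : Vector 𝔽 n) → Dec (x ≋ y)
    x ≋? y = all? λ i → x i ≟ y i

    encode : ∀ {n} → Vector 𝔽 n → Fin (q ^ n)
    encode x = funToFin (to ∘ x)

    decode : ∀ {n} → Fin (q ^ n) → Vector 𝔽 n
    decode i = from ∘ finToFun i

    decode-encode : ∀ {n} (x : Vector 𝔽 n) → decode (encode x) ≋ x
    decode-encode x i = trans
      (from-cong (finToFun-funToFin (to ∘ x) i)) (strictlyInverseʳ (x i))

    encode-injective : ∀ {n} {x y : Vector 𝔽 n} → encode x ≡ encode y → x ≋ y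
    encode-injective {x = x} {y} e i = trans (sym (decode-encode x i))
      (trans (reflexive (≡.cong (λ u → decode u i) e)) (decode-encode y i))

    encode-decode : ∀ {n} (i : Fin (q ^ n)) → encode (decode {n} i) ≡ i
    encode-decode {n} i = ≡.trans
      (funToFin-cong (λ k → strictlyInverseˡ (finToFun {q} {n} i k)))
      (funToFin-finToFin {n} {q} i)

    decode-injective : ∀ {n} {i j : Fin (q ^ n)} → decode {n} i ≋ decode j → i ≡ j
    decode-injective {n} {i} {j} p = ≡.trans (≡.sym (encode-decode {n} i))
      (≡.trans (funToFin-cong (λ k → to-cong (p k))) (encode-decode {n} j))

    Family : (m v : ℕ) → Set c
    Family m v = Vector (Vector 𝔽 v) m

    infix 4 _≋≋_
    _≋≋_ : ∀ {m v} → Family m v → Family m v → Set ℓ₁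
    b ≋≋ b′ = ∀ i → b i ≋ b′ i

    encodeᵇ : ∀ {m v} → Family m v → Fin ((q ^ v) ^ m)
    encodeᵇ b = funToFin (encode ∘ b)

    decodeᵇ : ∀ {m v} → Fin ((q ^ v) ^ m) → Family m v
    decodeᵇ u i = decode (finToFun u i)

    decode-encodeᵇ : ∀ {m v} (b : Family m v) → decodeᵇ (encodeᵇ b) ≋≋ b
    decode-encodeᵇ b i j = trans
      (reflexive (≡.cong (λ u → decode u j) (finToFun-funToFin (encode ∘ b) i)))
      (decode-encode (b i) j)

    encodeᵇ-injective : ∀ {m v} {b b′ : Family m v} → encodeᵇ b ≡ encodeᵇ b′ → b ≋≋ b′
    encodeᵇ-injective {b = b} {b′} e i j = trans (sym (decode-encodeᵇ b i j))
      (trans (reflexive (≡.cong (λ u → decodeᵇ u i j) e)) (decode-encodeᵇ b′ i j))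

    anyV : ∀ {n ℓ} {P : Pred (Vector 𝔽 n) ℓ} → Decidable P →
           (∀ {x y} → x ≋ y → P x → P y) → Dec (∃ P)
    anyV P? resp = map′ (λ (i , p) → decode i , p)
      (λ (x , p) → encode x , resp (sym ∘ decode-encode x) p) (any? (P? ∘ decode))

    allV : ∀ {n ℓ} {P : Pred (Vector 𝔽 n) ℓ} → Decidable P →
           (∀ {x y} → x ≋ y → P x → P y) → Dec (∀ x → P x)
    allV P? resp = map′ (λ f x → resp (decode-encode x) (f (encode x)))
      (λ f i → f (decode i)) (all? (P? ∘ decode))

    anyB : ∀ {m v ℓ} {P : Pred (Family m v) ℓ} → Decidable P →
           (∀ {x y} → x ≋≋ y → P x → P y) → Dec (∃ P)
    anyB P? resp = map′ (λ (i , p) → decodeᵇ i , p)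
      (λ (x , p) → encodeᵇ x , resp (λ i → sym ∘ decode-encodeᵇ x i) p)
      (any? (P? ∘ decodeᵇ))

    combination-cong : ∀ {m v} {a a′ : Vector 𝔽 m} {b b′ : Family m v} →
                       a ≋ a′ → b ≋≋ b′ → combination a b ≋ combination a′ b′
    combination-cong a≋ b≋ j = sum-cong-≋ λ i → *-cong (a≋ i) (b≋ i j)

    combination-0 : ∀ {m v} (b : Family m v) →
                    combination (λ _ → 0#) b ≋ (λ _ → 0#)
    combination-0 {m} b j =
      trans (sum-cong-≋ λ i → zeroˡ (b i j)) (sum-replicate-zero m)

    combination-+ : ∀ {m v} a a′ (b : Family m v) →
                    combination (λ i → a i + a′ i) b ≋
                    (λ j → combination a b j + combination a′ b j)
    combination-+ a a′ b j = trans (sum-cong-≋ λ i → distribʳ (b i j) (a i) (a′ i))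
      (∑-distrib-+ (λ i → a i * b i j) (λ i → a′ i * b i j))

    combination-* : ∀ {m v} r a (b : Family m v) →
                    combination (λ i → r * a i) b ≋ (λ j → r * combination a b j)
    combination-* r a b j = trans (sum-cong-≋ λ i → *-assoc r (a i) (b i j))
      (sym (*-distribˡ-sum r (λ i → a i * b i j)))

    Span-resp : ∀ {m v} {b : Family m v} {x y} → x ≋ y → Span b x → Span b y
    Span-resp x≋y (a , p) = a , λ j → trans (p j) (x≋y j)

    Span-mono : ∀ {m v} {b b′ : Family m v} → b ≋≋ b′ → Span b ⊆ Span b′
    Span-mono {b = b} {b′} b≋ (a , p) = a , λ j →
      trans (combination-cong {a = a} {b = b′} {b} (λ _ → refl) (λ i → sym ∘ b≋ i) j) (p j)

    Span-cong : ∀ {m v} {b b′ : Family m v} → b ≋≋ b′ → Span b ≐ Span b′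
    Span-cong {b = b} {b′} b≋ =
      Span-mono {b = b} {b′} b≋ , Span-mono {b = b′} {b} (λ i → sym ∘ b≋ i)

    span : ∀ {m v} → Family m v → Subspace v
    span b = record
      { member   = Span b
      ; resp     = Span-resp
      ; 0-closed = (λ _ → 0#) , combination-0 b
      ; +-closed = λ (a , p) (a′ , p′) → (λ i → a i + a′ i) , λ j →
          trans (combination-+ a a′ b j) (+-cong (p j) (p′ j))
      ; *-closed = λ r (a , p) → (λ i → r * a i) , λ j →
          trans (combination-* r a b j) (*-congˡ (p j))
      }

    Independent-resp : ∀ {m v} {b b′ : Family m v} → b ≋≋ b′ →
                       Independent b → Independent b′
    Independent-resp b≋ ind a p =
      ind a λ j → trans (combination-cong (λ _ → refl) b≋ j) (p j)

    independent? : ∀ {m v} → Decidable (Independent {m} {v})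
    independent? b = allV
      (λ a → (combination a b ≋? (λ _ → 0#)) →-dec all? (λ i → a i ≟ 0#))
      (λ a≋ f p i → trans (sym (a≋ i))
        (f (λ j → trans (combination-cong {b = b} {b} a≋ (λ _ _ → refl) j) (p j)) i))

    span? : ∀ {m v} (b : Family m v) → Decidable (Span b)
    span? b x = anyV (λ a → combination a b ≋? x)
      (λ a≋ p j → trans (combination-cong {b = b} {b} (sym ∘ a≋) (λ _ _ → refl) j) (p j))

    ⊆? : ∀ {v ℓ} {P Q : Pred (Vector 𝔽 v) ℓ} → Decidable P → Decidable Q →
         (∀ {x y} → x ≋ y → P x → P y) → (∀ {x y} → x ≋ y → Q x → Q y) → Dec (P ⊆ Q)
    ⊆? P? Q? P-resp Q-resp = map′ (λ f {x} → f x) (λ f x → f {x})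
      (allV (λ x → P? x →-dec Q? x) λ x≋y f p → Q-resp x≋y (f (P-resp (sym ∘ x≋y) p)))

    ≐? : ∀ {v ℓ} {P Q : Pred (Vector 𝔽 v) ℓ} → Decidable P → Decidable Q →
         (∀ {x y} → x ≋ y → P x → P y) → (∀ {x y} → x ≋ y → Q x → Q y) → Dec (P ≐ Q)
    ≐? P? Q? P-resp Q-resp = ⊆? P? Q? P-resp Q-resp ×-dec ⊆? Q? P? Q-resp P-resp

    ≐-sym : ∀ {v ℓ} {P Q : Pred (Vector 𝔽 v) ℓ} → P ≐ Q → Q ≐ P
    ≐-sym (f , g) = g , f

    ≐-trans : ∀ {v ℓ} {P Q R : Pred (Vector 𝔽 v) ℓ} → P ≐ Q → Q ≐ R → P ≐ R
    ≐-trans (f , g) (f′ , g′) = (λ p → f′ (f p)) , (λ r → g (g′ r))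

    hasDim? : ∀ {v} (U : Subspace v) → Decidable (member U) → Decidable (HasDim U)
    hasDim? U U? m = anyB
      (λ b → independent? b ×-dec ≐? U? (span? b) (resp U) Span-resp)
      (λ b≋ (ind , eq) → Independent-resp b≋ ind , ≐-trans eq (Span-cong b≋))

    HasDim-resp : ∀ {v m} {U W : Subspace v} → U ≈ₛ W → HasDim U m → HasDim W m
    HasDim-resp U≈W (b , ind , eq) = b , ind , ≐-trans (≐-sym U≈W) eq

    1<q : 1 < q
    1<q = injective⇒≤ {f = bit} bit-injective
      where
      open HeytingField heytingField
        using (_#_; invertible⇒#) renaming (#-irrefl to irrefl)
      1#0 : 1# # 0#
      1#0 = invertible⇒# (1# , trans (*-identityˡ _) 1-0 , trans (*-identityʳ _) 1-0)
        where
        1-0 : 1# - 0# ≈ 1#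
        1-0 = trans (+-congˡ (trans (sym (+-identityˡ _)) (-‿inverseʳ 0#))) (+-identityʳ 1#)
      to1≢to0 : to 1# ≢ to 0#
      to1≢to0 e = irrefl
        (trans (sym (strictlyInverseʳ 1#)) (trans (from-cong e) (strictlyInverseʳ 0#))) 1#0
      bit : Fin 2 → Fin q
      bit zero    = to 0#
      bit (suc _) = to 1#
      bit-injective : Injective _≡_ _≡_ bit
      bit-injective {zero}     {zero}     _ = ≡.refl
      bit-injective {zero}     {suc zero} e = ⊥-elim (to1≢to0 (≡.sym e))
      bit-injective {suc zero} {zero}     e = ⊥-elim (to1≢to0 e)
      bit-injective {suc zero} {suc zero} _ = ≡.refl

    independent⇒≤ : ∀ {m v} (b : Family m v) → Independent b → m ≤ v
    independent⇒≤ {m} {v} b ind = ℕₚ.≮⇒≥ λ v<m →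
      ℕₚ.<⇒≱ (ℕₚ.^-monoʳ-< q 1<q v<m) (injective⇒≤ {f = f} f-injective)
      where
      f : Fin (q ^ m) → Fin (q ^ v)
      f i = encode (combination (decode i) b)
      coefficients : ∀ a a′ → combination a b ≋ combination a′ b → a ≋ a′
      coefficients a a′ p i = x∙y⁻¹≈ε⇒x≈y (a i) (a′ i) (trans
        (+-congˡ (trans (-‿cong (sym (*-identityˡ (a′ i)))) (-‿distribˡ-* 1# (a′ i))))
        (ind (λ i → a i + - 1# * a′ i) (λ j → trans (combination-+ a _ b j)
          (trans (+-cong (p j) (trans (combination-* (- 1#) a′ b j)
            (trans (sym (-‿distribˡ-* 1# _)) (-‿cong (*-identityˡ _)))))
          (-‿inverseʳ _))) i))
      f-injective : Injective _≡_ _≡_ f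
      f-injective {i} {j} e = decode-injective {m} {i} {j}
        (coefficients (decode i) (decode j) (encode-injective e))

    HasDim⇒≤ : ∀ {v m} (U : Subspace v) → HasDim U m → m ≤ v
    HasDim⇒≤ U (b , ind , _) = independent⇒≤ b ind

    Far : ∀ {v} → ℕ → Subspace v → Subspace v → Set (c ⊔ ℓ₁)
    Far d U W = ∃[ δ ] (Distance U W δ × d ≤ δ)

    Far-resp : ∀ {v d} {U U′ W W′ : Subspace v} → U ≈ₛ U′ → W ≈ₛ W′ →
               Far d U W → Far d U′ W′
    Far-resp {U = U} {U′} {W} {W′} U≈ W≈ (δ , (m , n , s , hU , hW , hI , e) , d≤δ) =
      δ , (m , n , s , HasDim-resp {U = U} {U′} U≈ hU , HasDim-resp {U = W} {W′} W≈ hW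
          , HasDim-resp {U = U ∩ₛ W} {U′ ∩ₛ W′}
              ( (λ (p , r) → proj₁ U≈ p , proj₁ W≈ r)
              , (λ (p , r) → proj₂ U≈ p , proj₂ W≈ r)) hI
          , e) , d≤δ

    far? : ∀ {v} d (U W : Subspace v) → Decidable (member U) → Decidable (member W) →
           Dec (Far d U W)
    far? {v} d U W U? W? = map′
      (λ (m , _ , n , _ , s , _ , hU , hW , hI , d≤) →
        m ℕ.+ n ∸ 2 ℕ.* s , (m , n , s , hU , hW , hI , ≡.refl) , d≤)
      (λ { (_ , (m , n , s , hU , hW , hI , ≡.refl) , d≤) →
        m , s≤s (HasDim⇒≤ U hU) , n , s≤s (HasDim⇒≤ W hW) ,
        s , s≤s (HasDim⇒≤ (U ∩ₛ W) hI) , hU , hW , hI , d≤ })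
      (ℕₚ.anyUpTo? (λ m → ℕₚ.anyUpTo? (λ n → ℕₚ.anyUpTo? (λ s →
        hasDim? U U? m ×-dec hasDim? W W? n ×-dec
        hasDim? (U ∩ₛ W) (λ x → U? x ×-dec W? x) s ×-dec
        d ℕₚ.≤? (m ℕ.+ n ∸ 2 ℕ.* s)) (ℕ.suc v)) (ℕ.suc v)) (ℕ.suc v))

    code? : ∀ v d k n → Dec (Code v d k n)
    code? v d k n = map′ fromBases toBases (any? good?)
      where
      basis : Fin (((q ^ v) ^ k) ^ n) → Fin n → Family k v
      basis B i = decodeᵇ (finToFun B i)

      Good : Pred (Fin (((q ^ v) ^ k) ^ n)) (c ⊔ ℓ₁)
      Good B = (∀ i → Independent (basis B i))
             × (∀ i j → Span (basis B i) ≐ Span (basis B j) → i ≡ j)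
             × (∀ i j → i ≢ j → Far d (span (basis B i)) (span (basis B j)))

      good? : Decidable Good
      good? B = all? (λ i → independent? (basis B i))
        ×-dec all? (λ i → all? λ j →
          ≐? (span? (basis B i)) (span? (basis B j)) Span-resp Span-resp →-dec (i ≟ᶠ j))
        ×-dec all? (λ i → all? λ j → ¬? (i ≟ᶠ j) →-dec
          far? d (span (basis B i)) (span (basis B j)) (span? (basis B i)) (span? (basis B j)))

      fromBases : ∃ Good → Code v d k n
      fromBases (B , ind , inj , far) = record
        { codeword  = span ∘ basis B
        ; injective = inj _ _
        ; dimension = λ i → basis B i , ind i , (λ p → p) , (λ p → p)
        ; distance  = far _ _
        }

      toBases : Code v d k n → ∃ Good
      toBases C = B
        , (λ i → Independent-resp (λ j l → sym (basis≋ i j l)) (proj₁ (proj₂ (dimension i))))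
        , (λ i j eq → injective (≐-trans (U≐ i) (≐-trans eq (≐-sym (U≐ j)))))
        , (λ i j i≢j → Far-resp {U = codeword i} {span (basis B i)}
            {codeword j} {span (basis B j)} (U≐ i) (U≐ j) (distance i≢j))
        where
        open Code C
        b : Fin n → Family k v
        b i = proj₁ (dimension i)
        B : Fin (((q ^ v) ^ k) ^ n)
        B = funToFin (encodeᵇ ∘ b)
        basis≋ : ∀ i → basis B i ≋≋ b i
        basis≋ i j l = trans
          (reflexive (≡.cong (λ u → decodeᵇ u j l) (finToFun-funToFin (encodeᵇ ∘ b) i)))
          (decode-encodeᵇ (b i) j l)
        U≐ : ∀ i → member (codeword i) ≐ Span (basis B i)
        U≐ i = ≐-trans (proj₂ (proj₂ (dimension i)))
          (Span-cong (λ j l → sym (basis≋ i j l)))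

    emptyCode : ∀ v d k → Code v d k 0
    emptyCode v d k = record
      { codeword  = λ ()
      ; injective = λ { {()} }
      ; dimension = λ ()
      ; distance  = λ { {()} }
      }

    code-bounded : ∀ v d k n → Code v d k n → n ≤ (q ^ v) ^ k
    code-bounded v d k n C = injective⇒≤ {f = f} f-injective
      where
      open Code C
      f : Fin n → Fin ((q ^ v) ^ k)
      f i = encodeᵇ (proj₁ (dimension i))
      f-injective : Injective _≡_ _≡_ f
      f-injective {i} {j} e = injective (≐-trans (proj₂ (proj₂ (dimension i)))
        (≐-trans (Span-cong (encodeᵇ-injective e)) (≐-sym (proj₂ (proj₂ (dimension j))))))

  open Finiteness

  opaque
    maximum : ∀ v d k → ∃ (IsMaximum v d k)
    maximum v d k = boundedMax (code? v d k) (emptyCode v d k)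
      ((q ^ v) ^ k) (code-bounded v d k)

  -- A_q(v,d;k)
  A : (v d k : ℕ) → ℕ
  A v d k = proj₁ (maximum v d k)

  A-isMaximum : ∀ v d k → IsMaximum v d k (A v d k)
  A-isMaximum v d k = proj₂ (maximum v d k)

{-# OPTIONS --safe #-}

-- For v = 2k the two code sizes agree, since taking orthogonal complements turns
-- (k-1)-dimensional into k-dimensional subspaces of a (2k-1)-dimensional space and
-- preserves the minimum distance.
--
-- Let v > 2k, n = v - 1, d = 2δ and t = k - δ.  Every t-dimensional subspace of the
-- n-dimensional space lies in at most one codeword of dimension k - 1, which bounds
-- A(n,d;k-1) by ∏_{i<t} (q^n - q^i) / (q^(k-1) - q^i).  Lifted Gabidulin codes give
-- A(n,d;k) ≥ q^((n-k)(t+1)).  By Weierstrass' inequality ∏ (1 - x_i) ≥ 1 - ∑ x_i the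
-- two sides then differ by at least 1 before rounding, even for q = δ = 2.
--
-- Gabidulin codes need the field with q^m elements.  In R = F[X]/(X^(q^m-1) - 1)
-- every element satisfies z^(q^m) = z, so R is von Neumann regular, and the product P
-- of the X^(q^i-1) - 1 over 0 < i < m is nonzero for degree reasons.  Hence R has a
-- residue field in which P survives.  There X has m distinct conjugates, so that
-- 1, X, ..., X^(m-1) are independent; they span because the Frobenius map has order m.

module Submission where

open import Defs
open import Level using (Lift; lift; lower; _⊔_) renaming (suc to lsuc)
open import Algebra.Apartness.Bundles using (HeytingField)
open import Algebra.Bundles using (CommutativeRing)
import Algebra.Properties.Semiring.Exp as Exp
open import Data.Empty using (⊥-elim)
open import Data.Fin.Base using (Fin; zero; suc; toℕ; fromℕ; inject₁; punchIn; splitAt; _↑ˡ_; _↑ʳ_; combine; finToFun; funToFin)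
open import Data.Fin.Permutation using (Permutation; permutation; _⟨$⟩ʳ_)
open import Data.Fin.Properties using (all?; any?; toℕ<n; toℕ-injective; toℕ-inject₁; toℕ-fromℕ; suc-injective; punchInᵢ≢i; fromℕ<-injective; funToFin-finToFin)
  renaming (_≟_ to _≟ᶠ_)
open import Data.Nat.Base as ℕ using (ℕ; zero; suc; _≤_; _∸_; NonZero)
open import Data.Nat.Combinatorics using (nCn≡1) renaming (_C_ to _choose_)
import Data.Nat.Properties as ℕ
open import Data.Product using (∃; _×_; _,_; proj₁; proj₂)
open import Data.Sum.Base using (_⊎_; inj₁; inj₂; [_,_]′)
open import Data.Vec.Functional using (Vector; _∷_; []; _++_; removeAt)
open import Data.Vec.Functional.Properties using (lookup-++ˡ; lookup-++ʳ)
open import Function.Base using (_∘_)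
open import Function.Bundles using (Inverse)
open import Function.Definitions using (Injective)
open import Relation.Binary.Definitions using (tri<; tri≈; tri>)
open import Relation.Binary.PropositionalEquality as ≡ using (_≡_; _≢_)
open import Relation.Nullary using (¬_; Dec; contradiction; yes; no)
open import Relation.Nullary.Decidable using (map′; _×-dec_; ¬?; decidable-stable)
open import Relation.Unary using (Pred; Decidable; _⊆_)

-- The estimate is tightest for `q = δ = 2`. After division by `q^v - 1`, the plain powers of `q`
-- favour the right side only by the factor `q^(δ-1)`, while Weierstrass' inequality can cost nearly
-- `q / (q - 1)`, which is just as much when `q = δ = 2`. What survives between the two bounds is a
-- factor `q^(t+1) / (q^(t+1) + 1)`. It still separates the floors, because `q^v - 1` is at least
-- `(q^(t+1) + 1) (q^(v-k) - 1)`. A residue field of R replaces the usual quotient by an irreducible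
-- polynomial, since then no such polynomial has to be exhibited: R is finite, so a multiple of P
-- whose annihilator is a maximal ideal can be reached by going through the elements of R one by
-- one.

-- Floors and the numerical inequality between the two bounds.

module Arithmetic where

  open import Data.Integer.Base as ℤ using (+_)
  import Data.Integer.DivMod as ℤ
  import Data.Integer.Properties as ℤ
  open import Data.Nat.Base
  open import Data.Nat.DivMod using (m/n*n≤m; m*n/n≡m; /-monoˡ-≤)
  open import Data.Nat.Properties
  open import Data.Nat.Solver using (module +-*-Solver)
  open import Data.Rational.Unnormalised.Base as ℚᵘ using (floor)
  open import Relation.Binary.PropositionalEquality

  floor-*/ : ∀ V M a .{{_ : NonZero a}} →
             floor ((+ V ℚᵘ./ a) ℚᵘ.* (+ M ℚᵘ./ 1)) ≡ + (V * M / a)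
  floor-*/ V M a@(suc a′) rewrite *-identityʳ a′ | sym (ℤ.pos-* V M) =
    ℤ.div-pos-is-/ℕ (+ (V * M)) a

  -- The hypothesis is `x / a + 1 ≤ y / b` over the rationals with denominators cleared; a gap of at
  -- least 1 forces the floors apart.
  /-strict : ∀ x y a b .{{_ : NonZero a}} .{{_ : NonZero b}} →
             x * b + a * b ≤ y * a → x / a < y / b
  /-strict x y a b h = begin
    suc (x / a)             ≡⟨ m*n/n≡m (suc (x / a)) b ⟨
    suc (x / a) * b / b     ≤⟨ /-monoˡ-≤ b (*-cancelˡ-≤ a (begin
      a * (suc (x / a) * b)
        ≡⟨ solve 3 (λ a b c → a :* ((con 1 :+ c) :* b) := (c :* a) :* b :+ a :* b) refl a b (x / a) ⟩
      (x / a * a) * b + a * b     ≤⟨ +-monoˡ-≤ (a * b) (*-monoˡ-≤ b (m/n*n≤m x a)) ⟩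
      x * b + a * b               ≤⟨ h ⟩
      y * a                       ≡⟨ *-comm y a ⟩
      a * y                       ∎)) ⟩
    y / b                   ∎
    where
    open ≤-Reasoning
    open +-*-Solver

  -- The number of ways to extend s independent vectors of an m-dimensional
  -- space over a field with q elements by r further independent ones.
  extensions : ℕ → ℕ → ℕ → ℕ → ℕ
  extensions q m s zero    = 1
  extensions q m s (suc r) = (q ^ m ∸ q ^ s) * extensions q m (suc s) r

  extensions-≤ : ∀ q m s r → extensions q m s r ≤ (q ^ m) ^ r
  extensions-≤ q m s zero    = ≤-refl
  extensions-≤ q m s (suc r) = *-mono-≤ (m∸n≤m (q ^ m) (q ^ s)) (extensions-≤ q m (suc s) r)

  -- Weierstrass' inequality ∏ (1 - q^(i-m)) ≥ 1 - ∑ q^(i-m) ≥ 1 - (q^(s+r) - q^s) / q^m.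
  extensions-≥ : ∀ q m s r → 2 ≤ q → s + r ≤ m →
                 (q ^ m) ^ r * (q ^ m + q ^ s) ≤
                 q ^ m * extensions q m s r + (q ^ m) ^ r * q ^ (s + r)
  extensions-≥ q m s zero    _   _ = ≤-reflexive (begin
    1 * (q ^ m + q ^ s)
      ≡⟨ solve 2 (λ a b → con 1 :* (a :+ b) := a :* con 1 :+ con 1 :* b) refl (q ^ m) (q ^ s) ⟩
    q ^ m * 1 + 1 * q ^ s            ≡⟨ cong (λ z → q ^ m * 1 + 1 * q ^ z) (+-identityʳ s) ⟨
    q ^ m * 1 + 1 * q ^ (s + 0)      ∎)
    where
    open ≡-Reasoning
    open +-*-Solver
  extensions-≥ 1 m s (suc r) (s≤s ())
  -- Adding `x * Z * y` on both sides turns `x + y` on the left into `x + 2y ≤ x + q * y`, where the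
  -- induction hypothesis at `suc s` starts. On the right it pays for splitting `x` into `w + y`,
  -- since `y * G ≤ y * Z`.
  extensions-≥ q@(suc (suc p)) m s (suc r) 2≤q s+r≤m = +-cancelʳ-≤ (x * Z * y) _ _ (begin
    x * Z * (x + y) + x * Z * y               ≤⟨ m≤m+n _ (x * Z * (p * y)) ⟩
    x * Z * (x + y) + x * Z * y + x * Z * (p * y)
      ≡⟨ solve 4 (λ p x y Z → x :* Z :* (x :+ y) :+ x :* Z :* y :+ x :* Z :* (p :* y)
           := x :* (Z :* (x :+ (con 2 :+ p) :* y))) refl p x y Z ⟩
    x * (Z * (x + q * y))                     ≤⟨ *-monoʳ-≤ x (extensions-≥ q m (suc s) r 2≤q 1+s+r≤m) ⟩
    x * (x * G + Z * T)                       ≡⟨ cong (λ z → x * (z * G + Z * T)) (m∸n+n≡m y≤x) ⟨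
    x * ((w + y) * G + Z * T)
      ≡⟨ solve 6 (λ x y w G Z T → x :* ((w :+ y) :* G :+ Z :* T)
           := x :* (w :* G) :+ x :* Z :* T :+ x :* y :* G) refl x y w G Z T ⟩
    x * (w * G) + x * Z * T + x * y * G
      ≤⟨ +-monoʳ-≤ (x * (w * G) + x * Z * T) (*-monoʳ-≤ (x * y) (extensions-≤ q m (suc s) r)) ⟩
    x * (w * G) + x * Z * T + x * y * Z
      ≡⟨ cong₂ (λ u z → x * (w * G) + x * Z * q ^ u + z) (sym (+-suc s r))
           (trans (*-assoc x y Z) (trans (cong (x *_) (*-comm y Z)) (sym (*-assoc x Z y)))) ⟩
    x * (w * G) + x * Z * q ^ (s + suc r) + x * Z * y ∎)
    where
    open ≤-Reasoning
    open +-*-Solver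
    1+s+r≤m : suc s + r ≤ m
    1+s+r≤m = subst (_≤ m) (+-suc s r) s+r≤m
    x = q ^ m
    y = q ^ s
    Z = x ^ r
    w = x ∸ y
    G = extensions q m (suc s) r
    T = q ^ (suc s + r)
    y≤x : y ≤ x
    y≤x = ^-monoʳ-≤ q (≤-trans (m≤m+n s (suc r)) s+r≤m)

  private
    -- with x = q^(k-1), y = q^t, a = q^k - 1
    upper-bound-aux : ∀ q x y Z M a → 2 ≤ q → 1 ≤ y → q * y ≤ x → suc a ≡ q * x →
                      M * (x + 1) ≤ Z * x + M * y → M * (q * y + 1) ≤ Z * a
    upper-bound-aux q x y Z M a 2≤q 1≤y qy≤x 1+a≡qx h =
      *-cancelʳ-≤ _ _ w {{>-nonZero 0<w}} (begin
        M * (q * y + 1) * w     ≡⟨ solve 3 (λ M b w → M :* b :* w := M :* w :* b) refl M (q * y + 1) w ⟩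
        M * w * (q * y + 1)     ≤⟨ *-monoˡ-≤ (q * y + 1) Mw≤Zx ⟩
        Z * x * (q * y + 1)     ≡⟨ *-assoc Z x (q * y + 1) ⟩
        Z * (x * (q * y + 1))   ≤⟨ *-monoʳ-≤ Z key ⟩
        Z * (a * w)             ≡⟨ *-assoc Z a w ⟨
        Z * a * w               ∎)
      where
      open ≤-Reasoning
      open +-*-Solver
      y≤x : y ≤ x
      y≤x = ≤-trans (m≤n*m y q {{>-nonZero (≤-trans (s≤s z≤n) 2≤q)}}) qy≤x
      w = x + 1 ∸ y
      w+y : w + y ≡ x + 1
      w+y = m∸n+n≡m (≤-trans y≤x (m≤m+n x 1))
      0<w : 0 < w
      0<w = m<n⇒0<n∸m (≤-trans (s≤s y≤x) (≤-reflexive (+-comm 1 x)))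
      Mw≤Zx : M * w ≤ Z * x
      Mw≤Zx = +-cancelʳ-≤ (M * y) _ _ (begin
        M * w + M * y   ≡⟨ *-distribˡ-+ M w y ⟨
        M * (w + y)     ≡⟨ cong (M *_) w+y ⟩
        M * (x + 1)     ≤⟨ h ⟩
        Z * x + M * y   ∎)
      -- With all subtractions undone, three terms are compared separately, using `2 ≤ q`,
      -- `q * y ≤ x` and `1 ≤ y`. There is no slack: equality holds for `q = 2`, `y = 1`, `x = 2`.
      key : x * (q * y + 1) ≤ a * w
      key = +-cancelʳ-≤ (q * x * y + (x + 1)) _ _ (begin
        x * (q * y + 1) + (q * x * y + (x + 1))
          ≡⟨ solve 3 (λ q x y → x :* (q :* y :+ con 1) :+ (q :* x :* y :+ (x :+ con 1))
               := con 2 :* (q :* y :* x) :+ con 2 :* x :+ con 1) refl q x y ⟩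
        2 * (q * y * x) + 2 * x + 1
          ≤⟨ +-mono-≤ (+-mono-≤ (*-mono-≤ 2≤q (*-monoˡ-≤ x qy≤x)) (*-monoˡ-≤ x 2≤q)) 1≤y ⟩
        q * (x * x) + q * x + y
          ≡⟨ solve 3 (λ q x y → q :* (x :* x) :+ q :* x :+ y := q :* x :* (x :+ con 1) :+ y) refl q x y ⟩
        q * x * (x + 1) + y           ≡⟨ cong₂ (λ u z → u * z + y) (sym 1+a≡qx) (sym w+y) ⟩
        suc a * (w + y) + y           ≡⟨ solve 3 (λ a w y → (con 1 :+ a) :* (w :+ y) :+ y
               := a :* w :+ ((con 1 :+ a) :* y :+ (w :+ y))) refl a w y ⟩
        a * w + (suc a * y + (w + y)) ≡⟨ cong₂ (λ u z → a * w + (u * y + z)) 1+a≡qx w+y ⟩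
        a * w + (q * x * y + (x + 1)) ∎)

    -- with p = q^m, P = q^(m t), b = q^(m+1) - 1, V = q^v - 1
    comparison-aux : ∀ q x y p P M₁ M₂ a b V → 2 ≤ q → 1 ≤ y → q * y ≤ x → 1 ≤ p * P →
                     suc a ≡ q * x → suc b ≡ q * p → suc V ≡ q * p * (q * x) →
                     M₁ * (q * y + 1) ≤ P * y * a → p * P ≤ M₂ →
                     V * M₁ * b + a * b ≤ V * M₂ * a
    comparison-aux q x y p P M₁ M₂ a b V 2≤q 1≤y qy≤x 1≤pP 1+a≡ 1+b≡ 1+V≡ M₁≤ ≤M₂ =
      -- Of the `c = q * y + 1` copies of `V * (p * P) * a` on the right, `q * y` absorb the bound
      -- on `M₁`, by `b ≤ q * p`, and the last one absorbs the unit gap `a * b`, by `c * b ≤ V`.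
      *-cancelˡ-≤ c {{>-nonZero (m≤n+m 1 (q * y))}} (begin
        c * (V * M₁ * b + a * b)
          ≡⟨ solve 5 (λ c V M a b → c :* (V :* M :* b :+ a :* b)
               := M :* c :* (V :* b) :+ c :* b :* a) refl c V M₁ a b ⟩
        M₁ * c * (V * b) + c * b * a            ≤⟨ +-mono-≤ (*-monoˡ-≤ (V * b) M₁≤) (*-monoˡ-≤ a cb≤V) ⟩
        P * y * a * (V * b) + V * a
          ≤⟨ +-mono-≤ (*-monoʳ-≤ (P * y * a) (*-monoʳ-≤ V b≤qp)) (≤-trans (≤-reflexive (sym (*-identityˡ (V * a)))) (*-monoˡ-≤ (V * a) 1≤pP)) ⟩
        P * y * a * (V * (q * p)) + p * P * (V * a)
          ≡⟨ solve 6 (λ q y p P a V → P :* y :* a :* (V :* (q :* p)) :+ p :* P :* (V :* a)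
               := (q :* y :+ con 1) :* (V :* (p :* P) :* a)) refl q y p P a V ⟩
        c * (V * (p * P) * a)                   ≤⟨ *-monoʳ-≤ c (*-monoˡ-≤ a (*-monoʳ-≤ V ≤M₂)) ⟩
        c * (V * M₂ * a)                        ∎)
      where
      open ≤-Reasoning
      open +-*-Solver
      c = q * y + 1
      b≤qp : b ≤ q * p
      b≤qp = ≤-trans (n≤1+n b) (≤-reflexive 1+b≡)
      1≤x : 1 ≤ x
      1≤x = ≤-trans (*-mono-≤ (≤-trans (s≤s z≤n) 2≤q) 1≤y) qy≤x
      c≤qx : c ≤ q * x
      c≤qx = begin
        q * y + 1  ≤⟨ +-mono-≤ qy≤x 1≤x ⟩
        x + x      ≡⟨ cong (λ z → x + z) (sym (+-identityʳ x)) ⟩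
        2 * x      ≤⟨ *-monoˡ-≤ x 2≤q ⟩
        q * x      ∎
      cb≤V : c * b ≤ V
      cb≤V = s≤s⁻¹ (begin
        1 + c * b           ≤⟨ +-mono-≤ (m≤n+m 1 (q * y)) ≤-refl ⟩
        c + c * b           ≡⟨ *-suc c b ⟨
        c * suc b           ≤⟨ *-monoˡ-≤ (suc b) c≤qx ⟩
        q * x * suc b       ≡⟨ cong (q * x *_) 1+b≡ ⟩
        q * x * (q * p)     ≡⟨ *-comm (q * x) (q * p) ⟩
        q * p * (q * x)     ≡⟨ 1+V≡ ⟨
        suc V               ∎)

  -- Here `k = suc κ` and `v - k = suc m`, so `κ + suc m` is the dimension `v - 1` of the ambient
  -- space. The bounds on `M₁` and `M₂` are those of the anticode argument and of the lifted
  -- Gabidulin code; the conclusion is the hypothesis of `/-strict`.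
  comparison : ∀ q κ t m M₁ M₂ → 2 ≤ q → suc t ≤ κ →
               M₁ * extensions q κ 0 t ≤ (q ^ (κ + suc m)) ^ t → (q ^ m) ^ suc t ≤ M₂ →
               let a = q ^ suc κ ∸ 1; b = q ^ suc m ∸ 1; V = q ^ (suc m + suc κ) ∸ 1
               in V * M₁ * b + a * b ≤ V * M₂ * a
  comparison q@(suc _) κ t m M₁ M₂ 2≤q t<κ M₁≤ ≤M₂ =
    comparison-aux q (q ^ κ) (q ^ t) (q ^ m) ((q ^ m) ^ t) M₁ M₂ _ _ _ 2≤q (1≤^ q t) qy≤x
      (*-mono-≤ (1≤^ q m) (1≤^ (q ^ m) t {{m^n≢0 q m}}))
      (1+∸ (suc κ)) (1+∸ (suc m))
      (trans (1+∸ (suc m + suc κ)) (^-distribˡ-+-* q (suc m) (suc κ)))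
      (upper-bound-aux q x y Z M₁ _ 2≤q (1≤^ q t) qy≤x (1+∸ (suc κ)) bound)
      ≤M₂
    where
    open ≤-Reasoning
    open +-*-Solver
    1≤^ : ∀ q n .{{_ : NonZero q}} → 1 ≤ q ^ n
    1≤^ q n = >-nonZero⁻¹ (q ^ n) {{m^n≢0 q n}}
    1+∸ : ∀ n → suc (q ^ n ∸ 1) ≡ q ^ n
    1+∸ n = trans (+-comm 1 _) (m∸n+n≡m (1≤^ q n))
    qy≤x : q ^ suc t ≤ q ^ κ
    qy≤x = ^-monoʳ-≤ q t<κ
    x = q ^ κ
    y = q ^ t
    Z = (q ^ m) ^ t * y
    G = extensions q κ 0 t
    Zxᵗ : (q ^ (κ + suc m)) ^ t ≡ Z * x ^ t
    Zxᵗ = begin-equality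
      (q ^ (κ + suc m)) ^ t       ≡⟨ ^-*-assoc q (κ + suc m) t ⟩
      q ^ ((κ + suc m) * t)
        ≡⟨ cong (q ^_) (solve 3 (λ κ m t → (κ :+ (con 1 :+ m)) :* t := (m :* t :+ t) :+ κ :* t) refl κ m t) ⟩
      q ^ ((m * t + t) + κ * t)   ≡⟨ ^-distribˡ-+-* q (m * t + t) (κ * t) ⟩
      q ^ (m * t + t) * q ^ (κ * t) ≡⟨ cong₂ _*_ (^-distribˡ-+-* q (m * t) t) (sym (^-*-assoc q κ t)) ⟩
      q ^ (m * t) * y * x ^ t     ≡⟨ cong (λ z → z * y * x ^ t) (sym (^-*-assoc q m t)) ⟩
      Z * x ^ t                   ∎
    bound : M₁ * (x + 1) ≤ Z * x + M₁ * y
    bound = *-cancelʳ-≤ _ _ (x ^ t) {{m^n≢0 x t {{m^n≢0 q κ}}}} (begin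
      M₁ * (x + 1) * x ^ t
        ≡⟨ solve 3 (λ M u X → M :* u :* X := M :* (X :* u)) refl M₁ (x + 1) (x ^ t) ⟩
      M₁ * (x ^ t * (x + 1))          ≤⟨ *-monoʳ-≤ M₁ (extensions-≥ q κ 0 t 2≤q (≤-trans (n≤1+n t) t<κ)) ⟩
      M₁ * (x * G + x ^ t * y)
        ≡⟨ solve 5 (λ M x G X y → M :* (x :* G :+ X :* y) := x :* (M :* G) :+ M :* y :* X) refl M₁ x G (x ^ t) y ⟩
      x * (M₁ * G) + M₁ * y * x ^ t   ≤⟨ +-monoˡ-≤ _ (*-monoʳ-≤ x M₁≤) ⟩
      x * (q ^ (κ + suc m)) ^ t + M₁ * y * x ^ t ≡⟨ cong (λ z → x * z + M₁ * y * x ^ t) Zxᵗ ⟩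
      x * (Z * x ^ t) + M₁ * y * x ^ t
        ≡⟨ solve 5 (λ x Z X M y → x :* (Z :* X) :+ M :* y :* X := (Z :* x :+ M :* y) :* X) refl x Z (x ^ t) M₁ y ⟩
      (Z * x + M₁ * y) * x ^ t        ∎)

-- Binomial expansion and additivity of the Frobenius map.

module Frobenius {c ℓ} (R : CommutativeRing c ℓ) where
  open CommutativeRing R hiding (zero)
  open import Algebra.Properties.Semiring.Exp semiring using (_^_)
  open import Algebra.Properties.CommutativeMonoid.Sum +-commutativeMonoid
  open import Algebra.Properties.Semiring.Mult semiring using (×-assoc-*; ×-congʳ; ×-homo-1) renaming (_×_ to _·_)
  open import Algebra.Properties.CommutativeSemiring.Binomial commutativeSemiring using (theorem)
  open import Relation.Binary.Reasoning.Setoid setoid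

  1^n≈1 : ∀ n → 1# ^ n ≈ 1#
  1^n≈1 zero    = refl
  1^n≈1 (suc n) = trans (*-identityˡ _) (1^n≈1 n)

  -- Throughout this module `q` is one less than the exponent. The two outer terms are split off
  -- because the coefficients of the others are the ones that vanish when the exponent is the order
  -- of a finite field.
  expand : ∀ q x y → (x + y) ^ suc q ≈
           y ^ suc q + (∑[ k < q ] ((suc q choose suc (toℕ k)) · (x ^ suc (toℕ k) * y ^ (q ℕ.∸ toℕ k))) + x ^ suc q)
  expand q x y = begin
    (x + y) ^ suc q                           ≈⟨ theorem (suc q) x y ⟩
    t zero + ∑[ k ≤ q ] t (suc k)             ≈⟨ +-cong t₀ (sum-init-last (t ∘ suc)) ⟩
    y ^ suc q + (∑[ k < q ] t (suc (inject₁ k)) + t (fromℕ (suc q)))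
      ≈⟨ +-congˡ (+-cong (sum-cong-≋ {q} λ k → reflexive (≡.cong (λ j → (suc q choose suc j) · (x ^ suc j * y ^ (q ℕ.∸ j))) (toℕ-inject₁ k))) tₗ) ⟩
    _                                         ∎
    where
    term : ℕ → Carrier
    term k = (suc q choose k) · (x ^ k * y ^ (suc q ℕ.∸ k))
    t : Fin (suc (suc q)) → Carrier
    t k = term (toℕ k)
    t₀ : t zero ≈ y ^ suc q
    t₀ = trans (×-homo-1 _) (*-identityˡ _)
    tₗ : t (fromℕ (suc q)) ≈ x ^ suc q
    tₗ = begin
      t (fromℕ (suc q))             ≡⟨ ≡.cong term (toℕ-fromℕ (suc q)) ⟩
      term (suc q)
        ≡⟨ ≡.cong₂ (λ a b → a · (x ^ suc q * y ^ b)) (nCn≡1 (suc q)) (ℕ.n∸n≡0 (suc q)) ⟩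
      1 · (x ^ suc q * 1#)          ≈⟨ ×-homo-1 _ ⟩
      x ^ suc q * 1#                ≈⟨ *-identityʳ _ ⟩
      x ^ suc q                     ∎

  -- The hypothesis concerns only integer multiples of `1#`, so once known in the base field it
  -- passes to every algebra over it.
  frobenius-+ : ∀ q → (∀ (k : Fin q) → (suc q choose suc (toℕ k)) · 1# ≈ 0#) →
                ∀ x y → (x + y) ^ suc q ≈ x ^ suc q + y ^ suc q
  frobenius-+ q C≈0 x y = begin
    (x + y) ^ suc q                         ≈⟨ expand q x y ⟩
    y ^ suc q + (∑[ k < q ] t k + x ^ suc q)
      ≈⟨ +-congˡ (+-congʳ (trans (sum-cong-≋ {q} t≈0) (sum-replicate-zero q))) ⟩
    y ^ suc q + (0# + x ^ suc q)            ≈⟨ +-congˡ (+-identityˡ _) ⟩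
    y ^ suc q + x ^ suc q                   ≈⟨ +-comm _ _ ⟩
    x ^ suc q + y ^ suc q                   ∎
    where
    u : Fin q → Carrier
    u k = x ^ suc (toℕ k) * y ^ (q ℕ.∸ toℕ k)
    t : Fin q → Carrier
    t k = (suc q choose suc (toℕ k)) · u k
    t≈0 : ∀ k → t k ≈ 0#
    t≈0 k = begin
      n · u k          ≈⟨ ×-congʳ n (sym (*-identityˡ (u k))) ⟩
      n · (1# * u k)   ≈⟨ ×-assoc-* n 1# (u k) ⟨
      n · 1# * u k     ≈⟨ *-congʳ (C≈0 k) ⟩
      0# * u k         ≈⟨ zeroˡ (u k) ⟩
      0#               ∎
      where n = suc q choose suc (toℕ k)

-- Polynomials and roots over a field.

-- A decided form of the field axiom. It mentions no apartness relation, so a quotient ring can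
-- satisfy it directly.
Invertible-or-zero : ∀ {c ℓ} → CommutativeRing c ℓ → Set _
Invertible-or-zero R = ∀ x → x ≈ 0# ⊎ ∃ λ y → x * y ≈ 1#
  where open CommutativeRing R

module FieldProperties {c ℓ} (R : CommutativeRing c ℓ) (inverse : Invertible-or-zero R)
  (1≉0 : ¬ (CommutativeRing._≈_ R (CommutativeRing.1# R) (CommutativeRing.0# R))) where

  open CommutativeRing R hiding (zero)
  open import Algebra.Properties.Group +-group using (∙-cancelˡ; x∙y⁻¹≈ε⇒x≈y)
  open import Algebra.Properties.Ring ring using (-‿distribˡ-*)
  open import Algebra.Properties.Semiring.Exp semiring using (_^_)
  open import Algebra.Properties.CommutativeMonoid.Sum +-commutativeMonoid
  open import Algebra.Properties.Semiring.Sum semiring using (*-distribˡ-sum)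
  open import Algebra.Solver.Ring.NaturalCoefficients.Default commutativeSemiring
  open import Relation.Binary.Reasoning.Setoid setoid

  noZeroDivisors : ∀ {x y} → ¬ (x ≈ 0#) → x * y ≈ 0# → y ≈ 0#
  noZeroDivisors {x} {y} x≉0 xy≈0 with inverse x
  ... | inj₁ x≈0 = contradiction x≈0 x≉0
  ... | inj₂ (z , xz≈1) = begin
    y            ≈⟨ *-identityˡ y ⟨
    1# * y       ≈⟨ *-congʳ xz≈1 ⟨
    x * z * y    ≈⟨ solve 3 (λ x z y → x :* z :* y := z :* (x :* y)) refl x z y ⟩
    z * (x * y)  ≈⟨ *-congˡ xy≈0 ⟩
    z * 0#       ≈⟨ zeroʳ z ⟩
    0#           ∎

  ^-nonzero : ∀ {x} n → ¬ (x ≈ 0#) → ¬ (x ^ n ≈ 0#)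
  ^-nonzero zero    x≉0 1≈0  = 1≉0 1≈0
  ^-nonzero (suc n) x≉0 xⁿ≈0 = ^-nonzero n x≉0 (noZeroDivisors x≉0 xⁿ≈0)

  *-cancel-≉ : ∀ {x y z} → ¬ (x ≈ y) → x * z ≈ y * z → z ≈ 0#
  *-cancel-≉ {x} {y} {z} x≉y xz≈yz = noZeroDivisors (λ d → x≉y (x∙y⁻¹≈ε⇒x≈y x y d)) (begin
    (x - y) * z        ≈⟨ distribʳ z x (- y) ⟩
    x * z + - y * z    ≈⟨ +-cong xz≈yz (sym (-‿distribˡ-* y z)) ⟩
    y * z - y * z      ≈⟨ -‿inverseʳ _ ⟩
    0#                 ∎)

  eval : ∀ {n} → Vector Carrier n → Carrier → Carrier
  eval {zero}  a x = 0#
  eval {suc n} a x = a zero + x * eval (a ∘ suc) x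

  eval-0 : ∀ {n} (a : Vector Carrier n) x → (∀ i → a i ≈ 0#) → eval a x ≈ 0#
  eval-0 {zero}  a x a≈0 = refl
  eval-0 {suc n} a x a≈0 = begin
    a zero + x * eval (a ∘ suc) x  ≈⟨ +-cong (a≈0 zero) (*-congˡ (eval-0 (a ∘ suc) x (a≈0 ∘ suc))) ⟩
    0# + x * 0#                    ≈⟨ +-identityˡ _ ⟩
    x * 0#                         ≈⟨ zeroʳ x ⟩
    0#                             ∎

  eval-∑ : ∀ {n} (a : Vector Carrier n) x → eval a x ≈ ∑[ i < n ] (a i * x ^ toℕ i)
  eval-∑ {zero}  a x = refl
  eval-∑ {suc n} a x = +-cong (sym (*-identityʳ _)) (begin
    x * eval (a ∘ suc) x                       ≈⟨ *-congˡ (eval-∑ (a ∘ suc) x) ⟩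
    x * ∑[ i < n ] (a (suc i) * x ^ toℕ i)     ≈⟨ *-distribˡ-sum x (λ i → a (suc i) * x ^ toℕ i) ⟩
    ∑[ i < n ] (x * (a (suc i) * x ^ toℕ i))
      ≈⟨ sum-cong-≋ {n} (λ i → solve 3 (λ x a y → x :* (a :* y) := a :* (x :* y)) refl x (a (suc i)) (x ^ toℕ i)) ⟩
    ∑[ i < n ] (a (suc i) * x ^ suc (toℕ i))   ∎)

  -- Synthetic division a(X) = a(r) + (X - r) b(X), with both sides moved so that
  -- no subtraction occurs.
  divide : ∀ {n} (a : Vector Carrier (suc n)) r → ∃ λ (b : Vector Carrier n) →
           (∀ x → eval a x + r * eval b x ≈ eval a r + x * eval b x) ×
           ((∀ i → b i ≈ 0#) → ∀ i → a (suc i) ≈ 0#)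
  divide {zero}  a r = [] , (λ x → solve 3 (λ a x r → (a :+ x :* con 0) :+ r :* con 0 := (a :+ r :* con 0) :+ x :* con 0) refl (a zero) x r) , λ _ ()
  divide {suc n} a r with divide (a ∘ suc) r
  ... | b , eq , b⇒a = eval (a ∘ suc) r ∷ b , eq′ , b⇒a′
    where
    eq′ : ∀ x → _
    eq′ x = begin
      a zero + x * A + r * (Ar + x * B)
        ≈⟨ solve 6 (λ a x r A C B → (a :+ x :* A) :+ r :* (C :+ x :* B) := a :+ x :* (A :+ r :* B) :+ r :* C) refl (a zero) x r A Ar B ⟩
      a zero + x * (A + r * B) + r * Ar     ≈⟨ +-congʳ (+-congˡ (*-congˡ (eq x))) ⟩
      a zero + x * (Ar + x * B) + r * Ar
        ≈⟨ solve 3 (λ a u v → a :+ u :+ v := (a :+ v) :+ u) refl (a zero) (x * (Ar + x * B)) (r * Ar) ⟩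
      a zero + r * Ar + x * (Ar + x * B)    ∎
      where
      A = eval (a ∘ suc) x
      Ar = eval (a ∘ suc) r
      B = eval b x
    b⇒a′ : _ → ∀ i → a (suc i) ≈ 0#
    b⇒a′ b≈0 (suc i) = b⇒a (b≈0 ∘ suc) i
    b⇒a′ b≈0 zero = begin
      a (suc zero)                     ≈⟨ +-identityʳ _ ⟨
      a (suc zero) + 0#                ≈⟨ +-congˡ (trans (*-congˡ (eval-0 _ r (b⇒a (b≈0 ∘ suc)))) (zeroʳ r)) ⟨
      eval (a ∘ suc) r                 ≈⟨ b≈0 zero ⟩
      0#                               ∎

  -- Dividing by `X - r zero` leaves a shorter quotient that vanishes at the remaining roots.
  -- Counting coefficients instead of degrees makes vanishing leading coefficients harmless.
  roots⇒0 : ∀ {n} (a : Vector Carrier n) (r : Vector Carrier n) →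
            (∀ {i j} → i ≢ j → ¬ (r i ≈ r j)) → (∀ i → eval a (r i) ≈ 0#) → ∀ i → a i ≈ 0#
  roots⇒0 {suc n} a r distinct root i with divide a (r zero)
  ... | b , eq , b⇒a = a≈0 i
    where
    b≈0 : ∀ j → b j ≈ 0#
    b≈0 = roots⇒0 b (r ∘ suc) (λ i≢j → distinct (i≢j ∘ suc-injective)) λ j →
      *-cancel-≉ (distinct {zero} {suc j} λ ()) (begin
        r zero * eval b (r (suc j))                          ≈⟨ +-identityˡ _ ⟨
        0# + r zero * eval b (r (suc j))                     ≈⟨ +-congʳ (root (suc j)) ⟨
        eval a (r (suc j)) + r zero * eval b (r (suc j))     ≈⟨ eq (r (suc j)) ⟩
        eval a (r zero) + r (suc j) * eval b (r (suc j))     ≈⟨ +-congʳ (root zero) ⟩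
        0# + r (suc j) * eval b (r (suc j))                  ≈⟨ +-identityˡ _ ⟩
        r (suc j) * eval b (r (suc j))                       ∎)
    a≈0 : ∀ i → a i ≈ 0#
    a≈0 (suc i) = b⇒a b≈0 i
    a≈0 zero = begin
      a zero             ≈⟨ +-identityʳ _ ⟨
      a zero + 0#        ≈⟨ +-congˡ (trans (*-congˡ (eval-0 _ (r zero) (b⇒a b≈0))) (zeroʳ _)) ⟨
      eval a (r zero)    ≈⟨ root zero ⟩
      0#                 ∎

  private
    monomial : ∀ n → Vector Carrier (suc n)
    monomial zero    = 1# ∷ []
    monomial (suc n) = 0# ∷ monomial n

    eval-monomial : ∀ n x → eval (monomial n) x ≈ x ^ n
    eval-monomial zero    x = trans (+-congˡ (zeroʳ x)) (+-identityʳ 1#)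
    eval-monomial (suc n) x = trans (+-identityˡ _) (*-congˡ (eval-monomial n x))

    monomial-≉0 : ∀ n → ¬ (∀ i → monomial n i ≈ 0#)
    monomial-≉0 zero    e = 1≉0 (e zero)
    monomial-≉0 (suc n) e = monomial-≉0 n (e ∘ suc)

  -- `X^q - X` has `q + 1` coefficients, not all zero because `2 ≤ q` keeps its two terms apart. It
  -- therefore cannot have `q + 1` distinct roots.
  fixed-by-power : ∀ q → 2 ℕ.≤ q → (r : Vector Carrier (suc q)) →
                   (∀ i → r i ^ q ≈ r i) → ¬ (∀ {i j} → i ≢ j → ¬ (r i ≈ r j))
  fixed-by-power 1 (ℕ.s≤s ())
  fixed-by-power (suc (suc n)) _ r fixed distinct =
    monomial-≉0 n (λ i → roots⇒0 a r distinct root (suc (suc i)))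
    where
    a : Vector Carrier (3 ℕ.+ n)
    a = 0# ∷ (- 1# ∷ monomial n)
    root : ∀ i → eval a (r i) ≈ 0#
    root i = begin
      0# + x * (- 1# + x * eval (monomial n) x)  ≈⟨ +-identityˡ _ ⟩
      x * (- 1# + x * eval (monomial n) x)       ≈⟨ *-congˡ (+-congˡ (*-congˡ (eval-monomial n x))) ⟩
      x * (- 1# + x * x ^ n)
        ≈⟨ solve 3 (λ x m y → x :* (m :+ x :* y) := m :* x :+ x :* (x :* y)) refl x (- 1#) (x ^ n) ⟩
      - 1# * x + x ^ suc (suc n)
        ≈⟨ +-cong (trans (sym (-‿distribˡ-* 1# x)) (-‿cong (*-identityˡ x))) (fixed i) ⟩
      - x + x                                    ≈⟨ -‿inverseˡ x ⟩
      0#                                         ∎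
      where x = r i

  -- Linearised polynomials and the dimension of their kernels.

  -- S is a set of scalars, embedded by ι as the fixed field of σ.
  module Linearised {s} {S : Set s} (ι : S → Carrier) (c₀ c₁ : S)
    (ι-0 : ι c₀ ≈ 0#) (ι-1 : ι c₁ ≈ 1#)
    (σ : Carrier → Carrier) (σ-cong : ∀ {x y} → x ≈ y → σ x ≈ σ y)
    (σ-+ : ∀ x y → σ (x + y) ≈ σ x + σ y) (σ-* : ∀ x y → σ (x * y) ≈ σ x * σ y)
    (σ-1 : σ 1# ≈ 1#) (σ-ι : ∀ c → σ (ι c) ≈ ι c)
    (fixed : ∀ z → σ z ≈ z → ∃ λ c → ι c + z ≈ 0#) where

    linear : ∀ {n} → Vector S n → Vector Carrier n → Carrier
    linear {n} c x = ∑[ i < n ] (ι (c i) * x i)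

    LinearlyIndependent : ∀ {n} → Vector Carrier n → Set _
    LinearlyIndependent x = ∀ c → linear c x ≈ 0# → ∀ i → ι (c i) ≈ 0#

    σ-0 : σ 0# ≈ 0#
    σ-0 = ∙-cancelˡ (σ 0#) _ _ (trans (sym (σ-+ 0# 0#)) (trans (σ-cong (+-identityʳ 0#)) (sym (+-identityʳ _))))

    σ-linear : ∀ {n} (c : Vector S n) x → σ (linear c x) ≈ linear c (σ ∘ x)
    σ-linear {zero}  c x = σ-0
    σ-linear {suc n} c x = trans (σ-+ _ _)
      (+-cong (trans (σ-* _ _) (*-congʳ (σ-ι (c zero)))) (σ-linear (c ∘ suc) (x ∘ suc)))

    -- For `σ x = x^q` these are the q-polynomials with terms `a i * X^(q^i)`, whose values form the
    -- Gabidulin codewords.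
    linearised : ∀ {n} → Vector Carrier n → Carrier → Carrier
    linearised {zero}  a x = 0#
    linearised {suc n} a x = a zero * x + linearised (a ∘ suc) (σ x)

    linearised-cong : ∀ {n} (a : Vector Carrier n) {x y} → x ≈ y → linearised a x ≈ linearised a y
    linearised-cong {zero}  a x≈y = refl
    linearised-cong {suc n} a x≈y = +-cong (*-congˡ x≈y) (linearised-cong (a ∘ suc) (σ-cong x≈y))

    private
      -- Right division of a linearised polynomial with root 1 by X - σ(X).
      divideσ : ∀ {n} (a : Vector Carrier (suc n)) → linearised a 1# ≈ 0# →
                ∃ λ (b : Vector Carrier n) →
                (∀ {x y} → y + σ x ≈ x → linearised a x ≈ linearised b y) ×
                ((∀ i → b i ≈ 0#) → ∀ i → a i ≈ 0#)
      divideσ {zero} a e = [] , (λ {x} _ → begin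
          a zero * x + 0#  ≈⟨ +-identityʳ _ ⟩
          a zero * x       ≈⟨ *-congʳ a₀≈0 ⟩
          0# * x           ≈⟨ zeroˡ x ⟩
          0#               ∎) , λ { _ zero → a₀≈0 }
        where
        a₀≈0 : a zero ≈ 0#
        a₀≈0 = trans (sym (trans (+-identityʳ _) (*-identityʳ _))) e
      divideσ {suc n} a e with divideσ a′ e′
        where
        -- Since `x = y + σ x`, the first two terms become `a₀ y + (a₀ + a₁) σ x`. Merging the two
        -- coefficients leaves a shorter polynomial, evaluated at `σ x`, which again has root 1 and
        -- is divided recursively.
        a′ : Vector Carrier (suc n)
        a′ = (a zero + a (suc zero)) ∷ (λ i → a (suc (suc i)))
        e′ : linearised a′ 1# ≈ 0#
        e′ = begin
          (a zero + a (suc zero)) * 1# + linearised (λ i → a (suc (suc i))) (σ 1#)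
            ≈⟨ +-cong (distribʳ 1# _ _) (linearised-cong (λ i → a (suc (suc i))) (sym (σ-cong σ-1))) ⟩
          a zero * 1# + a (suc zero) * 1# + linearised (λ i → a (suc (suc i))) (σ (σ 1#))
            ≈⟨ +-assoc _ _ _ ⟩
          a zero * 1# + (a (suc zero) * 1# + linearised (λ i → a (suc (suc i))) (σ (σ 1#)))
            ≈⟨ +-congˡ (+-congʳ (*-congˡ (sym σ-1))) ⟩
          linearised a 1#  ≈⟨ e ⟩
          0#               ∎
      ... | b , eq , b⇒a = a zero ∷ b , eq′ , b⇒a′
        where
        eq′ : ∀ {x y} → y + σ x ≈ x → linearised a x ≈ linearised (a zero ∷ b) y
        eq′ {x} {y} y+σx≈x = begin
          a zero * x + (a (suc zero) * σ x + L)             ≈⟨ +-congʳ (*-congˡ (sym y+σx≈x)) ⟩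
          a zero * (y + σ x) + (a (suc zero) * σ x + L)
            ≈⟨ solve 5 (λ a b y z L → a :* (y :+ z) :+ (b :* z :+ L) := a :* y :+ ((a :+ b) :* z :+ L)) refl (a zero) (a (suc zero)) y (σ x) L ⟩
          a zero * y + ((a zero + a (suc zero)) * σ x + L)
            ≈⟨ +-congˡ (eq (trans (sym (σ-+ y (σ x))) (σ-cong y+σx≈x))) ⟩
          a zero * y + linearised b (σ y)                   ∎
          where L = linearised (λ i → a (suc (suc i))) (σ (σ x))
        b⇒a′ : _ → ∀ i → a i ≈ 0#
        b⇒a′ b≈0 zero          = b≈0 zero
        b⇒a′ b≈0 (suc zero)    = trans (sym (+-identityˡ _))
          (trans (+-congʳ (sym (b≈0 zero))) (b⇒a (b≈0 ∘ suc) zero))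
        b⇒a′ b≈0 (suc (suc i)) = b⇒a (b≈0 ∘ suc) (suc i)

      twist : ∀ {n} → Vector Carrier n → Carrier → Vector Carrier n
      twist {suc n} a u zero    = a zero * u
      twist {suc n} a u (suc i) = twist (a ∘ suc) (σ u) i

      linearised-twist : ∀ {n} (a : Vector Carrier n) u x → linearised (twist a u) x ≈ linearised a (u * x)
      linearised-twist {zero}  a u x = refl
      linearised-twist {suc n} a u x = +-cong (*-assoc _ _ _)
        (trans (linearised-twist (a ∘ suc) (σ u) (σ x)) (linearised-cong (a ∘ suc) (sym (σ-* u x))))

      untwist : ∀ {n} (a : Vector Carrier n) {u w} → u * w ≈ 1# →
                (∀ i → twist a u i ≈ 0#) → ∀ i → a i ≈ 0#
      untwist {suc n} a {u} {w} uw≈1 e zero = begin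
        a zero            ≈⟨ *-identityʳ _ ⟨
        a zero * 1#       ≈⟨ *-congˡ uw≈1 ⟨
        a zero * (u * w)  ≈⟨ *-assoc _ _ _ ⟨
        a zero * u * w    ≈⟨ *-congʳ (e zero) ⟩
        0# * w            ≈⟨ zeroˡ w ⟩
        0#                ∎
      untwist {suc n} a uw≈1 e (suc i) = untwist (a ∘ suc)
        (trans (sym (σ-* _ _)) (trans (σ-cong uw≈1) σ-1)) (e ∘ suc) i

    linear-0 : ∀ {n} (c : Vector S n) x → (∀ i → ι (c i) ≈ 0#) → linear c x ≈ 0#
    linear-0 {n} c x c≈0 = trans (sum-cong-≋ {n} λ i → trans (*-congʳ (c≈0 i)) (zeroˡ _)) (sum-replicate-zero n)

    -- Rescale so that 1 is a root of a, divide a by X - σ(X), and apply the induction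
    -- hypothesis to the elements x - σ(x).
    kernel-bound : ∀ {n} (x : Vector Carrier n) → LinearlyIndependent x →
                   ∀ (a : Vector Carrier n) → (∀ j → linearised a (x j) ≈ 0#) → ∀ i → a i ≈ 0#
    kernel-bound {suc n} x ind a root with inverse (x zero)
    ... | inj₁ x₀≈0 = contradiction (trans (sym ι-1) (ind (c₁ ∷ λ _ → c₀) (begin
      ι c₁ * x zero + linear {n} (λ _ → c₀) (x ∘ suc)
        ≈⟨ +-cong (*-congˡ x₀≈0) (linear-0 (λ _ → c₀) (x ∘ suc) (λ _ → ι-0)) ⟩
      ι c₁ * 0# + 0#                                ≈⟨ +-identityʳ _ ⟩
      ι c₁ * 0#                                     ≈⟨ zeroʳ _ ⟩
      0#                                            ∎) zero)) 1≉0
    ... | inj₂ (w , uw≈1) = untwist a uw≈1 (proj₂ (proj₂ quotient)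
            (kernel-bound y y-ind b λ j → begin
              linearised b (y j)                      ≈⟨ proj₁ (proj₂ quotient) (y+σ j) ⟨
              linearised (twist a u) (x′ j)           ≈⟨ linearised-twist a u (x′ j) ⟩
              linearised a (u * (x (suc j) * w))      ≈⟨ linearised-cong a (u*x′ (x (suc j))) ⟩
              linearised a (x (suc j))                ≈⟨ root (suc j) ⟩
              0#                                      ∎))
      where
      u = x zero
      u*x′ : ∀ z → u * (z * w) ≈ z
      u*x′ z = trans (solve 3 (λ u z w → u :* (z :* w) := z :* (u :* w)) refl u z w)
        (trans (*-congˡ uw≈1) (*-identityʳ z))
      x′ : Vector Carrier n
      x′ j = x (suc j) * w
      quotient = divideσ (twist a u) (trans (linearised-twist a u 1#)
        (trans (linearised-cong a (*-identityʳ u)) (root zero)))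
      b = proj₁ quotient
      y : Vector Carrier n
      y j = x′ j - σ (x′ j)
      y+σ : ∀ j → y j + σ (x′ j) ≈ x′ j
      y+σ j = trans (+-assoc _ _ _) (trans (+-congˡ (-‿inverseˡ _)) (+-identityʳ _))
      y-ind : LinearlyIndependent y
      -- A relation among the differences `x′ j - σ (x′ j)` says that the same combination of the
      -- `x′ j` is fixed by `σ`, hence is minus a scalar `c′`. Multiplied by `u = x zero` this
      -- becomes a relation among the `x j` in which `c′` is the coefficient of `x zero`.
      y-ind c e with fixed (linear c x′) σz≈z
        where
        σz≈z : σ (linear c x′) ≈ linear c x′
        σz≈z = begin
          σ (linear c x′)                    ≈⟨ σ-linear c x′ ⟩
          linear c (σ ∘ x′)                  ≈⟨ +-identityˡ _ ⟨
          0# + linear c (σ ∘ x′)             ≈⟨ +-congʳ e ⟨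
          linear c y + linear c (σ ∘ x′)
            ≈⟨ ∑-distrib-+ {n} (λ i → ι (c i) * y i) (λ i → ι (c i) * σ (x′ i)) ⟨
          ∑[ i < n ] (ι (c i) * y i + ι (c i) * σ (x′ i))
            ≈⟨ sum-cong-≋ {n} (λ i → trans (sym (distribˡ _ _ _)) (*-congˡ (y+σ i))) ⟩
          linear c x′                        ∎
      ... | c′ , e′ = λ i → ind (c′ ∷ c) (begin
        ι c′ * u + linear c (x ∘ suc)
          ≈⟨ +-cong (*-comm _ _) (sum-cong-≋ {n} λ i → trans (*-congˡ (sym (u*x′ (x (suc i))))) (solve 3 (λ a u v → a :* (u :* v) := u :* (a :* v)) refl (ι (c i)) u (x′ i))) ⟩
        u * ι c′ + ∑[ i < n ] (u * (ι (c i) * x′ i))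
          ≈⟨ +-congˡ (*-distribˡ-sum {n} u (λ i → ι (c i) * x′ i)) ⟨
        u * ι c′ + u * linear c x′         ≈⟨ distribˡ u _ _ ⟨
        u * (ι c′ + linear c x′)           ≈⟨ *-congˡ e′ ⟩
        u * 0#                             ≈⟨ zeroʳ u ⟩
        0#                                 ∎) (suc i)

-- Fermat's little theorem and binomial coefficients in a finite field.

module FiniteFieldProperties {c ℓ₁ ℓ₂ q} (F : FiniteField c ℓ₁ ℓ₂ q) where
  open FiniteField F
  open ConstantDimensionCodes F
  open Finiteness
  open CommutativeRing commutativeRing hiding (zero)
  open Inverse enumeration using (to; from; to-cong; strictlyInverseˡ; strictlyInverseʳ)
  open import Relation.Binary.Reasoning.Setoid setoid
  open import Algebra.Properties.Semiring.Exp semiring using (_^_)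
  open import Algebra.Properties.Ring ring using (-0#≈0#)
  open import Algebra.Properties.Group +-group using (∙-cancelˡ; ∙-cancelʳ)
  open import Algebra.Properties.CommutativeMonoid.Sum +-commutativeMonoid using (sum-cong-≋; sum-syntax)
  import Algebra.Properties.CommutativeMonoid.Sum *-commutativeMonoid as Product
  open import Algebra.Solver.Ring.NaturalCoefficients.Default commutativeSemiring
  open import Algebra.Properties.Semiring.Mult semiring using (×-comm-*; ×-assoc-*; ×-congʳ) renaming (_×_ to _·_)

  from-injective : ∀ {i j} → from i ≈ from j → i ≡ j
  from-injective {i} {j} e = ≡.trans (≡.sym (strictlyInverseˡ i)) (≡.trans (to-cong e) (strictlyInverseˡ j))

  1≉0 : ¬ (1# ≈ 0#)
  1≉0 1≈0 = contradiction
    (fromℕ<-injective 0 1 (ℕ.<-trans (ℕ.s≤s ℕ.z≤n) 1<q) 1<q (from-injective (trans (all≈0 _) (sym (all≈0 _))))) λ ()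
    where
    all≈0 : ∀ x → x ≈ 0#
    all≈0 x = trans (sym (*-identityˡ x)) (trans (*-congʳ 1≈0) (zeroˡ x))

  -- Inverses are searched for in the enumeration. If there is none, `x` is not apart from 0, and
  -- tightness makes it equal to 0.
  inverse : Invertible-or-zero commutativeRing
  inverse x with any? (λ i → x * from i ≟ 1#)
  ... | yes (i , e) = inj₂ (from i , e)
  ... | no none     = inj₁ (proj₁ (tight x 0#) λ x#0 →
    let (y , _ , e) = #⇒invertible x#0 in
    none (to y , trans (*-cong (sym (trans (+-congˡ -0#≈0#) (+-identityʳ x))) (strictlyInverseʳ y)) e))
    where open HeytingField heytingField using (tight; #⇒invertible)

  open FieldProperties commutativeRing inverse 1≉0 public

  -- Multiplication by a permutes the nonzero elements, hence fixes their product.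
  private
    module _ (a a⁻¹ : Carrier) (aa⁻¹≈1 : a * a⁻¹ ≈ 1#) where

      -- Replacing 0 by 1 in `h` turns the product over the whole field into the product of the
      -- nonzero elements. The map `w` records the factor by which `h` changes under multiplication
      -- by `a`, namely 1 at 0 and `a` elsewhere.
      h w : Carrier → Carrier
      h z with z ≟ 0#
      ... | yes _ = 1#
      ... | no _  = z
      w z with z ≟ 0#
      ... | yes _ = 1#
      ... | no _  = a

      h-≉0 : ∀ z → ¬ (h z ≈ 0#)
      h-≉0 z with z ≟ 0#
      ... | yes _  = 1≉0
      ... | no z≉0 = z≉0

      h-cong : ∀ {y z} → y ≈ z → h y ≈ h z
      h-cong {y} {z} y≈z with y ≟ 0# | z ≟ 0#
      ... | yes _  | yes _  = refl
      ... | no _   | no _   = y≈z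
      ... | yes p  | no ¬p  = contradiction (trans (sym y≈z) p) ¬p
      ... | no ¬p  | yes p  = contradiction (trans y≈z p) ¬p

      a≉0 : ¬ (a ≈ 0#)
      a≉0 a≈0 = 1≉0 (trans (sym aa⁻¹≈1) (trans (*-congʳ a≈0) (zeroˡ _)))

      h-* : ∀ z → h (a * z) ≈ w z * h z
      h-* z with a * z ≟ 0# | z ≟ 0#
      ... | yes _  | yes _  = sym (*-identityˡ _)
      ... | no _   | no _   = refl
      ... | yes p  | no ¬p  = contradiction (noZeroDivisors a≉0 p) ¬p
      ... | no ¬p  | yes p  = contradiction (trans (*-congˡ p) (zeroʳ a)) ¬p

      a⁻¹a : ∀ z → a⁻¹ * (a * z) ≈ z
      a⁻¹a z = trans (solve 3 (λ a b z → b :* (a :* z) := (a :* b) :* z) refl a a⁻¹ z)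
        (trans (*-congʳ aa⁻¹≈1) (*-identityˡ z))

      aa⁻¹ : ∀ z → a * (a⁻¹ * z) ≈ z
      aa⁻¹ z = trans (sym (*-assoc _ _ _)) (trans (*-congʳ aa⁻¹≈1) (*-identityˡ z))

      π : Permutation q q
      π = permutation (λ i → to (a * from i)) (λ i → to (a⁻¹ * from i))
        (λ i → ≡.trans (to-cong (trans (*-congˡ (strictlyInverseʳ _)) (aa⁻¹ _))) (strictlyInverseˡ i))
        (λ i → ≡.trans (to-cong (trans (*-congˡ (strictlyInverseʳ _)) (a⁻¹a _))) (strictlyInverseˡ i))

      ∏-≉0 : ∀ n (f : Fin n → Carrier) → (∀ i → ¬ (f i ≈ 0#)) → ¬ (Product.sum f ≈ 0#)
      ∏-≉0 zero    f f≉0 e = 1≉0 e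
      ∏-≉0 (suc n) f f≉0 e = ∏-≉0 n (f ∘ suc) (f≉0 ∘ suc) (noZeroDivisors (f≉0 zero) e)

      ∏w≈1 : Product.sum (w ∘ from) ≈ 1#
      ∏w≈1 with Product.sum (w ∘ from) ≟ 1#
      ... | yes e = e
      ... | no ¬e = contradiction (*-cancel-≉ ¬e (begin
        Product.sum (w ∘ from) * Product.sum (h ∘ from)
          ≈⟨ Product.∑-distrib-+ (w ∘ from) (h ∘ from) ⟨
        Product.sum (λ i → w (from i) * h (from i))
          ≈⟨ Product.sum-cong-≋ (λ i → sym (h-* (from i))) ⟩
        Product.sum (λ i → h (a * from i))
          ≈⟨ Product.sum-cong-≋ (λ i → h-cong (sym (strictlyInverseʳ (a * from i)))) ⟩
        Product.sum (λ i → h (from (π ⟨$⟩ʳ i)))                  ≈⟨ Product.sum-permute (h ∘ from) π ⟨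
        Product.sum (h ∘ from)                                   ≈⟨ *-identityˡ _ ⟨
        1# * Product.sum (h ∘ from)                              ∎)) (∏-≉0 q (h ∘ from) (h-≉0 ∘ from))

      w-0 : w (from (to 0#)) ≈ 1#
      w-0 with from (to 0#) ≟ 0#
      ... | yes _ = refl
      ... | no ¬p = contradiction (strictlyInverseʳ 0#) ¬p

      w-≢0 : ∀ i → i ≢ to 0# → w (from i) ≈ a
      w-≢0 i i≢ with from i ≟ 0#
      ... | yes p = contradiction (≡.trans (≡.sym (strictlyInverseˡ i)) (to-cong p)) i≢
      ... | no _  = refl

      -- The extra `a` takes the place of the single factor 1, so that no exponent `n - 1` has to be
      -- formed.
      ∏w : ∀ {n} (w′ : Fin n → Carrier) i₀ → w′ i₀ ≈ 1# → (∀ i → i ≢ i₀ → w′ i ≈ a) → a * Product.sum w′ ≈ a ^ n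
      ∏w {suc n} w′ i₀ e₀ e = *-congˡ (begin
        Product.sum w′                               ≈⟨ Product.sum-remove {i = i₀} w′ ⟩
        w′ i₀ * Product.sum (removeAt w′ i₀)
          ≈⟨ *-cong e₀ (Product.sum-cong-≋ {n} (λ i → e (punchIn i₀ i) (punchInᵢ≢i i₀ i))) ⟩
        1# * Product.sum {n} (λ _ → a)               ≈⟨ *-identityˡ _ ⟩
        Product.sum {n} (λ _ → a)                    ≈⟨ Product.sum-replicate n ⟩
        a ^ n                                        ∎)

      fermat-unit : a ^ q ≈ a
      fermat-unit = begin
        a ^ q                          ≈⟨ ∏w (w ∘ from) (to 0#) w-0 w-≢0 ⟨
        a * Product.sum (w ∘ from)     ≈⟨ *-congˡ ∏w≈1 ⟩
        a * 1#                         ≈⟨ *-identityʳ a ⟩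
        a                              ∎

    0^ : ∀ n {a} → 1 ℕ.≤ n → a ≈ 0# → a ^ n ≈ 0#
    0^ (suc n) _ a≈0 = trans (*-congʳ a≈0) (zeroˡ _)

  fermat : ∀ a → a ^ q ≈ a
  fermat a with inverse a
  ... | inj₁ a≈0       = trans (0^ q (ℕ.≤-trans (ℕ.s≤s ℕ.z≤n) 1<q) a≈0) (sym a≈0)
  ... | inj₂ (b , e)   = fermat-unit a b e

  -- The polynomial (1 + X)^q - X^q - 1 has degree less than q and vanishes on 𝔽.
  binomial-vanishes : ∀ q′ → q ≡ suc q′ → (k : Fin q′) → (q choose suc (toℕ k)) · 1# ≈ 0#
  binomial-vanishes q′ ≡.refl k = roots⇒0 (0# ∷ b) from (λ i≢j e → i≢j (from-injective e)) (root ∘ from) (suc k)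
    where
    b : Vector Carrier q′
    b k = (q choose suc (toℕ k)) · 1#
    1^n≈1 = Frobenius.1^n≈1 commutativeRing
    root : ∀ x → eval (0# ∷ b) x ≈ 0#
    root x = trans (+-identityˡ _) (∙-cancelʳ x _ _ (∙-cancelˡ 1# _ _ (begin
      1# + (x * eval b x + x)     ≈⟨ +-congˡ (+-congʳ (*-congˡ (eval-∑ b x))) ⟩
      1# + (x * ∑[ k < q′ ] (b k * x ^ toℕ k) + x)
        ≈⟨ +-congˡ (+-congʳ (*-distribˡ-sum x (λ k → b k * x ^ toℕ k))) ⟩
      1# + (∑[ k < q′ ] (x * (b k * x ^ toℕ k)) + x)
        ≈⟨ +-cong (sym (1^n≈1 q)) (+-cong (sum-cong-≋ {q′} term) (sym (fermat x))) ⟩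
      1# ^ q + (∑[ k < q′ ] ((q choose suc (toℕ k)) · (x ^ suc (toℕ k) * 1# ^ (q′ ℕ.∸ toℕ k))) + x ^ q)
                                  ≈⟨ Frobenius.expand commutativeRing q′ x 1# ⟨
      (x + 1#) ^ q                ≈⟨ fermat (x + 1#) ⟩
      x + 1#                      ≈⟨ +-comm _ _ ⟩
      1# + x                      ≈⟨ +-congˡ (+-identityˡ x) ⟨
      1# + (0# + x)               ∎)))
      where
      open import Algebra.Properties.Semiring.Sum semiring using (*-distribˡ-sum)
      term : ∀ k → x * (b k * x ^ toℕ k) ≈ (q choose suc (toℕ k)) · (x ^ suc (toℕ k) * 1# ^ (q′ ℕ.∸ toℕ k))
      term k = begin
        x * (n · 1# * x ^ toℕ k)           ≈⟨ *-congˡ (trans (×-assoc-* n 1# _) (×-congʳ n (*-identityˡ _))) ⟩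
        x * (n · (x ^ toℕ k))              ≈⟨ ×-comm-* n x _ ⟩
        n · (x * x ^ toℕ k)
          ≈⟨ ×-congʳ n (trans (*-congˡ (1^n≈1 (q′ ℕ.∸ toℕ k))) (*-identityʳ _)) ⟨
        n · (x ^ suc (toℕ k) * 1# ^ (q′ ℕ.∸ toℕ k)) ∎
        where n = q choose suc (toℕ k)

-- The cyclic algebra.

-- R[X] / (X^(n+1) - 1).
module CyclicAlgebra {c ℓ} (R : CommutativeRing c ℓ) (n : ℕ) where
  open CommutativeRing R hiding (zero)
  open import Algebra.Solver.Ring.NaturalCoefficients.Default commutativeSemiring
  open import Algebra.Properties.Ring ring using (-0#≈0#; -‿involutive)
  open import Relation.Binary.Reasoning.Setoid setoid

  V : Set c
  V = Vector Carrier (suc n)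

  infix 4 _≋_
  _≋_ : V → V → Set ℓ
  x ≋ y = ∀ j → x j ≈ y j

  rotate : V → V
  rotate z zero    = z (fromℕ n)
  rotate z (suc i) = z (inject₁ i)

  rotate-cong : ∀ {y z} → y ≋ z → rotate y ≋ rotate z
  rotate-cong e zero    = e (fromℕ n)
  rotate-cong e (suc i) = e (inject₁ i)

  one : V
  one zero    = 1#
  one (suc _) = 0#

  -- a(X) z by Horner's rule.
  act : ∀ {m} → Vector Carrier m → V → V
  act {zero}  a z j = 0#
  act {suc m} a z j = a zero * z j + rotate (act (a ∘ suc) z) j

  act-cong : ∀ {m} {a b : Vector Carrier m} {y z} → (∀ i → a i ≈ b i) → y ≋ z → act a y ≋ act b z
  act-cong {zero}  a≈b y≋z j = refl
  act-cong {suc m} a≈b y≋z j = +-cong (*-cong (a≈b zero) (y≋z j)) (rotate-cong (act-cong (a≈b ∘ suc) y≋z) j)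

  rotate-+ : ∀ y z → rotate (λ j → y j + z j) ≋ (λ j → rotate y j + rotate z j)
  rotate-+ y z zero    = refl
  rotate-+ y z (suc i) = refl

  rotate-* : ∀ r z → rotate (λ j → r * z j) ≋ (λ j → r * rotate z j)
  rotate-* r z zero    = refl
  rotate-* r z (suc i) = refl

  rotate-0 : rotate (λ _ → 0#) ≋ (λ _ → 0#)
  rotate-0 zero    = refl
  rotate-0 (suc i) = refl

  act-+ˡ : ∀ {m} (a b : Vector Carrier m) z → act (λ i → a i + b i) z ≋ (λ j → act a z j + act b z j)
  act-+ˡ {zero}  a b z j = sym (+-identityˡ 0#)
  act-+ˡ {suc m} a b z j = begin
    (a zero + b zero) * z j + rotate (act (λ i → a (suc i) + b (suc i)) z) j
      ≈⟨ +-congˡ (trans (rotate-cong (act-+ˡ (a ∘ suc) (b ∘ suc) z) j) (rotate-+ _ _ j)) ⟩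
    (a zero + b zero) * z j + (rotate (act (a ∘ suc) z) j + rotate (act (b ∘ suc) z) j)
      ≈⟨ solve 5 (λ a b z u v → (a :+ b) :* z :+ (u :+ v) := (a :* z :+ u) :+ (b :* z :+ v)) refl (a zero) (b zero) (z j) _ _ ⟩
    act a z j + act b z j ∎

  act-+ʳ : ∀ {m} (a : Vector Carrier m) y z → act a (λ j → y j + z j) ≋ (λ j → act a y j + act a z j)
  act-+ʳ {zero}  a y z j = sym (+-identityˡ 0#)
  act-+ʳ {suc m} a y z j = begin
    a zero * (y j + z j) + rotate (act (a ∘ suc) (λ j → y j + z j)) j
      ≈⟨ +-congˡ (trans (rotate-cong (act-+ʳ (a ∘ suc) y z) j) (rotate-+ _ _ j)) ⟩
    a zero * (y j + z j) + (rotate (act (a ∘ suc) y) j + rotate (act (a ∘ suc) z) j)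
      ≈⟨ solve 5 (λ a y z u v → a :* (y :+ z) :+ (u :+ v) := (a :* y :+ u) :+ (a :* z :+ v)) refl (a zero) (y j) (z j) _ _ ⟩
    act a y j + act a z j ∎

  act-* : ∀ {m} (a : Vector Carrier m) r z → act a (λ j → r * z j) ≋ (λ j → r * act a z j)
  act-* {zero}  a r z j = sym (zeroʳ r)
  act-* {suc m} a r z j = begin
    a zero * (r * z j) + rotate (act (a ∘ suc) (λ j → r * z j)) j
      ≈⟨ +-congˡ (trans (rotate-cong (act-* (a ∘ suc) r z) j) (rotate-* r _ j)) ⟩
    a zero * (r * z j) + r * rotate (act (a ∘ suc) z) j
      ≈⟨ solve 4 (λ a r z u → a :* (r :* z) :+ r :* u := r :* (a :* z :+ u)) refl (a zero) r (z j) _ ⟩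
    r * act a z j ∎

  act-rotate : ∀ {m} (a : Vector Carrier m) z → act a (rotate z) ≋ rotate (act a z)
  act-rotate {zero}  a z j = sym (rotate-0 j)
  act-rotate {suc m} a z j = begin
    a zero * rotate z j + rotate (act (a ∘ suc) (rotate z)) j
      ≈⟨ +-cong (sym (rotate-* (a zero) z j)) (rotate-cong (act-rotate (a ∘ suc) z) j) ⟩
    rotate (λ j → a zero * z j) j + rotate (rotate (act (a ∘ suc) z)) j
      ≈⟨ rotate-+ (λ j → a zero * z j) _ j ⟨
    rotate (act a z) j ∎

  -- Both actions are polynomials in the one linear operator `rotate`, hence commute. Together with
  -- `act-one` this yields commutativity and associativity of the product without any convolution of
  -- indices.
  act-comm : ∀ {m k} (a : Vector Carrier m) (b : Vector Carrier k) z → act a (act b z) ≋ act b (act a z)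
  act-comm {zero}  a b z j = trans (sym (zeroˡ _)) (trans (sym (act-* b 0# (λ _ → 0#) j))
    (act-cong {a = b} (λ _ → refl) (λ _ → zeroˡ 0#) j))
  act-comm {suc m} a b z j = begin
    a zero * act b z j + rotate (act (a ∘ suc) (act b z)) j
      ≈⟨ +-cong (sym (act-* b (a zero) z j)) (trans (rotate-cong (act-comm (a ∘ suc) b z) j) (sym (act-rotate b _ j))) ⟩
    act b (λ j → a zero * z j) j + act b (rotate (act (a ∘ suc) z)) j
      ≈⟨ act-+ʳ b (λ j → a zero * z j) _ j ⟨
    act b (act a z) j ∎

  private
    pad : ∀ {m} → Vector Carrier m → ℕ → Carrier
    pad {zero}  a i       = 0#
    pad {suc m} a zero    = a zero
    pad {suc m} a (suc i) = pad (a ∘ suc) i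

    pad-≥ : ∀ {m} (a : Vector Carrier m) i → m ℕ.≤ i → pad a i ≈ 0#
    pad-≥ {zero}  a i       _         = refl
    pad-≥ {suc m} a (suc i) (ℕ.s≤s p) = pad-≥ (a ∘ suc) i p

    pad-toℕ : ∀ {m} (a : Vector Carrier m) i → pad a (toℕ i) ≈ a i
    pad-toℕ a zero    = refl
    pad-toℕ a (suc i) = pad-toℕ (a ∘ suc) i

    -- No power of `X` wraps around while there are at most `suc n` coefficients. Extending them by
    -- zeros with `pad` keeps the statement uniform as the induction shortens the vector.
    act-one-pad : ∀ {m} (a : Vector Carrier m) → m ℕ.≤ suc n → ∀ j → act a one j ≈ pad a (toℕ j)
    act-one-pad {zero}  a _ j = refl
    act-one-pad {suc m} a (ℕ.s≤s m≤n) zero = begin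
      a zero * 1# + act (a ∘ suc) one (fromℕ n)
        ≈⟨ +-cong (*-identityʳ _) (act-one-pad (a ∘ suc) (ℕ.m≤n⇒m≤1+n m≤n) (fromℕ n)) ⟩
      a zero + pad (a ∘ suc) (toℕ (fromℕ n))
        ≈⟨ +-congˡ (pad-≥ (a ∘ suc) _ (≡.subst (m ℕ.≤_) (≡.sym (toℕ-fromℕ n)) m≤n)) ⟩
      a zero + 0#                                ≈⟨ +-identityʳ _ ⟩
      a zero                                     ∎
    act-one-pad {suc m} a (ℕ.s≤s m≤n) (suc i) = begin
      a zero * 0# + act (a ∘ suc) one (inject₁ i)
        ≈⟨ +-cong (zeroʳ _) (act-one-pad (a ∘ suc) (ℕ.m≤n⇒m≤1+n m≤n) (inject₁ i)) ⟩
      0# + pad (a ∘ suc) (toℕ (inject₁ i))         ≈⟨ +-identityˡ _ ⟩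
      pad (a ∘ suc) (toℕ (inject₁ i))              ≡⟨ ≡.cong (pad (a ∘ suc)) (toℕ-inject₁ i) ⟩
      pad (a ∘ suc) (toℕ i)                        ∎

  act-one : ∀ (a : V) → act a one ≋ a
  act-one a j = trans (act-one-pad a ℕ.≤-refl j) (pad-toℕ a j)

  private
    act-swap : ∀ (a b : V) → act a b ≋ act b a
    act-swap a b j = begin
      act a b j               ≈⟨ act-cong {a = a} (λ _ → refl) (act-one b) j ⟨
      act a (act b one) j     ≈⟨ act-comm a b one j ⟩
      act b (act a one) j     ≈⟨ act-cong {a = b} (λ _ → refl) (act-one a) j ⟩
      act b a j               ∎

    act-assoc : ∀ (a b d : V) → act (act a b) d ≋ act a (act b d)
    act-assoc a b d j = begin
      act (act a b) d j      ≈⟨ act-swap (act a b) d j ⟩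
      act d (act a b) j      ≈⟨ act-comm d a b j ⟩
      act a (act d b) j      ≈⟨ act-cong {a = a} (λ _ → refl) (act-swap d b) j ⟩
      act a (act b d) j      ∎

  algebra : CommutativeRing c ℓ
  algebra = record
    { Carrier = V ; _≈_ = _≋_
    ; _+_ = λ y z j → y j + z j ; _*_ = act ; -_ = λ z j → - z j
    ; 0# = λ _ → 0# ; 1# = one
    ; isCommutativeRing = record
      { isRing = record
        { +-isAbelianGroup = record
          { isGroup = record
            { isMonoid = record
              { isSemigroup = record
                { isMagma = record
                  { isEquivalence = record
                    { refl = λ _ → refl ; sym = λ e j → sym (e j) ; trans = λ e f j → trans (e j) (f j) }
                  ; ∙-cong = λ e f j → +-cong (e j) (f j)
                  }
                ; assoc = λ x y z j → +-assoc (x j) (y j) (z j)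
                }
              ; identity = (λ x j → +-identityˡ (x j)) , (λ x j → +-identityʳ (x j))
              }
            ; inverse = (λ x j → -‿inverseˡ (x j)) , (λ x j → -‿inverseʳ (x j))
            ; ⁻¹-cong = λ e j → -‿cong (e j)
            }
          ; comm = λ x y j → +-comm (x j) (y j)
          }
        ; *-cong = act-cong
        ; *-assoc = act-assoc
        ; *-identity = (λ x j → trans (act-swap one x j) (act-one x j)) , act-one
        ; distrib = (λ x y z → act-+ʳ x y z) , (λ x y z → act-+ˡ y z x)
        }
      ; *-comm = act-swap
      }
    }

  module A = CommutativeRing algebra
  open import Algebra.Properties.Semiring.Exp A.semiring using (_^_)

  ι : Carrier → V
  ι r j = r * one j

  ι-cong : ∀ {r s} → r ≈ s → ι r ≋ ι s
  ι-cong e j = *-congʳ e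

  ι-1 : ι 1# ≋ one
  ι-1 j = *-identityˡ _

  ι-0 : ι 0# ≋ (λ _ → 0#)
  ι-0 j = zeroˡ _

  ι-* : ∀ r z → act (ι r) z ≋ (λ j → r * z j)
  ι-* r z j = trans (act-swap (ι r) z j) (trans (act-* z r one j) (*-congˡ (act-one z j)))

  X : V
  X = rotate one

  X-* : ∀ z → act X z ≋ rotate z
  X-* z j = trans (act-swap X z j) (trans (act-rotate z one j) (rotate-cong (act-one z) j))

  -- Horner's rule builds every element from scalars and `X` by sums and products.
  generated : ∀ {p} (P : V → Set p) → (∀ {y z} → y ≋ z → P y → P z) →
              (∀ {y z} → P y → P z → P (y A.+ z)) → (∀ {y z} → P y → P z → P (act y z)) →
              (∀ r → P (ι r)) → P X → ∀ z → P z
  generated P resp P+ P* Pι PX z = resp (act-one z) (go z)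
    where
    go : ∀ {m} (a : Vector Carrier m) → P (act a one)
    go {zero}  a = resp ι-0 (Pι 0#)
    go {suc m} a = P+ (Pι (a zero)) (resp (X-* _) (P* PX (go (a ∘ suc))))

  private
    Supported : ℕ → V → Set ℓ
    Supported s z = ∀ j → s ℕ.< toℕ j → z j ≈ 0#

    rotate-supported : ∀ {s z} → s ℕ.< n → Supported s z → Supported (suc s) (rotate z) × rotate z zero ≈ 0#
    rotate-supported {s} s<n z-sup =
      (λ { (suc i) (ℕ.s≤s p) → z-sup (inject₁ i) (≡.subst (s ℕ.<_) (≡.sym (toℕ-inject₁ i)) p) }) ,
      z-sup (fromℕ n) (≡.subst (s ℕ.<_) (≡.sym (toℕ-fromℕ n)) s<n)

    X^-supported : ∀ {s z} e → e ℕ.+ s ℕ.≤ n → Supported s z → Supported (e ℕ.+ s) (act (X ^ e) z)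
    X^-supported {s} {z} zero    _ z-sup j p = trans (A.*-identityˡ z j) (z-sup j p)
    X^-supported {s} {z} (suc e) e+s<n z-sup j p = begin
      act (act X (X ^ e)) z j     ≈⟨ act-assoc X (X ^ e) z j ⟩
      act X (act (X ^ e) z) j     ≈⟨ X-* _ j ⟩
      rotate (act (X ^ e) z) j    ≈⟨ proj₁ (rotate-supported e+s<n (X^-supported e (ℕ.<⇒≤ e+s<n) z-sup)) j p ⟩
      0#                          ∎

    X^-zero : ∀ {s z} e → suc e ℕ.+ s ℕ.≤ n → Supported s z → act (X ^ suc e) z zero ≈ 0#
    X^-zero {s} {z} e e+s<n z-sup = begin
      act (act X (X ^ e)) z zero     ≈⟨ act-assoc X (X ^ e) z zero ⟩
      act X (act (X ^ e) z) zero     ≈⟨ X-* _ zero ⟩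
      rotate (act (X ^ e) z) zero    ≈⟨ proj₂ (rotate-supported e+s<n (X^-supported e (ℕ.<⇒≤ e+s<n) z-sup)) ⟩
      0#                             ∎

  X^n+1≈1 : X ^ suc n ≋ one
  X^n+1≈1 j = trans (X-* (X ^ n) j) (last (X ^ n) (power n ℕ.≤-refl) j)
    where
    Unit : ℕ → V → Set ℓ
    Unit i z = (∀ j → toℕ j ≡ i → z j ≈ 1#) × (∀ j → toℕ j ≢ i → z j ≈ 0#)
    power : ∀ i → i ℕ.≤ n → Unit i (X ^ i)
    power zero    _   = (λ { zero _ → refl }) , λ { zero ne → contradiction ≡.refl ne ; (suc _) _ → refl }
    power (suc i) i<n with power i (ℕ.<⇒≤ i<n)
    ... | is1 , is0 =
      (λ { (suc j) e → trans (X-* (X ^ i) (suc j)) (is1 (inject₁ j) (≡.trans (toℕ-inject₁ j) (ℕ.suc-injective e))) }) ,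
      λ { zero _ → trans (X-* (X ^ i) zero) (is0 (fromℕ n) λ e → ℕ.<-irrefl (≡.trans (≡.sym e) (toℕ-fromℕ n)) i<n)
        ; (suc j) ne → trans (X-* (X ^ i) (suc j)) (is0 (inject₁ j) λ e → ne (≡.cong suc (≡.trans (≡.sym (toℕ-inject₁ j)) e))) }
    last : ∀ z → Unit n z → rotate z ≋ one
    last z (is1 , is0) zero    = is1 (fromℕ n) (toℕ-fromℕ n)
    last z (is1 , is0) (suc i) = is0 (inject₁ i) λ e → ℕ.<-irrefl (≡.trans (≡.sym (toℕ-inject₁ i)) e) (toℕ<n i)

  -- The degree of the product below. The function `e` lists the predecessors of the exponents, so
  -- that every exponent is positive by construction.
  total : (ℕ → ℕ) → ℕ → ℕ
  total e zero    = 0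
  total e (suc r) = suc (e r) ℕ.+ total e r

  ∏X^-1 : (ℕ → ℕ) → ℕ → V
  ∏X^-1 e zero    = one
  ∏X^-1 e (suc r) = act (X ^ suc (e r) A.+ A.- one) (∏X^-1 e r)

  -- As long as the degree does not exceed n, the constant coefficient is ±1.
  ∏X^-1-≉0 : ¬ (1# ≈ 0#) → ∀ e r → total e r ℕ.≤ n → ¬ (∏X^-1 e r ≋ (λ _ → 0#))
  ∏X^-1-≉0 1≉0 e r t≤n P≋0 = proj₂ (go r t≤n) (P≋0 zero)
    where
    step : ∀ k (z : V) → act (X ^ suc k A.+ A.- one) z ≋ (λ j → act (X ^ suc k) z j - z j)
    step k z j = trans (A.distribʳ z (X ^ suc k) (A.- one) j)
      (+-congˡ (trans (A.sym (-‿distribˡ-* one z) j) (-‿cong (A.*-identityˡ z j))))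
      where open import Algebra.Properties.Ring A.ring using (-‿distribˡ-*)
    go : ∀ r → total e r ℕ.≤ n → Supported (total e r) (∏X^-1 e r) × ¬ (∏X^-1 e r zero ≈ 0#)
    go zero    _ = (λ { (suc _) _ → refl }) , 1≉0
    go (suc r) t≤n with go r (ℕ.≤-trans (ℕ.m≤n+m _ (suc (e r))) t≤n)
    ... | sup , ≉0 =
      (λ j p → trans (step (e r) _ j) (trans (+-cong (X^-supported (suc (e r)) t≤n sup j p)
        (trans (-‿cong (sup j (ℕ.≤-<-trans (ℕ.m≤n+m _ (suc (e r))) p))) -0#≈0#)) (+-identityˡ 0#))) ,
      λ e≈0 → ≉0 (trans (sym (-‿involutive _)) (trans (-‿cong (begin
        - ∏X^-1 e r zero                             ≈⟨ +-identityˡ _ ⟨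
        0# - ∏X^-1 e r zero                          ≈⟨ +-congʳ (X^-zero (e r) t≤n sup) ⟨
        act (X ^ suc (e r)) (∏X^-1 e r) zero - ∏X^-1 e r zero ≈⟨ step (e r) _ zero ⟨
        ∏X^-1 e (suc r) zero                         ≈⟨ e≈0 ⟩
        0#                                           ∎)) -0#≈0#))

-- Residue fields of finite von Neumann regular rings.

module AnnihilatorQuotient {c ℓ} (R : CommutativeRing c ℓ) where
  open CommutativeRing R hiding (zero)
  open import Algebra.Solver.Ring.NaturalCoefficients.Default commutativeSemiring
  open import Relation.Binary.Reasoning.Setoid setoid

  -- R / Ann(e).
  quotient : Carrier → CommutativeRing c ℓ
  quotient e = record
    { Carrier = Carrier ; _≈_ = λ x y → e * x ≈ e * y
    ; _+_ = _+_ ; _*_ = _*_ ; -_ = -_ ; 0# = 0# ; 1# = 1#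
    ; isCommutativeRing = record
      { isRing = record
        { +-isAbelianGroup = record
          { isGroup = record
            { isMonoid = record
              { isSemigroup = record
                { isMagma = record
                  { isEquivalence = record { refl = refl ; sym = sym ; trans = trans }
                  ; ∙-cong = λ {x} {y} {u} {v} p r → trans (distribˡ e x u) (trans (+-cong p r) (sym (distribˡ e y v)))
                  }
                ; assoc = λ x y z → *-congˡ (+-assoc x y z)
                }
              ; identity = (λ x → *-congˡ (+-identityˡ x)) , (λ x → *-congˡ (+-identityʳ x))
              }
            ; inverse = (λ x → *-congˡ (-‿inverseˡ x)) , (λ x → *-congˡ (-‿inverseʳ x))
            ; ⁻¹-cong = λ {x} {y} p → trans (sym (-‿distribʳ-* e x)) (trans (-‿cong p) (-‿distribʳ-* e y))
            }
          ; comm = λ x y → *-congˡ (+-comm x y)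
          }
        ; *-cong = λ {x} {y} {u} {v} p r → begin
            e * (x * u)   ≈⟨ *-assoc e x u ⟨
            e * x * u     ≈⟨ *-congʳ p ⟩
            e * y * u     ≈⟨ solve 3 (λ e y u → e :* y :* u := y :* (e :* u)) refl e y u ⟩
            y * (e * u)   ≈⟨ *-congˡ r ⟩
            y * (e * v)   ≈⟨ solve 3 (λ e y v → y :* (e :* v) := e :* (y :* v)) refl e y v ⟩
            e * (y * v)   ∎
        ; *-assoc = λ x y z → *-congˡ (*-assoc x y z)
        ; *-identity = (λ x → *-congˡ (*-identityˡ x)) , (λ x → *-congˡ (*-identityʳ x))
        ; distrib = (λ x y z → *-congˡ (distribˡ x y z)) , (λ x y z → *-congˡ (distribʳ x y z))
        }
      ; *-comm = λ x y → *-congˡ (*-comm x y)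
      }
    }
    where open import Algebra.Properties.Ring ring using (-‿distribʳ-*)

  module _ (≈0? : ∀ x → Dec (x ≈ 0#)) (regular : ∀ z → ∃ λ w → z * (z * w) ≈ z) where

    private
      refine : ∀ {k} (f : Fin k → Carrier) P → ¬ (P ≈ 0#) → ∃ λ r →
               ¬ (P * r ≈ 0#) × ∀ i → P * r * f i ≈ 0# ⊎ ∃ λ w → P * r * (f i * w) ≈ P * r
      refine {zero}  f P P≉0 = 1# , (λ e → P≉0 (trans (sym (*-identityʳ P)) e)) , λ ()
      refine {suc k} f P P≉0 with ≈0? (P * f zero)
      ... | yes Pf≈0 with refine (f ∘ suc) P P≉0
      ...   | r , ≉0 , h = r , ≉0 , λ
              { zero    → inj₁ (trans (solve 3 (λ P r f → P :* r :* f := P :* f :* r) refl P r (f zero))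
                            (trans (*-congʳ Pf≈0) (zeroˡ r)))
              ; (suc i) → h i }
      refine {suc k} f P P≉0 | no Pf≉0 with refine (f ∘ suc) (P * f zero) Pf≉0
      ...   | r , ≉0 , h = f zero * r , (λ e → ≉0 (trans (*-assoc _ _ _) e)) , λ
              -- The multiplier contains `f zero` as a factor, and a factor `f` with
              -- `f * (f * w) ≈ f` absorbs `f * w`.
              { zero    → inj₂ (proj₁ (regular (f zero)) , trans
                  (solve 4 (λ P r f w → P :* (f :* r) :* (f :* w) := P :* (f :* (f :* w) :* r)) refl P r (f zero) _)
                  (*-congˡ (*-congʳ (proj₂ (regular (f zero))))))
              ; (suc i) → transport (h i) }
        where
        transport : ∀ {x} → P * f zero * r * x ≈ 0# ⊎ (∃ λ w → P * f zero * r * (x * w) ≈ P * f zero * r) →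
                    P * (f zero * r) * x ≈ 0# ⊎ (∃ λ w → P * (f zero * r) * (x * w) ≈ P * (f zero * r))
        transport (inj₁ e)       = inj₁ (trans (*-congʳ (sym (*-assoc _ _ _))) e)
        transport (inj₂ (w , e)) = inj₂ (w , trans (*-congʳ (sym (*-assoc _ _ _))) (trans e (*-assoc _ _ _)))

    -- Multiply P in turn by every element that does not annihilate it; by regularity
    -- each of these elements becomes invertible modulo the annihilator of the product.
    fieldQuotient : ∀ {k} (el : Fin k → Carrier) → (∀ x → ∃ λ i → el i ≈ x) → ∀ P → ¬ (P ≈ 0#) →
                    ∃ λ e → Invertible-or-zero (quotient e) × ¬ (e * 1# ≈ e * 0#) ×
                            (∀ f g → f * g ≈ P → ¬ (e * f ≈ e * 0#))
    fieldQuotient el complete P P≉0 with refine el P P≉0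
    ... | r , e≉0 , h = e , inv , (λ e1 → e≉0 (trans (sym (*-identityʳ e)) (trans e1 (zeroʳ e)))) , factor
      where
      e = P * r
      inv : Invertible-or-zero (quotient e)
      inv x with complete x
      ... | i , elᵢ≈x with h i
      ...   | inj₁ p       = inj₁ (trans (*-congˡ (sym elᵢ≈x)) (trans p (sym (zeroʳ e))))
      ...   | inj₂ (w , p) = inj₂ (w , trans (*-congˡ (*-congʳ (sym elᵢ≈x))) (trans p (sym (*-identityʳ e))))
      -- A factor `f` of `P` divides `e`. If `e * f` vanished then so would `e * e`, and with it
      -- `e ≈ e * (e * w)`. Hence all factors of `P` stay nonzero in the quotient.
      factor : ∀ f g → f * g ≈ P → ¬ (e * f ≈ e * 0#)
      factor f g fg≈P ef≈0 = e≉0 (begin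
        e                          ≈⟨ proj₂ (regular e) ⟨
        e * (P * r * w)            ≈⟨ *-congˡ (*-congʳ (*-congʳ fg≈P)) ⟨
        e * (f * g * r * w)
          ≈⟨ solve 5 (λ e f g r w → e :* (f :* g :* r :* w) := e :* f :* (g :* r :* w)) refl e f g r w ⟩
        e * f * (g * r * w)        ≈⟨ *-congʳ (trans ef≈0 (zeroʳ e)) ⟩
        0# * (g * r * w)           ≈⟨ zeroˡ _ ⟩
        0#                         ∎)
        where w = proj₁ (regular e)

-- Field extensions as residue fields of the cyclic algebra.

-- A field extension of degree at most m + 1, as its elements are fixed by the
-- (m+1)-st power of the Frobenius map, with an element X that has m + 1 conjugates.
record Extension {c ℓ₁ ℓ₂ q} (F : FiniteField c ℓ₁ ℓ₂ q) (m : ℕ) : Set (lsuc (c ⊔ ℓ₁)) where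
  open CommutativeRing (FiniteField.commutativeRing F) using ()
    renaming (Carrier to 𝔽; _≈_ to _≈ᶠ_; _+_ to _+ᶠ_; _*_ to _*ᶠ_; 0# to 0ᶠ; 1# to 1ᶠ)
  infix 4 _≟_
  field
    K : CommutativeRing c ℓ₁
  open CommutativeRing K public renaming (Carrier to 𝕂) hiding (zero)
  open Exp semiring using (_^_)
  field
    inverse         : Invertible-or-zero K
    1≉0             : ¬ (1# ≈ 0#)
    _≟_             : ∀ x y → Dec (x ≈ y)
    ι               : 𝔽 → 𝕂
    ι-cong          : ∀ {r s} → r ≈ᶠ s → ι r ≈ ι s
    ι-0             : ι 0ᶠ ≈ 0#
    ι-1             : ι 1ᶠ ≈ 1#
    ι-+             : ∀ r s → ι (r +ᶠ s) ≈ ι r + ι s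
    ι-*             : ∀ r s → ι (r *ᶠ s) ≈ ι r * ι s
    ι-^q            : ∀ r → ι r ^ q ≈ ι r
    frobenius-+     : ∀ x y → (x + y) ^ q ≈ x ^ q + y ^ q
    ^q^m≈id         : ∀ x → x ^ (q ℕ.^ suc m) ≈ x
    X               : 𝕂
    X-conjugate-≉   : ∀ d → suc d ℕ.< suc m → ¬ (X ^ (q ℕ.^ suc d) ≈ X)

-- With `q^(m+1)` written as `suc (suc n)`, the relation of the cyclic algebra is
-- `X^(q^(m+1) - 1) = 1`, and `z^n` is a witness that `z` is regular.
module Construction {c ℓ₁ ℓ₂ q} (F : FiniteField c ℓ₁ ℓ₂ q) (m n : ℕ) (q^m≡ : q ℕ.^ suc m ≡ suc (suc n)) where
  open FiniteField F
  open ConstantDimensionCodes F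
  open Finiteness
  private
    module 𝔽ₚ = FiniteFieldProperties F
    module 𝔽′ = CommutativeRing commutativeRing
  open CyclicAlgebra commutativeRing n
  open import Algebra.Properties.Semiring.Exp A.semiring using (^-congˡ; ^-assocʳ; ^-congʳ) renaming (_^_ to _^ᴬ_)
  open import Algebra.Properties.CommutativeSemiring.Exp A.commutativeSemiring using (^-distrib-*)
  open import Algebra.Properties.Semiring.Exp 𝔽′.semiring using () renaming (_^_ to _^ᶠ_)

  private
    q′ : ℕ
    q′ = ℕ.pred q
    q≡ : q ≡ suc q′
    q≡ = ≡.sym (ℕ.suc-pred q {{ℕ.>-nonZero (ℕ.<-trans (ℕ.s≤s ℕ.z≤n) 1<q)}})

  ι-+ : ∀ r s → ι (r 𝔽′.+ s) A.≈ ι r A.+ ι s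
  ι-+ r s j = 𝔽′.distribʳ (one j) r s

  ι-*-homo : ∀ r s → ι (r 𝔽′.* s) A.≈ ι r A.* ι s
  ι-*-homo r s j = 𝔽′.trans (𝔽′.*-assoc r s (one j)) (𝔽′.sym (ι-* r (ι s) j))

  ι-^ : ∀ r k → ι r ^ᴬ k A.≈ ι (r ^ᶠ k)
  ι-^ r zero    = A.sym ι-1
  ι-^ r (suc k) = A.trans (A.*-congˡ {ι r} (ι-^ r k)) (A.sym (ι-*-homo r (r ^ᶠ k)))

  ι-^q : ∀ r → ι r ^ᴬ q A.≈ ι r
  ι-^q r = A.trans (ι-^ r q) (ι-cong (𝔽ₚ.fermat r))

  private
    open import Algebra.Properties.Semiring.Mult A.semiring using () renaming (_×_ to _·ᴬ_)
    open import Algebra.Properties.Semiring.Mult 𝔽′.semiring using () renaming (_×_ to _·_)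

    ι-· : ∀ k → k ·ᴬ A.1# A.≈ ι (k · 𝔽′.1#)
    ι-· zero    = A.sym ι-0
    ι-· (suc k) = A.trans (A.+-cong (A.sym ι-1) (ι-· k)) (A.sym (ι-+ 𝔽′.1# (k · 𝔽′.1#)))

    frobenius-+′ : ∀ {p} → q ≡ suc p → ∀ x y → (x A.+ y) ^ᴬ q A.≈ x ^ᴬ q A.+ y ^ᴬ q
    frobenius-+′ {p} ≡.refl = Frobenius.frobenius-+ algebra p λ k → A.trans (ι-· (q choose suc (toℕ k)))
      (A.trans (ι-cong (𝔽ₚ.binomial-vanishes p ≡.refl k)) ι-0)

  frobenius-+ : ∀ x y → (x A.+ y) ^ᴬ q A.≈ x ^ᴬ q A.+ y ^ᴬ q
  frobenius-+ = frobenius-+′ q≡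

  frobenius-+-iter : ∀ i x y → (x A.+ y) ^ᴬ (q ℕ.^ i) A.≈ x ^ᴬ (q ℕ.^ i) A.+ y ^ᴬ (q ℕ.^ i)
  frobenius-+-iter zero x y = A.trans (A.*-identityʳ (x A.+ y)) (A.sym (A.+-cong (A.*-identityʳ x) (A.*-identityʳ y)))
  frobenius-+-iter (suc i) x y = A.trans (A.sym (^-assocʳ (x A.+ y) q (q ℕ.^ i)))
    (A.trans (^-congˡ (q ℕ.^ i) (frobenius-+ x y))
    (A.trans (frobenius-+-iter i (x ^ᴬ q) (y ^ᴬ q)) (A.+-cong (^-assocʳ x q (q ℕ.^ i)) (^-assocʳ y q (q ℕ.^ i)))))

  ι-^q^ : ∀ i r → ι r ^ᴬ (q ℕ.^ i) A.≈ ι r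
  ι-^q^ zero    r = A.*-identityʳ (ι r)
  ι-^q^ (suc i) r = A.trans (A.sym (^-assocʳ (ι r) q (q ℕ.^ i))) (A.trans (^-congˡ (q ℕ.^ i) (ι-^q r)) (ι-^q^ i r))

  -- By additivity and multiplicativity of the power map its fixed points form a subring. It
  -- contains the scalars by Fermat's theorem and `X` because `X^(n+1) = 1`.
  ^q^m≈id : ∀ z → z ^ᴬ (q ℕ.^ suc m) A.≈ z
  ^q^m≈id = generated (λ z → z ^ᴬ (q ℕ.^ suc m) A.≈ z)
    (λ y≋z e → A.trans (^-congˡ (q ℕ.^ suc m) (A.sym y≋z)) (A.trans e y≋z))
    (λ {y} {z} e f → A.trans (frobenius-+-iter (suc m) y z) (A.+-cong e f))
    (λ {y} {z} e f → A.trans (^-distrib-* y z (q ℕ.^ suc m)) (A.*-cong e f))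
    (ι-^q^ (suc m))
    (A.trans (^-congʳ X q^m≡) (A.trans (A.*-congˡ {X} X^n+1≈1) (A.*-identityʳ X)))

  private
    -- One less than the degree `q^(i+1) - 1`, as `∏X^-1` expects the predecessor of each exponent.
    exponent : ℕ → ℕ
    exponent i = q ℕ.^ suc i ℕ.∸ 2

    exponent-suc : ∀ i → suc (suc (exponent i)) ≡ q ℕ.^ suc i
    exponent-suc i = ≡.trans (ℕ.+-comm 2 (exponent i)) (ℕ.m∸n+n≡m (ℕ.≤-trans 1<q
      (≡.subst (ℕ._≤ q ℕ.^ suc i) (ℕ.*-identityʳ q) (ℕ.*-monoʳ-≤ q 1≤q^i))))
      where
      1≤q^i : 1 ℕ.≤ q ℕ.^ i
      1≤q^i = ℕ.>-nonZero⁻¹ _ {{ℕ.m^n≢0 q i {{ℕ.>-nonZero (ℕ.<-trans (ℕ.s≤s ℕ.z≤n) 1<q)}}}}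

    -- A geometric sum, bounded by doubling: the degrees `q^i - 1` for `1 ≤ i ≤ r` add up to at most
    -- `q^(r+1) - 2`. For `r = m` this is `n`, the largest degree for which the product is known to
    -- be nonzero.
    total-≤ : ∀ r → suc (suc (total exponent r)) ℕ.≤ q ℕ.^ suc r
    total-≤ zero    = ≡.subst (2 ℕ.≤_) (≡.sym (ℕ.*-identityʳ q)) 1<q
    total-≤ (suc r) = begin
      suc (suc (suc (exponent r) ℕ.+ t))       ≡⟨⟩
      suc (suc (suc (exponent r ℕ.+ t)))
        ≡⟨ ≡.cong suc (≡.sym (≡.trans (ℕ.+-suc (suc (exponent r)) t) ≡.refl)) ⟩
      suc (suc (exponent r) ℕ.+ suc t)         ≡⟨⟩
      suc (suc (exponent r)) ℕ.+ suc t         ≤⟨ ℕ.+-monoʳ-≤ (suc (suc (exponent r))) (ℕ.n≤1+n (suc t)) ⟩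
      suc (suc (exponent r)) ℕ.+ suc (suc t)   ≤⟨ ℕ.+-mono-≤ (ℕ.≤-reflexive (exponent-suc r)) (total-≤ r) ⟩
      q ℕ.^ suc r ℕ.+ q ℕ.^ suc r              ≡⟨ ≡.cong (q ℕ.^ suc r ℕ.+_) (ℕ.+-identityʳ _) ⟨
      2 ℕ.* q ℕ.^ suc r                        ≤⟨ ℕ.*-monoˡ-≤ (q ℕ.^ suc r) 1<q ⟩
      q ℕ.* q ℕ.^ suc r                        ∎
      where
      open ℕ.≤-Reasoning
      t = total exponent r

    P : V
    P = ∏X^-1 exponent m

    P≉0 : ¬ (P ≋ (λ _ → 𝔽′.0#))
    P≉0 = ∏X^-1-≉0 𝔽ₚ.1≉0 exponent m (ℕ.s≤s⁻¹ (ℕ.s≤s⁻¹ (≡.subst (suc (suc (total exponent m)) ℕ.≤_) q^m≡ (total-≤ m))))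

    factor : ∀ {i r} → i ℕ.< r → ∃ λ g → (X ^ᴬ suc (exponent i) A.+ A.- A.1#) A.* g A.≈ ∏X^-1 exponent r
    factor {i} {suc r} (ℕ.s≤s i≤r) with i ℕ.≟ r
    ... | yes ≡.refl = ∏X^-1 exponent r , A.refl
    ... | no i≢r with factor (ℕ.≤∧≢⇒< i≤r i≢r)
    ...   | g , e = f r A.* g , A.trans (solve 3 (λ a b g → a :* (b :* g) := b :* (a :* g)) A.refl (f i) (f r) g) (A.*-congˡ {f r} e)
      where
      open import Algebra.Solver.Ring.NaturalCoefficients.Default A.commutativeSemiring
      f : ℕ → V
      f i = X ^ᴬ suc (exponent i) A.+ A.- A.1#

    regular : ∀ z → ∃ λ w → z A.* (z A.* w) A.≈ z
    regular z = z ^ᴬ n , A.trans (A.sym (^-congʳ z q^m≡)) (^q^m≈id z)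

    opaque
      Kdata : ∃ λ e → Invertible-or-zero (AnnihilatorQuotient.quotient algebra e) × ¬ (e A.* A.1# A.≈ e A.* A.0#) ×
                      (∀ f g → f A.* g A.≈ P → ¬ (e A.* f A.≈ e A.* A.0#))
      Kdata = AnnihilatorQuotient.fieldQuotient algebra (λ x → x ≋? _) regular
        decode (λ x → encode x , decode-encode x) P P≉0

  modulus : V
  modulus = proj₁ Kdata

  K : CommutativeRing c ℓ₁
  K = AnnihilatorQuotient.quotient algebra modulus

  open CommutativeRing K renaming (Carrier to 𝕂) hiding (zero)

  infix 4 _≟ᴷ_
  _≟ᴷ_ : ∀ x y → Dec (x ≈ y)
  x ≟ᴷ y = _ ≋? _

  ≋⇒≈ : ∀ {x y} → x ≋ y → x ≈ y
  ≋⇒≈ = A.*-congˡ {modulus}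

  inverse : Invertible-or-zero K
  inverse = proj₁ (proj₂ Kdata)

  1≉0 : ¬ (1# ≈ 0#)
  1≉0 = proj₁ (proj₂ (proj₂ Kdata))

  open FieldProperties K inverse 1≉0 using (noZeroDivisors)
  open import Algebra.Properties.Semiring.Exp semiring using (_^_)
  open import Relation.Binary.Reasoning.Setoid setoid

  private
    ^≡ : ∀ x k → x ^ k ≡ x ^ᴬ k
    ^≡ x zero    = ≡.refl
    ^≡ x (suc k) = ≡.cong (x A.*_) (^≡ x k)

    ^≈ : ∀ {x y} k → x ^ᴬ k A.≈ y → x ^ k ≈ y
    ^≈ {x} k e rewrite ^≡ x k = ≋⇒≈ e

    -- `X` is a unit, so a coincidence `X^(q^(d+1)) = X` would make `X^(q^(d+1) - 1) - 1` vanish in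
    -- `K`; but this is a factor of `P`.
    X-conjugate-≉ : ∀ d → suc d ℕ.< suc m → ¬ (X ^ (q ℕ.^ suc d) ≈ X)
    X-conjugate-≉ d (ℕ.s≤s d<m) e = proj₂ (proj₂ (proj₂ Kdata)) f (proj₁ (factor d<m)) (proj₂ (factor d<m))
      (noZeroDivisors {X} {f} X≉0 (begin
        X * f                                          ≈⟨ distribˡ X (X ^ᴬ suc (exponent d)) (- 1#) ⟩
        X * X ^ᴬ suc (exponent d) + X * - 1#
          ≈⟨ +-cong {X * X ^ᴬ suc (exponent d)} {X} Xq (trans (sym (-‿distribʳ-* X 1#)) (-‿cong (*-identityʳ X))) ⟩
        X + - X                                        ≈⟨ -‿inverseʳ X ⟩
        0#                                             ∎))
      where
      open import Algebra.Properties.Ring ring using (-‿distribʳ-*)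
      f : 𝕂
      f = X ^ᴬ suc (exponent d) + - 1#
      X≉0 : ¬ (X ≈ 0#)
      X≉0 X≈0 = 1≉0 (trans (sym (≋⇒≈ X^n+1≈1)) (trans (*-congʳ {X ^ᴬ n} X≈0) (zeroˡ (X ^ᴬ n))))
      Xq : X * X ^ᴬ suc (exponent d) ≈ X
      Xq = trans (sym (trans (reflexive (^≡ X (q ℕ.^ suc d))) (≋⇒≈ (^-congʳ X (≡.sym (exponent-suc d)))))) e

  frobenius-+ᴷ : ∀ x y → (x + y) ^ q ≈ x ^ q + y ^ q
  frobenius-+ᴷ x y rewrite ^≡ (x + y) q | ^≡ x q | ^≡ y q = ≋⇒≈ (frobenius-+ x y)

  extension : Extension F m
  extension = record
    { K = K ; inverse = inverse ; 1≉0 = 1≉0 ; _≟_ = _≟ᴷ_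
    ; ι = ι ; ι-cong = λ {r} {s} e → ≋⇒≈ (ι-cong e) ; ι-0 = ≋⇒≈ ι-0 ; ι-1 = ≋⇒≈ ι-1
    ; ι-+ = λ r s → ≋⇒≈ (ι-+ r s) ; ι-* = λ r s → ≋⇒≈ (ι-*-homo r s)
    ; ι-^q = λ r → ^≈ q (ι-^q r) ; frobenius-+ = frobenius-+ᴷ
    ; ^q^m≈id = λ x → ^≈ (q ℕ.^ suc m) (^q^m≈id x) ; X = X ; X-conjugate-≉ = X-conjugate-≉
    }

-- Fixed field, conjugates and power basis of the extension.

module ExtensionProperties {c ℓ₁ ℓ₂ q} {F : FiniteField c ℓ₁ ℓ₂ q} {m} (E : Extension F m) where
  open FiniteField F using (enumeration)
  open ConstantDimensionCodes F using (module Finiteness)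
  open Finiteness using (1<q; anyV)
  open Extension E
  module 𝔽 = CommutativeRing (FiniteField.commutativeRing F)
  private
    module 𝔽ₚ = FiniteFieldProperties F
  open FieldProperties K inverse 1≉0 public
  open import Algebra.Properties.Semiring.Exp semiring using (_^_; ^-congˡ; ^-congʳ; ^-assocʳ)
  open import Algebra.Properties.CommutativeSemiring.Exp commutativeSemiring using (^-distrib-*)
  open import Algebra.Properties.CommutativeMonoid.Sum +-commutativeMonoid using (sum-cong-≋; ∑-distrib-+)
  open import Algebra.Properties.Semiring.Sum semiring using (*-distribˡ-sum)
  open import Algebra.Properties.Group +-group using (∙-cancelˡ; inverseʳ-unique)
  open import Algebra.Properties.Ring ring using (-‿distribˡ-*)
  open import Relation.Binary.Reasoning.Setoid setoid

  σ : 𝕂 → 𝕂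
  σ x = x ^ q

  σ-+ : ∀ x y → σ (x + y) ≈ σ x + σ y
  σ-+ = frobenius-+

  σ-* : ∀ x y → σ (x * y) ≈ σ x * σ y
  σ-* x y = ^-distrib-* x y q

  σ-1 : σ 1# ≈ 1#
  σ-1 = Frobenius.1^n≈1 K q

  σ-ι : ∀ r → σ (ι r) ≈ ι r
  σ-ι = ι-^q

  ι-≈0 : ∀ r → ι r ≈ 0# → r 𝔽.≈ 𝔽.0#
  ι-≈0 r ιr≈0 with 𝔽ₚ.inverse r
  ... | inj₁ r≈0      = r≈0
  ... | inj₂ (s , rs) = contradiction (begin
    1#              ≈⟨ trans (sym ι-1) (trans (ι-cong (𝔽.sym rs)) (ι-* r s)) ⟩
    ι r * ι s       ≈⟨ *-congʳ {ι s} ιr≈0 ⟩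
    0# * ι s        ≈⟨ zeroˡ (ι s) ⟩
    0#              ∎) 1≉0

  ι-neg : ∀ r → ι (𝔽.- r) + ι r ≈ 0#
  ι-neg r = trans (sym (ι-+ (𝔽.- r) r)) (trans (ι-cong (𝔽.-‿inverseˡ r)) ι-0)

  ι-injective : ∀ r s → ι r ≈ ι s → r 𝔽.≈ s
  ι-injective r s e = 𝔽.sym (x∙y⁻¹≈ε⇒x≈y s r (𝔽.trans (𝔽.+-comm _ _) (ι-≈0 (𝔽.- r 𝔽.+ s)
    (trans ((ι-+ (𝔽.- r) s)) (trans (+-congˡ {ι (𝔽.- r)} (sym e)) (ι-neg r))))))
    where open import Algebra.Properties.Group 𝔽.+-group using (x∙y⁻¹≈ε⇒x≈y)

  -- Otherwise `z` and the images of the `q` scalars would be `q + 1` distinct solutions of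
  -- `x^q = x`.
  fixed : ∀ z → σ z ≈ z → ∃ λ r → ι r + z ≈ 0#
  fixed z σz≈z with any? (λ i → ι (from i) ≟ z)
    where open Inverse enumeration using (from)
  ... | yes (i , e) = 𝔽.- Inverse.from enumeration i ,
        trans (+-congˡ {ι (𝔽.- Inverse.from enumeration i)} (sym e)) (ι-neg (Inverse.from enumeration i))
  ... | no none = ⊥-elim (fixed-by-power q 1<q (z ∷ ι ∘ from) (λ { zero → σz≈z ; (suc i) → σ-ι (from i) }) distinct)
    where
    open Inverse enumeration using (from)
    distinct : ∀ {i j} → i ≢ j → ¬ ((z ∷ ι ∘ from) i ≈ (z ∷ ι ∘ from) j)
    distinct {zero}  {zero}  i≢j _ = i≢j ≡.refl
    distinct {zero}  {suc j} _   e = none (j , sym e)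
    distinct {suc i} {zero}  _   e = none (i , e)
    distinct {suc i} {suc j} i≢j e = i≢j (≡.cong suc (𝔽ₚ.from-injective (ι-injective (from i) (from j) e)))

  open Linearised ι 𝔽.0# 𝔽.1# (ι-0) (ι-1) σ (λ {x} {y} → ^-congˡ q {x} {y})
    σ-+ σ-* σ-1 σ-ι fixed public

  private
    σ^ : ∀ i → 𝕂 → 𝕂
    σ^ i x = x ^ (q ℕ.^ i)

    frobenius-iter : ∀ i x y → σ^ i (x + y) ≈ σ^ i x + σ^ i y
    frobenius-iter zero x y = trans (*-identityʳ _) (sym (+-cong (*-identityʳ _) (*-identityʳ _)))
    frobenius-iter (suc i) x y = trans (sym (^-assocʳ (x + y) q (q ℕ.^ i)))
      (trans (^-congˡ (q ℕ.^ i) (frobenius-+ x y))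
      (trans (frobenius-iter i (x ^ q) (y ^ q)) (+-cong (^-assocʳ x q (q ℕ.^ i)) (^-assocʳ y q (q ℕ.^ i)))))

    -- Additivity reduces the claim to `σ^ i (x - y) ≈ 0`, and a field has no nilpotent elements.
    σ^-injective : ∀ i x y → σ^ i x ≈ σ^ i y → x ≈ y
    σ^-injective i x y e with x + - y ≟ 0#
    ... | yes x-y≈0 = x∙y⁻¹≈ε⇒x≈y x y x-y≈0
      where open import Algebra.Properties.Group +-group using (x∙y⁻¹≈ε⇒x≈y)
    ... | no x-y≉0 = contradiction (∙-cancelˡ (σ^ i y) (σ^ i (x + - y)) 0# (begin
        σ^ i y + σ^ i (x + - y)   ≈⟨ additive ⟨
        σ^ i (y + (x + - y))      ≈⟨ ^-congˡ (q ℕ.^ i) {y + (x + - y)} {x} (begin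
          y + (x + - y)             ≈⟨ +-comm y (x + - y) ⟩
          x + - y + y               ≈⟨ +-assoc x (- y) y ⟩
          x + (- y + y)             ≈⟨ +-congˡ {x} (-‿inverseˡ y) ⟩
          x + 0#                    ≈⟨ +-identityʳ x ⟩
          x                         ∎) ⟩
        σ^ i x                    ≈⟨ e ⟩
        σ^ i y                    ≈⟨ +-identityʳ (σ^ i y) ⟨
        σ^ i y + 0#               ∎)) (^-nonzero (q ℕ.^ i) x-y≉0)
      where
      additive : σ^ i (y + (x + - y)) ≈ σ^ i y + σ^ i (x + - y)
      additive = frobenius-iter i y (x + - y)

    conjugates-distinct : ∀ i j → i ℕ.< j → j ℕ.< suc m → ¬ (σ^ i X ≈ σ^ j X)
    conjugates-distinct i j i<j j≤m e with ℕ.m≤n⇒∃[o]m+o≡n i<j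
    ... | d , ≡.refl = X-conjugate-≉ d (ℕ.≤-<-trans (ℕ.s≤s (ℕ.m≤n+m d i)) j≤m)
      (σ^-injective i (σ^ (suc d) X) X (begin
        σ^ i (σ^ (suc d) X)               ≈⟨ ^-assocʳ X (q ℕ.^ suc d) (q ℕ.^ i) ⟩
        X ^ (q ℕ.^ suc d ℕ.* q ℕ.^ i)
          ≈⟨ ^-congʳ X (≡.trans (≡.sym (ℕ.^-distribˡ-+-* q (suc d) i)) (≡.cong (q ℕ.^_) (≡.cong suc (ℕ.+-comm d i)))) ⟩
        σ^ (suc i ℕ.+ d) X                ≈⟨ e ⟨
        σ^ i X                            ∎))

    eval-σ : ∀ {k} (r : Vector 𝔽.Carrier k) x → σ (eval (ι ∘ r) x) ≈ eval (ι ∘ r) (σ x)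
    eval-σ {zero}  r x = σ-0
    eval-σ {suc k} r x = begin
      σ (ι (r zero) + x * eval (ι ∘ r ∘ suc) x)         ≈⟨ σ-+ (ι (r zero)) (x * eval (ι ∘ r ∘ suc) x) ⟩
      σ (ι (r zero)) + σ (x * eval (ι ∘ r ∘ suc) x)
        ≈⟨ +-cong {σ (ι (r zero))} {ι (r zero)} (σ-ι (r zero)) (^-distrib-* x (eval (ι ∘ r ∘ suc) x) q) ⟩
      ι (r zero) + σ x * σ (eval (ι ∘ r ∘ suc) x)
        ≈⟨ +-congˡ {ι (r zero)} (*-congˡ {σ x} (eval-σ (r ∘ suc) x)) ⟩
      ι (r zero) + σ x * eval (ι ∘ r ∘ suc) (σ x)       ∎

    eval-cong : ∀ {k} (a : Vector 𝕂 k) {x y} → x ≈ y → eval a x ≈ eval a y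
    eval-cong {zero}  a e = refl {0#}
    eval-cong {suc k} a {x} {y} e = +-congˡ {a zero} (*-cong {x} {y} e (eval-cong (a ∘ suc) e))

    conjugate-root : ∀ {k} (r : Vector 𝔽.Carrier k) x → eval (ι ∘ r) x ≈ 0# → ∀ i → eval (ι ∘ r) (σ^ i x) ≈ 0#
    conjugate-root r x e zero    = trans (eval-cong (ι ∘ r) (*-identityʳ x)) e
    conjugate-root r x e (suc i) = trans (eval-cong (ι ∘ r) (sym (^-assocʳ x q (q ℕ.^ i))))
      (conjugate-root r (σ x) (trans (sym (eval-σ r x)) (trans (^-congˡ q {eval (ι ∘ r) x} e) σ-0)) i)

  powers : ∀ k → Vector 𝕂 k
  powers k i = X ^ toℕ i

  -- A relation is a polynomial over the base field with `k` coefficients and root `X`. Its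
  -- coefficients are fixed by `σ`, so the first `k` conjugates of `X` are roots as well, and they
  -- are distinct.
  powers-independent : ∀ {k} → k ℕ.≤ suc m → LinearlyIndependent (powers k)
  powers-independent {k} k≤m r e = roots⇒0 (ι ∘ r) (λ i → σ^ (toℕ i) X) distinct
    (λ i → conjugate-root r X (trans (eval-∑ (ι ∘ r) X) e) (toℕ i))
    where
    toℕ<m : ∀ (i : Fin k) → toℕ i ℕ.< suc m
    toℕ<m i = ℕ.<-≤-trans (toℕ<n i) k≤m
    distinct : ∀ {i j : Fin k} → i ≢ j → ¬ (σ^ (toℕ i) X ≈ σ^ (toℕ j) X)
    distinct {i} {j} i≢j e with ℕ.<-cmp (toℕ i) (toℕ j)
    ... | tri< i<j _ _ = conjugates-distinct (toℕ i) (toℕ j) i<j (toℕ<m j) e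
    ... | tri≈ _ i≡j _ = i≢j (toℕ-injective i≡j)
    ... | tri> _ _ j<i = conjugates-distinct (toℕ j) (toℕ i) j<i (toℕ<m i) (sym e)

  basis : Vector 𝕂 (suc m)
  basis = powers (suc m)

  basis-independent : LinearlyIndependent basis
  basis-independent = powers-independent ℕ.≤-refl

  linear-* : ∀ {k} s (r : Vector 𝔽.Carrier k) x → linear (λ i → s 𝔽.* r i) x ≈ ι s * linear r x
  linear-* {k} s r x = trans
    (sum-cong-≋ {k} λ i → trans (*-congʳ {x i} (ι-* s (r i))) (*-assoc (ι s) (ι (r i)) (x i)))
    (sym (*-distribˡ-sum {k} (ι s) (λ i → ι (r i) * x i)))

  linear-+ : ∀ {k} (r s : Vector 𝔽.Carrier k) x → linear (λ i → r i 𝔽.+ s i) x ≈ linear r x + linear s x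
  linear-+ {k} r s x = trans
    (sum-cong-≋ {k} λ i → trans (*-congʳ {x i} (ι-+ (r i) (s i))) (distribʳ (x i) (ι (r i)) (ι (s i))))
    (∑-distrib-+ {k} (λ i → ι (r i) * x i) (λ i → ι (s i) * x i))

  linear-cong : ∀ {k} {r s : Vector 𝔽.Carrier k} x → (∀ i → r i 𝔽.≈ s i) → linear r x ≈ linear s x
  linear-cong {k} x e = sum-cong-≋ {k} λ i → *-congʳ {x i} (ι-cong (e i))

  private
    extend-independent : ∀ {k} (x : Vector 𝕂 k) y → LinearlyIndependent x →
                         ¬ (∃ λ r → linear r x ≈ y) → LinearlyIndependent (y ∷ x)
    extend-independent x y ind none r e with 𝔽ₚ.inverse (r zero)
    ... | inj₁ r₀≈0 = λ
            { zero → ιr₀≈0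
            ; (suc i) → ind (r ∘ suc) (begin
                linear (r ∘ suc) x                   ≈⟨ +-identityˡ (linear (r ∘ suc) x) ⟨
                0# + linear (r ∘ suc) x
                  ≈⟨ +-congʳ {linear (r ∘ suc) x} (trans (*-congʳ {y} ιr₀≈0) (zeroˡ y)) ⟨
                ι (r zero) * y + linear (r ∘ suc) x  ≈⟨ e ⟩
                0#                                   ∎) i }
      where
      ιr₀≈0 : ι (r zero) ≈ 0#
      ιr₀≈0 = trans (ι-cong r₀≈0) ι-0
    ... | inj₂ (s , r₀s) = contradiction ((λ i → 𝔽.- s 𝔽.* r (suc i)) , (begin
        linear (λ i → 𝔽.- s 𝔽.* r (suc i)) x   ≈⟨ linear-* (𝔽.- s) (r ∘ suc) x ⟩
        ι (𝔽.- s) * L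
          ≈⟨ *-cong {ι (𝔽.- s)} { - ι s} (inverseʳ-unique (ι s) (ι (𝔽.- s)) (trans (+-comm (ι s) (ι (𝔽.- s))) (ι-neg s))) (inverseʳ-unique (ι (r zero) * y) L e) ⟩
        - ι s * - (ι (r zero) * y)               ≈⟨ -x*-y (ι s) (ι (r zero) * y) ⟩
        ι s * (ι (r zero) * y)                   ≈⟨ *-assoc (ι s) (ι (r zero)) y ⟨
        ι s * ι (r zero) * y
          ≈⟨ *-congʳ {y} (trans (sym (ι-* s (r zero))) (trans (ι-cong (𝔽.trans (𝔽.*-comm s (r zero)) r₀s)) ι-1)) ⟩
        1# * y                                   ≈⟨ *-identityˡ y ⟩
        y                                        ∎)) none
      where
      L = linear (r ∘ suc) x
      -x*-y : ∀ x y → - x * - y ≈ x * y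
      -x*-y x y = trans (sym (-‿distribˡ-* x (- y))) (trans (-‿cong (sym (-‿distribʳ-* x y))) (-‿involutive (x * y)))
        where open import Algebra.Properties.Ring ring using (-‿distribʳ-*; -‿involutive)

    top : ∀ k → Vector 𝕂 (suc k)
    top zero    = 1# ∷ []
    top (suc k) = 0# ∷ top k

    linearised-top : ∀ k x → linearised (top k) x ≈ σ^ k x
    linearised-top zero    x = trans (+-identityʳ (1# * x)) (trans (*-identityˡ x) (sym (*-identityʳ x)))
    linearised-top (suc k) x = begin
      0# * x + linearised (top k) (σ x)   ≈⟨ +-congʳ {linearised (top k) (σ x)} (zeroˡ x) ⟩
      0# + linearised (top k) (σ x)       ≈⟨ +-identityˡ _ ⟩
      linearised (top k) (σ x)            ≈⟨ linearised-top k (σ x) ⟩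
      σ^ k (σ x)                          ≈⟨ ^-assocʳ x q (q ℕ.^ k) ⟩
      σ^ (suc k) x                        ∎

  -- σ^(m+1) - 1 vanishes on the whole field, so there are at most m+1 independent elements.
  basis-spans : ∀ y → ∃ λ r → linear r basis ≈ y
  basis-spans y with anyV {P = λ r → linear r basis ≈ y} (λ r → linear r basis ≟ y)
    (λ {r} {s} r≋s e → trans (linear-cong basis (𝔽.sym ∘ r≋s)) e)
  ... | yes p   = p
  ... | no none = contradiction (begin
      1#           ≈⟨ +-identityˡ 1# ⟨
      0# + 1#
        ≈⟨ +-congʳ {1#} (kernel-bound (y ∷ basis) (extend-independent basis y basis-independent none)
                        (- 1# ∷ top m) root zero) ⟨
      - 1# + 1#    ≈⟨ -‿inverseˡ 1# ⟩
      0#           ∎) 1≉0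
    where
    root : ∀ j → linearised (- 1# ∷ top m) ((y ∷ basis) j) ≈ 0#
    root j = begin
      - 1# * z + linearised (top m) (σ z)
        ≈⟨ +-cong { - 1# * z} { - z} (trans (sym (-‿distribˡ-* 1# z)) (-‿cong (*-identityˡ z)))
                                                (trans (linearised-top m (σ z)) (trans (^-assocʳ z q (q ℕ.^ m)) (^q^m≈id z))) ⟩
      - z + z                              ≈⟨ -‿inverseˡ z ⟩
      0#                                   ∎
      where z = (y ∷ basis) j

-- Linear algebra: dimension, rank and kernels.

private
  -- For equal dimensions the distance is `2 (κ - t)`; `t ≤ κ` makes the truncated subtraction
  -- exact.
  half-distance : ∀ {k l κ t δ} → k ≡ κ → l ≡ κ → t ≤ κ → δ ℕ.* 2 ≤ k ℕ.+ l ∸ 2 ℕ.* t → t ℕ.+ δ ≤ κ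
  half-distance {_} {_} {κ} {t} {δ} ≡.refl ≡.refl t≤κ d≤ = ℕ.*-cancelʳ-≤ (t ℕ.+ δ) κ 2 (begin
    (t ℕ.+ δ) ℕ.* 2                   ≡⟨ ℕ.*-distribʳ-+ 2 t δ ⟩
    t ℕ.* 2 ℕ.+ δ ℕ.* 2               ≤⟨ ℕ.+-monoʳ-≤ (t ℕ.* 2) d≤ ⟩
    t ℕ.* 2 ℕ.+ (κ ℕ.+ κ ∸ 2 ℕ.* t)
      ≡⟨ ≡.cong₂ (λ u w → u ℕ.+ (κ ℕ.+ w ∸ 2 ℕ.* t)) (ℕ.*-comm t 2) (≡.sym (ℕ.+-identityʳ κ)) ⟩
    2 ℕ.* t ℕ.+ (2 ℕ.* κ ∸ 2 ℕ.* t)   ≡⟨ ℕ.m+[n∸m]≡n (ℕ.*-monoʳ-≤ 2 t≤κ) ⟩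
    2 ℕ.* κ                           ≡⟨ ℕ.*-comm 2 κ ⟩
    κ ℕ.* 2                           ∎)
    where open ℕ.≤-Reasoning

module LinearAlgebra {c ℓ₁ ℓ₂ q} (F : FiniteField c ℓ₁ ℓ₂ q) where
  open FiniteField F using (commutativeRing)
  open ConstantDimensionCodes F
  open Finiteness
  open CommutativeRing commutativeRing hiding (zero)
  open FiniteFieldProperties F using (inverse)
  open import Data.Vec.Functional.Relation.Binary.Equality.Setoid setoid using (_≋_)
  open import Algebra.Properties.CommutativeMonoid.Sum +-commutativeMonoid
  open import Algebra.Properties.Semiring.Sum semiring using (*-distribˡ-sum; *-distribʳ-sum)
  open import Algebra.Properties.Group +-group using (inverseˡ-unique; inverseʳ-unique; ⁻¹-involutive; x∙y⁻¹≈ε⇒x≈y)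
  open import Algebra.Properties.Ring ring using (-‿distribˡ-*; -‿distribʳ-*; -1*x≈-x)
  open import Relation.Binary.Reasoning.Setoid setoid

  private variable
    k m n s v : ℕ

  0ᵛ : Vector 𝔽 v
  0ᵛ _ = 0#

  combination-assoc : ∀ (a : Vector 𝔽 k) (d : Family k m) (b : Family m v) →
    combination a (λ i → combination (d i) b) ≋ combination (combination a d) b
  combination-assoc {k} {m} a d b j = begin
    ∑[ i < k ] (a i * ∑[ l < m ] (d i l * b l j))
      ≈⟨ sum-cong-≋ {k} (λ i → *-distribˡ-sum (a i) (λ l → d i l * b l j)) ⟩
    ∑[ i < k ] (∑[ l < m ] (a i * (d i l * b l j)))
      ≈⟨ ∑-comm {k} {m} (λ i l → a i * (d i l * b l j)) ⟩
    ∑[ l < m ] (∑[ i < k ] (a i * (d i l * b l j)))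
      ≈⟨ sum-cong-≋ {m} (λ l → trans (sum-cong-≋ {k} (λ i → sym (*-assoc (a i) (d i l) (b l j)))) (sym (*-distribʳ-sum (b l j) (λ i → a i * d i l)))) ⟩
    ∑[ l < m ] (∑[ i < k ] (a i * d i l) * b l j) ∎

  combination-0ʳ : ∀ (a : Vector 𝔽 k) (b : Family k v) → (∀ i → b i ≋ 0ᵛ) → combination a b ≋ 0ᵛ
  combination-0ʳ {k} a b b≈0 j = trans (sum-cong-≋ {k} λ i → trans (*-congˡ (b≈0 i j)) (zeroʳ (a i))) (sum-replicate-zero k)

  combination-congˡ : ∀ {a a′ : Vector 𝔽 k} (b : Family k v) → a ≋ a′ → combination a b ≋ combination a′ b
  combination-congˡ b a≋ = combination-cong {b = b} {b} a≋ (λ _ _ → refl)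

  combination-congʳ : ∀ (a : Vector 𝔽 k) {b b′ : Family k v} → b ≋≋ b′ → combination a b ≋ combination a b′
  combination-congʳ a b≋ = combination-cong {a = a} (λ _ → refl) b≋

  combination-member : ∀ (U : Subspace v) (a : Vector 𝔽 k) (b : Family k v) →
                       (∀ i → member U (b i)) → member U (combination a b)
  combination-member {k = zero}  U a b b∈U = 0-closed U
  combination-member {k = suc k} U a b b∈U = +-closed U (*-closed U (a zero) (b∈U zero))
    (combination-member U (a ∘ suc) (b ∘ suc) (b∈U ∘ suc))

  unit : ∀ {n} → Family n n
  unit zero    zero    = 1#
  unit zero    (suc j) = 0#
  unit (suc i) zero    = 0#
  unit (suc i) (suc j) = unit i j

  combination-unit : ∀ (a : Vector 𝔽 n) → combination a unit ≋ a
  combination-unit {suc n} a zero = begin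
    a zero * 1# + ∑[ i < n ] (a (suc i) * 0#)
      ≈⟨ +-cong (*-identityʳ _) (trans (sum-cong-≋ {n} (λ i → zeroʳ (a (suc i)))) (sum-replicate-zero n)) ⟩
    a zero + 0#                                 ≈⟨ +-identityʳ _ ⟩
    a zero                                      ∎
  combination-unit {suc n} a (suc j) =
    trans (+-cong (zeroʳ _) (combination-unit (a ∘ suc) j)) (+-identityˡ _)

  combination-unitˡ : ∀ (b : Family n v) i → combination (unit i) b ≋ b i
  combination-unitˡ {suc n} b zero j = trans (+-cong (*-identityˡ _)
    (combination-0 (b ∘ suc) j)) (+-identityʳ _)
  combination-unitˡ {suc n} b (suc i) j =
    trans (+-cong (zeroˡ _) (combination-unitˡ (b ∘ suc) i j)) (+-identityˡ _)

  unit-independent : Independent (unit {n})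
  unit-independent a e i = trans (sym (combination-unit a i)) (e i)

  member-basis : ∀ (b : Family n v) i → Span b (b i)
  member-basis b i = unit i , combination-unitˡ b i

  Span-⊆ : ∀ (b : Family k v) (b′ : Family m v) → (∀ i → Span b′ (b i)) → Span b ⊆ Span b′
  Span-⊆ b b′ b⊂b′ (a , e) = Span-resp {b = b′} e (combination-member (span b′) a b b⊂b′)

  ∷-independent : ∀ {b : Family m v} {x} → Independent b → ¬ Span b x → Independent (x ∷ b)
  ∷-independent {b = b} {x} ind x∉ a e with inverse (a zero)
  ... | inj₁ a₀≈0 = λ { zero → a₀≈0 ; (suc i) → ind (a ∘ suc) (λ j → begin
      combination (a ∘ suc) b j                ≈⟨ +-identityˡ _ ⟨
      0# + combination (a ∘ suc) b j           ≈⟨ +-congʳ (trans (*-congʳ a₀≈0) (zeroˡ (x j))) ⟨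
      a zero * x j + combination (a ∘ suc) b j ≈⟨ e j ⟩
      0#                                       ∎) i }
  ... | inj₂ (r , a₀r≈1) = contradiction ((λ i → - r * a (suc i)) , λ j → begin
      combination (λ i → - r * a (suc i)) b j  ≈⟨ combination-* (- r) (a ∘ suc) b j ⟩
      - r * L j                                ≈⟨ *-congˡ (inverseʳ-unique (a zero * x j) (L j) (e j)) ⟩
      - r * - (a zero * x j)                   ≈⟨ -‿distribˡ-* r _ ⟨
      - (r * - (a zero * x j))                 ≈⟨ -‿cong (sym (-‿distribʳ-* r _)) ⟩
      - - (r * (a zero * x j))                 ≈⟨ ⁻¹-involutive _ ⟩
      r * (a zero * x j)                       ≈⟨ *-assoc _ _ _ ⟨
      r * a zero * x j                         ≈⟨ *-congʳ (trans (*-comm r (a zero)) a₀r≈1) ⟩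
      1# * x j                                 ≈⟨ *-identityˡ _ ⟩
      x j                                      ∎) x∉
    where
    L : Vector 𝔽 _
    L = combination (a ∘ suc) b

  combination-injective : ∀ (b : Family m v) → Independent b → ∀ {a a′} →
                          combination a b ≋ combination a′ b → a ≋ a′
  combination-injective b ind {a} {a′} e i = x∙y⁻¹≈ε⇒x≈y (a i) (a′ i) (trans (+-congˡ (sym (-1*x≈-x (a′ i))))
    (ind (λ i → a i + - 1# * a′ i) (λ j → begin
      combination (λ i → a i + - 1# * a′ i) b j                ≈⟨ combination-+ a (λ i → - 1# * a′ i) b j ⟩
      combination a b j + combination (λ i → - 1# * a′ i) b j
        ≈⟨ +-cong (e j) (trans (combination-* (- 1#) a′ b j) (-1*x≈-x _)) ⟩
      combination a′ b j + - combination a′ b j                ≈⟨ -‿inverseʳ _ ⟩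
      0#                                                       ∎) i))

  -- An independent family in `U` is enlarged by vectors outside its span until none is left.
  -- Independent families have at most `v` members, so the fuel `f = v - m` suffices.
  hasDim : ∀ (U : Subspace v) → Decidable (member U) → ∃ (HasDim U)
  hasDim {v} U U? = grow v 0 ≡.refl [] (λ _ _ ()) (λ ())
    where
    grow : ∀ f m → m ℕ.+ f ≡ v → (b : Family m v) → Independent b → (∀ i → member U (b i)) → ∃ (HasDim U)
    grow f m m+f≡v b ind b∈U with anyV {P = λ x → member U x × ¬ Span b x} (λ x → U? x ×-dec ¬? (span? b x))
      (λ x≋y (x∈U , x∉) → resp U x≋y x∈U , λ y∈ → x∉ (Span-resp {b = b} (sym ∘ x≋y) y∈))
    ... | no none = m , b , ind
          , (λ {x} x∈U → decidable-stable (span? b x) (λ x∉ → none (x , x∈U , x∉)))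
          , λ (a , e) → resp U e (combination-member U a b b∈U)
    grow zero    m m≡v b ind b∈U | yes (x , x∈U , x∉) =
      contradiction (independent⇒≤ (x ∷ b) (∷-independent ind x∉))
        (ℕ.<-irrefl (≡.trans (≡.sym (ℕ.+-identityʳ m)) m≡v))
    grow (suc f) m m+f≡v b ind b∈U | yes (x , x∈U , x∉) =
      grow f (suc m) (≡.trans (≡.sym (ℕ.+-suc m f)) m+f≡v) (x ∷ b) (∷-independent ind x∉)
        (λ { zero → x∈U ; (suc i) → b∈U i })

  -- The coordinates of `b` with respect to `b′` are `k` independent vectors of length `m`, which
  -- reduces the claim to the bound for the full coordinate space.
  independent-in-span : ∀ (b : Family k v) (b′ : Family m v) → Independent b → (∀ i → Span b′ (b i)) → k ≤ m
  independent-in-span b b′ ind b⊂b′ = independent⇒≤ d λ a e → ind a λ j → begin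
    combination a b j
      ≈⟨ combination-congʳ a (λ i j → sym (proj₂ (b⊂b′ i) j)) j ⟩
    combination a (λ i → combination (d i) b′) j     ≈⟨ combination-assoc a d b′ j ⟩
    combination (combination a d) b′ j               ≈⟨ combination-congˡ b′ e j ⟩
    combination 0ᵛ b′ j                              ≈⟨ combination-0 b′ j ⟩
    0#                                               ∎
    where
    d : Family _ _
    d i = proj₁ (b⊂b′ i)

  independent⇒≤dim : ∀ (U : Subspace v) → HasDim U m → (b : Family k v) → Independent b → (∀ i → member U (b i)) → k ≤ m
  independent⇒≤dim U (b′ , _ , U⊆ , _) b ind b∈U = independent-in-span b b′ ind (λ i → U⊆ (b∈U i))

  basis-member : ∀ (U : Subspace v) ((b , _) : HasDim U m) → ∀ i → member U (b i)
  basis-member U (b , _ , _ , ⊆U) i = ⊆U (member-basis b i)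

  dim-unique : ∀ (U : Subspace v) → HasDim U k → HasDim U m → k ≡ m
  dim-unique U hk@(b , ind , _) hm@(b′ , ind′ , _) = ℕ.≤-antisym
    (independent⇒≤dim U hm b ind (basis-member U hk))
    (independent⇒≤dim U hk b′ ind′ (basis-member U hm))

  member? : ∀ (U : Subspace v) → HasDim U m → Decidable (member U)
  member? U (b , _ , U⊆ , ⊆U) x = map′ ⊆U U⊆ (span? b x)

  sum-++ : ∀ m {n} (f : Vector 𝔽 (m ℕ.+ n)) →
           sum f ≈ ∑[ i < m ] f (i ↑ˡ n) + ∑[ j < n ] f (m ↑ʳ j)
  sum-++ zero    f = sym (+-identityˡ _)
  sum-++ (suc m) f = trans (+-congˡ (sum-++ m (f ∘ suc))) (sym (+-assoc _ _ _))

  combination-++ : ∀ (a : Vector 𝔽 (m ℕ.+ n)) (b : Family m v) (b′ : Family n v) →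
                   combination a (b ++ b′) ≋ λ j → combination (λ i → a (i ↑ˡ n)) b j + combination (λ i → a (m ↑ʳ i)) b′ j
  combination-++ {m} {n} a b b′ j = trans (sum-++ m (λ i → a i * (b ++ b′) i j)) (+-cong
    (sum-cong-≋ {m} λ i → *-congˡ (reflexive (≡.cong (λ x → x j) (lookup-++ˡ b b′ i))))
    (sum-cong-≋ {n} λ i → *-congˡ (reflexive (≡.cong (λ x → x j) (lookup-++ʳ b b′ i)))))

  ++-≋ : ∀ m {n} {x y : Vector 𝔽 (m ℕ.+ n)} → (∀ i → x (i ↑ˡ n) ≈ y (i ↑ˡ n)) → (∀ i → x (m ↑ʳ i) ≈ y (m ↑ʳ i)) → x ≋ y
  ++-≋ zero    l r i       = r i
  ++-≋ (suc m) l r zero    = l zero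
  ++-≋ (suc m) l r (suc i) = ++-≋ m (l ∘ suc) r i

  -- The left kernel, consisting of the relations among the rows of `b`. `Lift` only adjusts the
  -- universe level.
  kernel : Family m v → Subspace m
  kernel b = record
    { member   = λ a → Lift c (combination a b ≋ 0ᵛ)
    ; resp     = λ x≋y (lift e) → lift λ j → trans (combination-congˡ b (sym ∘ x≋y) j) (e j)
    ; 0-closed = lift (combination-0 b)
    ; +-closed = λ {x} {y} (lift e) (lift f) → lift λ j → trans (combination-+ x y b j)
        (trans (+-cong (e j) (f j)) (+-identityˡ 0#))
    ; *-closed = λ r {x} (lift e) → lift λ j → trans (combination-* r x b j) (trans (*-congˡ (e j)) (zeroʳ r))
    }

  kernelDim : ∀ (b : Family m v) → ∃ (HasDim (kernel b))
  kernelDim b = hasDim (kernel b) (λ a → map′ lift lower (combination a b ≋? 0ᵛ))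

  rank : ∀ (b : Family m v) → ∃ (HasDim (span b))
  rank b = hasDim (span b) (span? b)

  -- A basis `h` of the kernel and preimages `p` of a basis `g` of the row space together form a
  -- basis of the coefficient space.
  rank-nullity : ∀ (b : Family m v) → HasDim (kernel b) k → HasDim (span b) n → m ≡ k ℕ.+ n
  rank-nullity {m} {v} {k} {n} b (h , h-ind , ker⊆h , h⊆ker) (g , g-ind , b⊆g , g⊆b) = ℕ.≤-antisym
    (independent-in-span unit (h ++ p) unit-independent (λ i → spans (unit i)))
    (independent⇒≤ (h ++ p) ind)
    where
    g∈b : ∀ i → Span b (g i)
    g∈b i = g⊆b (member-basis g i)
    p : Family n m
    p i = proj₁ (g∈b i)
    h∈ker : ∀ i → combination (h i) b ≋ 0ᵛ
    h∈ker i = lower (h⊆ker (member-basis h i))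
    image : ∀ a → combination (combination a p) b ≋ combination a g
    image a j = trans (sym (combination-assoc a p b j)) (combination-congʳ a (λ i → proj₂ (g∈b i)) j)
    ind : Independent (h ++ p)
    ind a e = ++-≋ k (h-ind aₗ (λ j → begin
        combination aₗ h j                          ≈⟨ +-identityʳ _ ⟨
        combination aₗ h j + 0#
          ≈⟨ +-congˡ (trans (combination-congˡ p aᵣ≈0 j) (combination-0 p j)) ⟨
        combination aₗ h j + combination aᵣ p j     ≈⟨ combination-++ a h p j ⟨
        combination a (h ++ p) j                    ≈⟨ e j ⟩
        0#                                          ∎)) aᵣ≈0
      where
      aₗ : Vector 𝔽 k
      aₗ i = a (i ↑ˡ n)
      aᵣ : Vector 𝔽 n
      aᵣ i = a (k ↑ʳ i)
      aᵣ≈0 : ∀ i → aᵣ i ≈ 0#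
      aᵣ≈0 = g-ind aᵣ λ j → begin
        combination aᵣ g j                                 ≈⟨ image aᵣ j ⟨
        combination (combination aᵣ p) b j                 ≈⟨ +-identityˡ _ ⟨
        0# + combination (combination aᵣ p) b j
          ≈⟨ +-congʳ (trans (sym (combination-assoc aₗ h b j)) (combination-0ʳ aₗ _ h∈ker j)) ⟨
        combination (combination aₗ h) b j + combination (combination aᵣ p) b j
          ≈⟨ combination-+ (combination aₗ h) (combination aᵣ p) b j ⟨
        combination (λ i → combination aₗ h i + combination aᵣ p i) b j
          ≈⟨ combination-congˡ b (λ i → trans (sym (combination-++ a h p i)) (e i)) j ⟩
        combination 0ᵛ b j                                 ≈⟨ combination-0 b j ⟩
        0#                                                 ∎
    spans : ∀ x → Span (h ++ p) x
    spans x = (aₗ ++ aᵣ) , λ j → begin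
      combination (aₗ ++ aᵣ) (h ++ p) j         ≈⟨ combination-++ (aₗ ++ aᵣ) h p j ⟩
      combination (λ i → (aₗ ++ aᵣ) (i ↑ˡ n)) h j + combination (λ i → (aₗ ++ aᵣ) (k ↑ʳ i)) p j
        ≈⟨ +-cong (combination-congˡ h (λ i → reflexive (lookup-++ˡ aₗ aᵣ i)) j)
                  (combination-congˡ p (λ i → reflexive (lookup-++ʳ aₗ aᵣ i)) j) ⟩
      combination aₗ h j + combination aᵣ p j   ≈⟨ +-congʳ (eₗ j) ⟩
      (x j + - 1# * y j) + y j                  ≈⟨ +-assoc _ _ _ ⟩
      x j + (- 1# * y j + y j)
        ≈⟨ +-congˡ (trans (+-congʳ (-1*x≈-x (y j))) (-‿inverseˡ (y j))) ⟩
      x j + 0#                                  ≈⟨ +-identityʳ _ ⟩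
      x j                                       ∎
      where
      x∈ : Span g (combination x b)
      x∈ = b⊆g (x , λ _ → refl)
      aᵣ : Vector 𝔽 n
      aᵣ = proj₁ x∈
      y : Vector 𝔽 m
      y = combination aᵣ p
      rest : Span h (λ i → x i + - 1# * y i)
      rest = ker⊆h (lift λ j → begin
        combination (λ i → x i + - 1# * y i) b j               ≈⟨ combination-+ x (λ i → - 1# * y i) b j ⟩
        combination x b j + combination (λ i → - 1# * y i) b j
          ≈⟨ +-congˡ (trans (combination-* (- 1#) y b j) (-1*x≈-x _)) ⟩
        combination x b j + - combination y b j
          ≈⟨ +-congˡ (-‿cong (trans (image aᵣ j) (proj₂ x∈ j))) ⟩
        combination x b j + - combination x b j                ≈⟨ -‿inverseʳ _ ⟩
        0#                                                     ∎)
      aₗ : Vector 𝔽 k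
      aₗ = proj₁ rest
      eₗ = proj₂ rest

  transpose : Family m v → Family v m
  transpose b j i = b i j

  -- Expressing the rows in a basis of the row space factors `b` through a matrix `d` with `k`
  -- columns, and every column of `b` is a combination of these.
  rank-transpose-≤ : ∀ (b : Family m v) → HasDim (span b) k → HasDim (span (transpose b)) n → n ≤ k
  rank-transpose-≤ {m} {v} {k} b (g , _ , b⊆g , _) (g′ , ind′ , _ , g′⊆) =
    independent-in-span g′ (transpose d) ind′ λ i → Span-⊆ (transpose b) (transpose d) columns (g′⊆ (member-basis g′ i))
    where
    b∈g : ∀ i → Span g (b i)
    b∈g i = b⊆g (member-basis b i)
    d : Family m k
    d i = proj₁ (b∈g i)
    columns : ∀ j → Span (transpose d) (transpose b j)
    columns j = (λ l → g l j) , λ i → trans (sum-cong-≋ {k} λ l → *-comm (g l j) (d i l)) (proj₂ (b∈g i) j)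

  -- Row rank equals column rank.
  kernel-transpose : ∀ (b : Family m v) → HasDim (kernel b) k → HasDim (kernel (transpose b)) n → k ℕ.+ v ≡ n ℕ.+ m
  kernel-transpose {m} {v} {k} {n} b hk hn with rank b | rank (transpose b)
  ... | r , hr | r′ , hr′ = ≡.trans
    (≡.cong (k ℕ.+_) (rank-nullity (transpose b) hn hr′))
    (≡.trans (ℕ+.x∙yz≈y∙xz k n r′) (≡.cong (n ℕ.+_) (≡.trans (≡.cong (k ℕ.+_) r′≡r) (≡.sym (rank-nullity b hk hr)))))
    where
    import Algebra.Properties.CommutativeSemigroup ℕ.+-commutativeSemigroup as ℕ+
    r′≡r : r′ ≡ r
    r′≡r = ℕ.≤-antisym (rank-transpose-≤ b hr hr′) (rank-transpose-≤ (transpose b) hr′ hr)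

  -- Minimum distance and dual codes.

  -- Expresses `dim (U ∩ W) + δ ≤ κ` without naming the dimension; between subspaces of dimension
  -- `κ` this means distance at least `2δ`.
  Separated : (κ δ : ℕ) → Subspace v → Subspace v → Set _
  Separated {v} κ δ U W = ∀ {s} (b : Family s v) → Independent b →
    (∀ i → member U (b i)) → (∀ i → member W (b i)) → s ℕ.+ δ ≤ κ

  codewords-separated : ∀ {δ κ n} (C : Code v (δ ℕ.* 2) κ n) → let open Code C in
                        ∀ {i j} → i ≢ j → Separated κ δ (codeword i) (codeword j)
  codewords-separated {δ = δ} {κ} C {i} {j} i≢j {s} b ind b∈U b∈W with Code.distance C i≢j
  ... | _ , (k , l , t , hU , hW , hI , ≡.refl) , d≤ = ℕ.≤-trans (ℕ.+-monoˡ-≤ δ s≤t)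
      (half-distance (dim-unique U hU (dimension i)) (dim-unique W hW (dimension j)) t≤κ d≤)
    where
    open Code C
    U = codeword i
    W = codeword j
    s≤t : s ≤ t
    s≤t = independent⇒≤dim (U ∩ₛ W) hI b ind (λ i → b∈U i , b∈W i)
    t≤κ : t ≤ κ
    t≤κ = independent⇒≤dim U (dimension i) (proj₁ hI) (proj₁ (proj₂ hI)) (proj₁ ∘ basis-member (U ∩ₛ W) hI)

  -- Two equal codewords would share a basis of `κ` vectors, contradicting separation as `1 ≤ δ`.
  separated-code : ∀ {δ κ n} → 1 ≤ δ → (U : Fin n → Subspace v) → (∀ i → HasDim (U i) κ) →
                   (∀ {i j} → i ≢ j → Separated κ δ (U i) (U j)) → Code v (δ ℕ.* 2) κ n
  separated-code {v} {δ} {κ} 1≤δ U dims sep = record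
    { codeword  = U
    ; injective = injective
    ; dimension = dims
    ; distance  = distance
    }
    where
    injective : ∀ {i j} → U i ≈ₛ U j → i ≡ j
    injective {i} {j} U≈ with i ≟ᶠ j
    ... | yes i≡j = i≡j
    ... | no i≢j  = contradiction (sep i≢j (proj₁ (dims i)) (proj₁ (proj₂ (dims i)))
      (basis-member (U i) (dims i)) (proj₁ U≈ ∘ basis-member (U i) (dims i)))
      (ℕ.<⇒≱ (≡.subst (ℕ._≤ κ ℕ.+ δ) (ℕ.+-comm κ 1) (ℕ.+-monoʳ-≤ κ 1≤δ)))
    distance : ∀ {i j} → i ≢ j → _
    distance {i} {j} i≢j with hasDim (U i ∩ₛ U j) (λ x → member? (U i) (dims i) x ×-dec member? (U j) (dims j) x)
    ... | s , h@(b , ind , _) = _ , (κ , κ , s , dims i , dims j , h , ≡.refl) , ℕ.m+n≤o⇒m≤o∸n (δ ℕ.* 2) (≡.subst₂ _≤_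
      (≡.trans (ℕ.*-distribʳ-+ 2 s δ) (≡.trans (ℕ.+-comm (s ℕ.* 2) (δ ℕ.* 2)) (≡.cong (δ ℕ.* 2 ℕ.+_) (ℕ.*-comm s 2))))
      (≡.trans (ℕ.*-comm κ 2) (≡.cong (κ ℕ.+_) (ℕ.+-identityʳ κ)))
      (ℕ.*-monoˡ-≤ 2 (sep i≢j b ind (proj₁ ∘ basis-member (U i ∩ₛ U j) h) (proj₂ ∘ basis-member (U i ∩ₛ U j) h))))

  orthogonal : Family m v → Subspace v
  orthogonal b = kernel (transpose b)

  kernel-independent : ∀ (b : Family m v) → Independent b → HasDim (kernel b) 0
  kernel-independent b ind = [] , (λ _ _ ()) ,
    (λ {x} (lift e) → (λ ()) , λ j → sym (ind x e j)) ,
    (λ {x} (a , e) → lift λ j → trans (combination-congˡ b (λ i → sym (e i)) j) (combination-0 b j))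

  orthogonal-dim : ∀ {κ κ′} (b : Family κ v) → Independent b → κ ℕ.+ κ′ ≡ v → HasDim (orthogonal b) κ′
  orthogonal-dim {v} {κ} {κ′} b ind κ+κ′≡v with kernelDim (transpose b)
  ... | s , hs = ≡.subst (HasDim (orthogonal b)) (ℕ.+-cancelʳ-≡ κ s κ′
    (≡.trans (≡.sym (kernel-transpose b (kernel-independent b ind) hs)) (≡.trans (≡.sym κ+κ′≡v) (ℕ.+-comm κ κ′)))) hs

  -- Let `D` be the dimension of the common orthogonal complement and `s` that of the relations
  -- among the rows of `b ++ b′`. The relations embed into the intersection of the spans, so
  -- `s + δ ≤ κ`. Equality of row and column rank gives `s + v ≡ D + 2κ`, whence `D + δ ≤ κ′`.
  orthogonal-separated : ∀ {κ κ′ δ} (b b′ : Family κ v) → Independent b → Independent b′ → κ ℕ.+ κ′ ≡ v →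
                         Separated κ δ (span b) (span b′) → Separated κ′ δ (orthogonal b) (orthogonal b′)
  orthogonal-separated {v} {κ} {κ′} {δ} b b′ ind ind′ κ+κ′≡v sep {t} f f-ind f∈ f∈′
    with kernelDim (b ++ b′) | kernelDim (transpose (b ++ b′))
  ... | s , hs@(h , h-ind , _ , h⊆) | D , hD = ℕ.≤-trans (ℕ.+-monoˡ-≤ δ t≤D)
    (ℕ.+-cancelʳ-≤ (κ ℕ.+ κ) (D ℕ.+ δ) κ′ (≡.subst₂ _≤_ left right (ℕ.+-monoˡ-≤ (κ ℕ.+ κ′) s+δ≤κ)))
    where
    open import Data.Nat.Solver using (module +-*-Solver)
    open +-*-Solver using (solve; _:=_; _:+_)
    rank-eq : s ℕ.+ v ≡ D ℕ.+ (κ ℕ.+ κ)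
    rank-eq = kernel-transpose (b ++ b′) hs hD
    left : s ℕ.+ δ ℕ.+ (κ ℕ.+ κ′) ≡ D ℕ.+ δ ℕ.+ (κ ℕ.+ κ)
    left = ≡.trans (≡.cong (s ℕ.+ δ ℕ.+_) κ+κ′≡v)
      (≡.trans (solve 3 (λ s d v → s :+ d :+ v := s :+ v :+ d) ≡.refl s δ v)
      (≡.trans (≡.cong (ℕ._+ δ) rank-eq) (solve 3 (λ D d k → D :+ (k :+ k) :+ d := D :+ d :+ (k :+ k)) ≡.refl D δ κ)))
    right : κ ℕ.+ (κ ℕ.+ κ′) ≡ κ′ ℕ.+ (κ ℕ.+ κ)
    right = solve 2 (λ k k′ → k :+ (k :+ k′) := k′ :+ (k :+ k)) ≡.refl κ κ′
    t≤D : t ≤ D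
    t≤D = independent⇒≤dim (kernel (transpose (b ++ b′))) hD f f-ind λ i → lift λ j → orth i (splitAt κ j)
      where
      orth : ∀ i u → ∑[ l < v ] (f i l * [ b , b′ ]′ u l) ≈ 0#
      orth i (inj₁ u) = lower (f∈ i) u
      orth i (inj₂ u) = lower (f∈′ i) u
    hₗ hᵣ : Family s κ
    hₗ i j = h i (j ↑ˡ κ)
    hᵣ i j = h i (κ ↑ʳ j)
    opposite : ∀ i → (λ j → combination (hₗ i) b j + combination (hᵣ i) b′ j) ≋ 0ᵛ
    opposite i j = trans (sym (combination-++ (h i) b b′ j)) (lower (h⊆ (member-basis h i)) j)
    -- Each relation splits into a vector `y i` of the first span and its negative `y′ i` in the
    -- second, so `y i` lies in both.
    y : Family s v
    y i = combination (hₗ i) b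
    y′ : Family s v
    y′ i = combination (hᵣ i) b′
    y-ind : Independent y
    y-ind a e = h-ind a (++-≋ κ
      (ind (combination a hₗ) (λ j → trans (sym (combination-assoc a hₗ b j)) (e j)))
      (ind′ (combination a hᵣ) (λ j → begin
        combination (combination a hᵣ) b′ j     ≈⟨ combination-assoc a hᵣ b′ j ⟨
        combination a y′ j                      ≈⟨ +-identityˡ _ ⟨
        0# + combination a y′ j                 ≈⟨ +-congʳ (e j) ⟨
        combination a y j + combination a y′ j  ≈⟨ ∑-distrib-+ {s} (λ i → a i * y i j) (λ i → a i * y′ i j) ⟨
        ∑[ i < s ] (a i * y i j + a i * y′ i j) ≈⟨ sum-cong-≋ {s} (λ i → sym (distribˡ (a i) _ _)) ⟩
        combination a (λ i j → y i j + y′ i j) j ≈⟨ combination-0ʳ a _ opposite j ⟩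
        0#                                      ∎)))
    s+δ≤κ : s ℕ.+ δ ≤ κ
    s+δ≤κ = sep y y-ind (λ i → hₗ i , λ _ → refl)
      (λ i → Span-resp {b = b′} (λ j → trans (-1*x≈-x _) (sym (inverseˡ-unique _ _ (opposite i j))))
        (*-closed (span b′) (- 1#) (hᵣ i , λ _ → refl)))

  dualCode : ∀ {δ κ κ′ n} → 1 ≤ δ → κ ℕ.+ κ′ ≡ v → Code v (δ ℕ.* 2) κ n → Code v (δ ℕ.* 2) κ′ n
  dualCode {v} {δ} {κ} {κ′} 1≤δ κ+κ′≡v C = separated-code 1≤δ (orthogonal ∘ b)
    (λ i → orthogonal-dim (b i) (ind i) κ+κ′≡v)
    (λ {i} {j} i≢j → orthogonal-separated (b i) (b j) (ind i) (ind j) κ+κ′≡v λ f f-ind f∈ f∈′ →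
      codewords-separated C i≢j f f-ind (λ l → proj₂ (proj₂ (proj₂ (dimension i))) (f∈ l))
        (λ l → proj₂ (proj₂ (proj₂ (dimension j))) (f∈′ l)))
    where
    open Code C
    b : ∀ i → Family κ v
    b i = proj₁ (dimension i)
    ind : ∀ i → Independent (b i)
    ind i = proj₁ (proj₂ (dimension i))

  A-dual : ∀ {δ κ κ′} → 1 ≤ δ → κ ℕ.+ κ′ ≡ v → A v (δ ℕ.* 2) κ ≡ A v (δ ℕ.* 2) κ′
  A-dual {v} {δ} {κ} {κ′} 1≤δ e = ℕ.≤-antisym
    (proj₂ (A-isMaximum v (δ ℕ.* 2) κ′) _ (dualCode 1≤δ e (proj₁ (A-isMaximum v (δ ℕ.* 2) κ))))
    (proj₂ (A-isMaximum v (δ ℕ.* 2) κ) _ (dualCode 1≤δ (≡.trans (ℕ.+-comm κ′ κ) e) (proj₁ (A-isMaximum v (δ ℕ.* 2) κ′))))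

finToFun-injective : ∀ {m n} {i j : Fin (n ℕ.^ m)} → (∀ k → finToFun {n} {m} i k ≡ finToFun j k) → i ≡ j
finToFun-injective {m} {n} {i} {j} e = ≡.trans (≡.sym (funToFin-finToFin {m} {n} i))
  (≡.trans (funToFin-cong e) (funToFin-finToFin {m} {n} j))
  where
  funToFin-cong : ∀ {m n} {f g : Fin m → Fin n} → (∀ k → f k ≡ g k) → funToFin f ≡ funToFin g
  funToFin-cong {zero}  e = ≡.refl
  funToFin-cong {suc m} e = ≡.cong₂ combine (e zero) (funToFin-cong (e ∘ suc))

-- Lifted Gabidulin codes.

module LiftedGabidulin {c ℓ₁ ℓ₂ q} {F : FiniteField c ℓ₁ ℓ₂ q} {m} (E : Extension F m) where
  open ConstantDimensionCodes F
  open Finiteness hiding (_≟_)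
  open LinearAlgebra F
  open Extension E
  open ExtensionProperties E
  open import Data.Vec.Functional.Relation.Binary.Equality.Setoid 𝔽.setoid using (_≋_)
  open import Algebra.Solver.Ring.NaturalCoefficients.Default commutativeSemiring
  open import Algebra.Properties.Group +-group using (x∙y⁻¹≈ε⇒x≈y; ∙-cancelʳ)
  open import Relation.Binary.Reasoning.Setoid setoid

  linear-congʳ : ∀ {k} (r : Vector 𝔽 k) {x y : Vector 𝕂 k} → (∀ i → x i ≈ y i) → linear r x ≈ linear r y
  linear-congʳ {zero}  r e = refl
  linear-congʳ {suc k} r e = +-cong (*-congˡ (e zero)) (linear-congʳ (r ∘ suc) (e ∘ suc))

  linear-combination : ∀ {k l} (d : Vector 𝔽 k) (r : Family k l) (x : Vector 𝕂 l) →
                       linear d (λ i → linear (r i) x) ≈ linear (combination d r) x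
  linear-combination {zero}  d r x = sym (linear-0 (λ _ → 𝔽.0#) x (λ _ → ι-0))
  linear-combination {suc k} d r x = begin
    ι (d zero) * linear (r zero) x + linear (d ∘ suc) (λ i → linear (r (suc i)) x)
      ≈⟨ +-cong (sym (linear-* (d zero) (r zero) x)) (linear-combination (d ∘ suc) (r ∘ suc) x) ⟩
    linear (λ j → d zero 𝔽.* r zero j) x + linear (combination (d ∘ suc) (r ∘ suc)) x
      ≈⟨ linear-+ (λ j → d zero 𝔽.* r zero j) (combination (d ∘ suc) (r ∘ suc)) x ⟨
    linear (combination d r) x ∎

  linearised-+ : ∀ {n} (a : Vector 𝕂 n) x y → linearised a (x + y) ≈ linearised a x + linearised a y
  linearised-+ {zero}  a x y = sym (+-identityˡ 0#)
  linearised-+ {suc n} a x y = begin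
    a zero * (x + y) + linearised (a ∘ suc) (σ (x + y))
      ≈⟨ +-congˡ (trans (linearised-cong (a ∘ suc) (σ-+ x y)) (linearised-+ (a ∘ suc) (σ x) (σ y))) ⟩
    a zero * (x + y) + (linearised (a ∘ suc) (σ x) + linearised (a ∘ suc) (σ y))
      ≈⟨ solve 5 (λ a x y u v → a :* (x :+ y) :+ (u :+ v) := (a :* x :+ u) :+ (a :* y :+ v)) refl (a zero) x y _ _ ⟩
    linearised a x + linearised a y ∎

  linearised-* : ∀ {n} (a : Vector 𝕂 n) r x → linearised a (ι r * x) ≈ ι r * linearised a x
  linearised-* {zero}  a r x = sym (zeroʳ (ι r))
  linearised-* {suc n} a r x = begin
    a zero * (ι r * x) + linearised (a ∘ suc) (σ (ι r * x))
      ≈⟨ +-congˡ (trans (linearised-cong (a ∘ suc) (trans (σ-* (ι r) x) (*-congʳ (σ-ι r)))) (linearised-* (a ∘ suc) r (σ x))) ⟩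
    a zero * (ι r * x) + ι r * linearised (a ∘ suc) (σ x)
      ≈⟨ solve 4 (λ a r x u → a :* (r :* x) :+ r :* u := r :* (a :* x :+ u)) refl (a zero) (ι r) x _ ⟩
    ι r * linearised a x ∎

  linearised-0 : ∀ {n} (a : Vector 𝕂 n) → linearised a 0# ≈ 0#
  linearised-0 a = begin
    linearised a 0#              ≈⟨ linearised-cong a (sym (trans (*-congʳ ι-0) (zeroˡ 0#))) ⟩
    linearised a (ι 𝔽.0# * 0#)   ≈⟨ linearised-* a 𝔽.0# 0# ⟩
    ι 𝔽.0# * linearised a 0#     ≈⟨ trans (*-congʳ ι-0) (zeroˡ _) ⟩
    0#                           ∎

  linearised-linear : ∀ {n k} (a : Vector 𝕂 n) (r : Vector 𝔽 k) x → linearised a (linear r x) ≈ linear r (linearised a ∘ x)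
  linearised-linear {k = zero}  a r x = linearised-0 a
  linearised-linear {k = suc k} a r x = trans (linearised-+ a _ _)
    (+-cong (linearised-* a (r zero) (x zero)) (linearised-linear a (r ∘ suc) (x ∘ suc)))

  linearised-difference : ∀ {n} (a b : Vector 𝕂 n) x →
                          linearised (λ i → a i - b i) x + linearised b x ≈ linearised a x
  linearised-difference {zero}  a b x = +-identityˡ 0#
  linearised-difference {suc n} a b x = begin
    (a zero - b zero) * x + L₁ + (b zero * x + L₂)
      ≈⟨ solve 6 (λ a b′ b x u v → (a :+ b′) :* x :+ u :+ (b :* x :+ v) := (a :+ (b′ :+ b)) :* x :+ (u :+ v)) refl (a zero) (- b zero) (b zero) x L₁ L₂ ⟩
    (a zero + (- b zero + b zero)) * x + (L₁ + L₂)
      ≈⟨ +-cong (*-congʳ (trans (+-congˡ (-‿inverseˡ _)) (+-identityʳ _))) (linearised-difference (a ∘ suc) (b ∘ suc) (σ x)) ⟩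
    linearised a x ∎
    where
    L₁ = linearised (λ i → a (suc i) - b (suc i)) (σ x)
    L₂ = linearised (b ∘ suc) (σ x)

  coordinates-unique : ∀ (r s : Vector 𝔽 (suc m)) → linear r basis ≈ linear s basis → r ≋ s
  coordinates-unique r s e i = x∙y⁻¹≈ε⇒x≈y′ (ι-≈0 _ (basis-independent (λ i → r i 𝔽.+ 𝔽.- 𝔽.1# 𝔽.* s i) (begin
      linear (λ i → r i 𝔽.+ 𝔽.- 𝔽.1# 𝔽.* s i) basis           ≈⟨ linear-+ r (λ i → 𝔽.- 𝔽.1# 𝔽.* s i) basis ⟩
      linear r basis + linear (λ i → 𝔽.- 𝔽.1# 𝔽.* s i) basis   ≈⟨ +-cong e (linear-* (𝔽.- 𝔽.1#) s basis) ⟩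
      linear s basis + ι (𝔽.- 𝔽.1#) * linear s basis
        ≈⟨ solve 2 (λ L u → L :+ u :* L := (u :+ con 1) :* L) refl (linear s basis) (ι (𝔽.- 𝔽.1#)) ⟩
      (ι (𝔽.- 𝔽.1#) + 1#) * linear s basis
        ≈⟨ *-congʳ (trans (+-congˡ (sym ι-1)) (ι-neg 𝔽.1#)) ⟩
      0# * linear s basis                                      ≈⟨ zeroˡ _ ⟩
      0#                                                       ∎) i))
    where
    open import Algebra.Properties.Group 𝔽.+-group using () renaming (x∙y⁻¹≈ε⇒x≈y to cancel)
    open import Algebra.Properties.Ring 𝔽.ring using (-1*x≈-x)
    x∙y⁻¹≈ε⇒x≈y′ : r i 𝔽.+ 𝔽.- 𝔽.1# 𝔽.* s i 𝔽.≈ 𝔽.0# → r i 𝔽.≈ s i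
    x∙y⁻¹≈ε⇒x≈y′ p = cancel (r i) (s i) (𝔽.trans (𝔽.+-congˡ (𝔽.sym (-1*x≈-x (s i)))) p)

  subfamily : ∀ {s v} t → t ≤ s → (b : Family s v) → Independent b →
              ∃ λ (b′ : Family t v) → Independent b′ × (∀ i → ∃ λ j → b′ i ≡ b j)
  subfamily {zero}  zero _ b ind = b , ind , λ i → i , ≡.refl
  subfamily {suc s} t t≤s b ind with t ℕ.≟ suc s
  ... | yes ≡.refl = b , ind , λ i → i , ≡.refl
  ... | no t≢s with subfamily t (ℕ.s≤s⁻¹ (ℕ.≤∧≢⇒< t≤s t≢s)) (b ∘ suc) (λ a e i → ind (𝔽.0# ∷ a)
                      (λ j → 𝔽.trans (𝔽.+-congʳ (𝔽.zeroˡ _)) (𝔽.trans (𝔽.+-identityˡ _) (e j))) (suc i))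
  ...   | b′ , ind′ , sub = b′ , ind′ , λ i → suc (proj₁ (sub i)) , proj₂ (sub i)

  combination-zip-++ˡ : ∀ {n k l} (a : Vector 𝔽 n) (x : Family n k) (y : Family n l) i →
                        combination a (λ j → x j ++ y j) (i ↑ˡ l) 𝔽.≈ combination a x i
  combination-zip-++ˡ {zero}  a x y i = 𝔽.refl
  combination-zip-++ˡ {suc n} a x y i = 𝔽.+-cong (𝔽.*-congˡ (𝔽.reflexive (lookup-++ˡ (x zero) (y zero) i)))
    (combination-zip-++ˡ (a ∘ suc) (x ∘ suc) (y ∘ suc) i)

  combination-zip-++ʳ : ∀ {n k l} (a : Vector 𝔽 n) (x : Family n k) (y : Family n l) i →
                        combination a (λ j → x j ++ y j) (k ↑ʳ i) 𝔽.≈ combination a y i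
  combination-zip-++ʳ {zero}  a x y i = 𝔽.refl
  combination-zip-++ʳ {suc n} a x y i = 𝔽.+-cong (𝔽.*-congˡ (𝔽.reflexive (lookup-++ʳ (x zero) (y zero) i)))
    (combination-zip-++ʳ (a ∘ suc) (x ∘ suc) (y ∘ suc) i)

  module _ {k t δ : ℕ} (k≤m : k ≤ suc m) (t+δ≡k : t ℕ.+ δ ≡ k) (1≤δ : 1 ≤ δ) where

    private
      -- A message: `t + 1` elements of the extension in coordinates, serving as coefficients of a
      -- linearised polynomial. Unless zero, such a polynomial cannot vanish on `t + 1` independent
      -- elements.
      Index : Set
      Index = Fin ((q ℕ.^ suc m) ℕ.^ suc t)

      coefficients : Index → Vector 𝕂 (suc t)
      coefficients u i = linear (decodeᵇ u i) basis

      coefficients-injective : ∀ {u w} → (∀ i → coefficients u i ≈ coefficients w i) → u ≡ w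
      coefficients-injective {u} {w} e = finToFun-injective {suc t} λ i →
        decode-injective {suc m} (coordinates-unique _ _ (e i))

      value : Index → Fin k → 𝕂
      value u i = linearised (coefficients u) (powers k i)

      right : Index → Family k (suc m)
      right u i = proj₁ (basis-spans (value u i))

      -- A basis of the graph of f ↦ linearised (coefficients u) f in coordinates.
      graph : Index → Family k (k ℕ.+ suc m)
      graph u i = unit i ++ right u i

      graphˡ : ∀ u a i → combination a (graph u) (i ↑ˡ suc m) 𝔽.≈ a i
      graphˡ u a i = 𝔽.trans (combination-zip-++ˡ a unit (right u) i) (combination-unit a i)

      graphʳ : ∀ u a → linear (λ i → combination a (graph u) (k ↑ʳ i)) basis ≈
                       linearised (coefficients u) (linear a (powers k))
      graphʳ u a = begin
        linear (λ i → combination a (graph u) (k ↑ʳ i)) basis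
          ≈⟨ linear-cong basis (combination-zip-++ʳ a unit (right u)) ⟩
        linear (combination a (right u)) basis                   ≈⟨ linear-combination a (right u) basis ⟨
        linear a (λ i → linear (right u i) basis)
          ≈⟨ linear-congʳ a (λ i → proj₂ (basis-spans (value u i))) ⟩
        linear a (value u)
          ≈⟨ linearised-linear (coefficients u) a (powers k) ⟨
        linearised (coefficients u) (linear a (powers k))        ∎

      graph-independent : ∀ u → Independent (graph u)
      graph-independent u a e i = 𝔽.trans (𝔽.sym (graphˡ u a i)) (e (i ↑ˡ suc m))

      -- A common vector of two graphs has the same first `k` coordinates in both, hence yields a
      -- field element on which the two linearised polynomials agree. Their difference then vanishes
      -- on `t + 1` independent elements, and `kernel-bound` makes it zero.
      agree : ∀ {u w} (b : Family (suc t) (k ℕ.+ suc m)) → Independent b →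
              (∀ i → Span (graph u) (b i)) → (∀ i → Span (graph w) (b i)) → u ≡ w
      agree {u} {w} b ind b∈u b∈w = coefficients-injective λ i →
        x∙y⁻¹≈ε⇒x≈y _ _ (kernel-bound y y-ind (λ i → coefficients u i - coefficients w i) root i)
        where
        r r′ : Family (suc t) k
        r i = proj₁ (b∈u i)
        r′ i = proj₁ (b∈w i)
        r≋r′ : ∀ i → r i ≋ r′ i
        r≋r′ i j = 𝔽.trans (𝔽.sym (graphˡ u (r i) j)) (𝔽.trans (proj₂ (b∈u i) (j ↑ˡ suc m))
          (𝔽.trans (𝔽.sym (proj₂ (b∈w i) (j ↑ˡ suc m))) (graphˡ w (r′ i) j)))
        y : Vector 𝕂 (suc t)
        y i = linear (r i) (powers k)
        root : ∀ i → linearised (λ i → coefficients u i - coefficients w i) (y i) ≈ 0#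
        root i = ∙-cancelʳ (linearised (coefficients w) (y i)) _ _ (begin
          linearised (λ i → coefficients u i - coefficients w i) (y i) + linearised (coefficients w) (y i)
            ≈⟨ linearised-difference (coefficients u) (coefficients w) (y i) ⟩
          linearised (coefficients u) (y i)                              ≈⟨ graphʳ u (r i) ⟨
          linear (λ j → combination (r i) (graph u) (k ↑ʳ j)) basis
            ≈⟨ linear-cong basis (λ j → 𝔽.trans (proj₂ (b∈u i) (k ↑ʳ j)) (𝔽.sym (proj₂ (b∈w i) (k ↑ʳ j)))) ⟩
          linear (λ j → combination (r′ i) (graph w) (k ↑ʳ j)) basis     ≈⟨ graphʳ w (r′ i) ⟩
          linearised (coefficients w) (linear (r′ i) (powers k))
            ≈⟨ linearised-cong (coefficients w) (linear-cong (powers k) (λ j → 𝔽.sym (r≋r′ i j))) ⟩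
          linearised (coefficients w) (y i)                              ≈⟨ +-identityˡ _ ⟨
          0# + linearised (coefficients w) (y i)                         ∎)
        y-ind : LinearlyIndependent y
        -- A graph vector is determined by its first `k` coordinates, so independence passes from
        -- `b` to `r`; `k ≤ suc m` keeps the powers of `X` independent and carries it on to `y`.
        y-ind d e i = trans (ι-cong (ind d (λ j → 𝔽.trans (combination-congʳ d (λ i j → 𝔽.sym (proj₂ (b∈u i) j)) j)
          (𝔽.trans (combination-assoc d r (graph u) j) (𝔽.trans (combination-congˡ (graph u) dr≋0 j) (combination-0 (graph u) j)))) i)) ι-0
          where
          dr≋0 : combination d r ≋ 0ᵛ
          dr≋0 j = ι-≈0 _ (powers-independent k≤m (combination d r) (trans (sym (linear-combination d r (powers k))) e) j)

    liftedCode : Code (k ℕ.+ suc m) (δ ℕ.* 2) k ((q ℕ.^ suc m) ℕ.^ suc t)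
    liftedCode = separated-code 1≤δ (span ∘ graph)
      (λ u → graph u , graph-independent u , (λ x → x) , (λ x → x)) separated
      where
      separated : ∀ {u w} → u ≢ w → Separated k δ (span (graph u)) (span (graph w))
      separated {u} {w} u≢w {s} b ind b∈u b∈w with s ℕ.≤? t
      ... | yes s≤t = ≡.subst (s ℕ.+ δ ≤_) t+δ≡k (ℕ.+-monoˡ-≤ δ s≤t)
      ... | no s≰t with subfamily (suc t) (ℕ.≰⇒> s≰t) b ind
      ...   | b′ , ind′ , sub = contradiction (agree b′ ind′
                (λ i → ≡.subst (Span (graph u)) (≡.sym (proj₂ (sub i))) (b∈u (proj₁ (sub i))))
                (λ i → ≡.subst (Span (graph w)) (≡.sym (proj₂ (sub i))) (b∈w (proj₁ (sub i))))) u≢w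

-- Double counting and the anticode bound.

module Counting where

  open import Data.Nat.Base using (ℕ; zero; suc; _+_; _*_; _^_; _∸_; _≤_; z≤n; s≤s)
  open import Relation.Binary.PropositionalEquality using (refl; sym; trans; cong)
  open import Algebra.Properties.CommutativeMonoid.Sum ℕ.+-0-commutativeMonoid
  open import Algebra.Properties.Semiring.Sum ℕ.+-*-semiring using (*-distribʳ-sum; *-distribˡ-sum)
  open Arithmetic using (extensions)

  indicator : ∀ {p} {P : Set p} → Dec P → ℕ
  indicator (yes _) = 1
  indicator (no _)  = 0

  indicator-yes : ∀ {p} {P : Set p} (P? : Dec P) → P → indicator P? ≡ 1
  indicator-yes (yes _) _ = refl
  indicator-yes (no ¬p) p = contradiction p ¬p

  indicator-no : ∀ {p} {P : Set p} (P? : Dec P) → ¬ P → indicator P? ≡ 0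
  indicator-no (yes p) ¬p = contradiction p ¬p
  indicator-no (no _)  _  = refl

  indicator-split : ∀ {p q r} {P : Set p} {Q : Set q} {R : Set r} (P? : Dec P) (Q? : Dec Q) (R? : Dec R) →
                    (P → R) → indicator P? ≤ indicator Q? + indicator (¬? Q?) * indicator R?
  indicator-split (no _)  _       _  _   = z≤n
  indicator-split (yes _) (yes _) _  _   = s≤s z≤n
  indicator-split (yes p) (no _)  R? P→R = ℕ.≤-reflexive (sym (trans (ℕ.+-identityʳ _) (indicator-yes R? (P→R p))))

  ∑-mono : ∀ {n} {f g : Vector ℕ n} → (∀ i → f i ≤ g i) → sum f ≤ sum g
  ∑-mono {zero}  f≤g = z≤n
  ∑-mono {suc n} f≤g = ℕ.+-mono-≤ (f≤g zero) (∑-mono (f≤g ∘ suc))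

  ∑-const : ∀ n x → ∑[ i < n ] x ≡ n * x
  ∑-const zero    x = refl
  ∑-const (suc n) x = cong (x +_) (∑-const n x)

  ∑-none : ∀ {p n} {P : Pred (Fin n) p} (P? : Decidable P) → (∀ i → ¬ P i) → ∑[ i < n ] indicator (P? i) ≡ 0
  ∑-none {n = n} P? none = trans (sum-cong-≗ {n} λ i → indicator-no (P? i) (none i)) (sum-replicate-zero n)

  ∑-at-most-one : ∀ {p n} {P : Pred (Fin n) p} (P? : Decidable P) → (∀ {i j} → P i → P j → i ≡ j) →
                  ∑[ i < n ] indicator (P? i) ≤ 1
  ∑-at-most-one {n = zero}  P? unique = z≤n
  ∑-at-most-one {n = suc n} P? unique with P? zero
  ... | no _   = ∑-at-most-one (P? ∘ suc) (λ p p′ → suc-injective (unique p p′))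
  ... | yes p₀ = ℕ.≤-reflexive (cong suc (∑-none (P? ∘ suc) λ i p → contradiction (unique p₀ p) λ ()))

  ∑-unique : ∀ {p n} {P : Pred (Fin n) p} (P? : Decidable P) → (∀ {i j} → P i → P j → i ≡ j) → ∀ i → P i →
             ∑[ i < n ] indicator (P? i) ≡ 1
  ∑-unique {n = n@(suc _)} P? unique i p = ℕ.≤-antisym (∑-at-most-one P? unique) (begin
    1                                    ≡⟨ indicator-yes (P? i) p ⟨
    indicator (P? i)                     ≤⟨ ℕ.m≤m+n _ _ ⟩
    indicator (P? i) + sum (removeAt (indicator ∘ P?) i)
      ≡⟨ sum-remove {i = i} (λ i → indicator (P? i)) ⟨
    ∑[ i < n ] indicator (P? i)          ∎)
    where open ℕ.≤-Reasoning

  -- Both sides count the pairs of `a` and `i` with `f a ≡ i`.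
  ∑-image : ∀ {p m n} (f : Fin m → Fin n) → Injective _≡_ _≡_ f → {P : Pred (Fin n) p} (P? : Decidable P) →
            (∀ {i} → P i → ∃ λ a → f a ≡ i) → (∀ a → P (f a)) → ∑[ i < n ] indicator (P? i) ≡ m
  ∑-image {m = m} {n} f inj {P} P? onto into = begin
    ∑[ i < n ] indicator (P? i)                        ≡⟨ sum-cong-≗ {n} fibre ⟩
    ∑[ i < n ] (∑[ a < m ] indicator (f a ≟ᶠ i))       ≡⟨ ∑-comm (λ i a → indicator (f a ≟ᶠ i)) ⟩
    ∑[ a < m ] (∑[ i < n ] indicator (f a ≟ᶠ i))
      ≡⟨ sum-cong-≗ {m} (λ a → ∑-unique (f a ≟ᶠ_) (λ { refl refl → refl }) (f a) refl) ⟩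
    ∑[ a < m ] 1                                       ≡⟨ ∑-const m 1 ⟩
    m * 1                                              ≡⟨ ℕ.*-identityʳ m ⟩
    m                                                  ∎
    where
    open ≡.≡-Reasoning
    fibre : ∀ i → indicator (P? i) ≡ ∑[ a < m ] indicator (f a ≟ᶠ i)
    fibre i with P? i
    ... | no ¬p = sym (∑-none (λ a → f a ≟ᶠ i) λ { a refl → ¬p (into a) })
    ... | yes p = sym (∑-unique (λ a → f a ≟ᶠ i) (λ e e′ → inj (trans e (sym e′))) (proj₁ (onto p)) (proj₂ (onto p)))

  module AnticodeBound {c ℓ₁ ℓ₂ q} (F : FiniteField c ℓ₁ ℓ₂ q) where
    open ConstantDimensionCodes F
    open Finiteness
    open LinearAlgebra F

    count-subspace : ∀ {v m} (U : Subspace v) → HasDim U m → (U? : Decidable (member U)) →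
                     ∑[ i < q ^ v ] indicator (U? (decode {v} i)) ≡ q ^ m
    count-subspace {v} {m} U (b , ind , U⊆ , ⊆U) U? = ∑-image f f-injective (U? ∘ decode {v})
      (λ {i} p → encode (proj₁ (U⊆ p)) , decode-injective {v} (λ j →
        F.trans (decode-encode (combination (decode (encode (proj₁ (U⊆ p)))) b) j)
        (F.trans (combination-congˡ b (decode-encode (proj₁ (U⊆ p))) j) (proj₂ (U⊆ p) j))))
      (λ a → ⊆U (decode {m} a , λ j → F.sym (decode-encode (combination (decode a) b) j)))
      where
      module F = CommutativeRing (FiniteField.commutativeRing F)
      f : Fin (q ^ m) → Fin (q ^ v)
      f a = encode (combination (decode {m} a) b)
      f-injective : Injective _≡_ _≡_ f
      f-injective {i} {j} e = decode-injective {m} (combination-injective b ind (encode-injective e))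

    module _ {n κ δ t M} (C : Code n (δ * 2) κ M) (t+δ≡1+κ : t + δ ≡ suc κ) where
      open Code C

      private
        U? : ∀ i → Decidable (member (codeword i))
        U? i = member? (codeword i) (dimension i)

        contains? : ∀ {s} (b : Family s n) i → Dec (∀ j → member (codeword i) (b j))
        contains? b i = all? (U? i ∘ b)

        containing : ∀ {s} → Family s n → ℕ
        containing b = ∑[ i < M ] indicator (contains? b i)

        new? : ∀ {s} (b : Family s n) x → Dec (¬ Span b x)
        new? b x = ¬? (span? b x)

        -- The `q^κ` vectors of a codeword containing `b` split into the `q^s` vectors of the span
        -- of `b` and those that extend `b` inside the codeword.
        extending : ∀ {s} (b : Family s n) → Independent b → ∀ i →
                    indicator (contains? b i) * (q ^ κ ∸ q ^ s) ≤
                    ∑[ x < q ^ n ] (indicator (new? b (decode x)) * indicator (contains? (decode x ∷ b) i))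
        extending {s} b ind i with contains? b i
        ... | no _   = z≤n
        ... | yes b∈ = begin
          q ^ κ ∸ q ^ s + 0                       ≡⟨ ℕ.+-identityʳ _ ⟩
          q ^ κ ∸ q ^ s                           ≤⟨ ℕ.∸-monoˡ-≤ (q ^ s) (begin
            q ^ κ                                   ≡⟨ count-subspace (codeword i) (dimension i) (U? i) ⟨
            ∑[ x < q ^ n ] indicator (U? i (decode x)) ≤⟨ ∑-mono split ⟩
            ∑[ x < q ^ n ] (indicator (span? b (decode x)) + e x)
              ≡⟨ ∑-distrib-+ {q ^ n} (λ x → indicator (span? b (decode x))) e ⟩
            ∑[ x < q ^ n ] indicator (span? b (decode x)) + ∑[ x < q ^ n ] e x
              ≡⟨ cong (_+ sum e) (count-subspace (span b) (b , ind , (λ p → p) , λ p → p) (span? b)) ⟩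
            q ^ s + ∑[ x < q ^ n ] e x              ∎) ⟩
          q ^ s + ∑[ x < q ^ n ] e x ∸ q ^ s      ≡⟨ ℕ.m+n∸m≡n (q ^ s) _ ⟩
          ∑[ x < q ^ n ] e x                      ∎
          where
          open ℕ.≤-Reasoning
          e : Fin (q ^ n) → ℕ
          e x = indicator (new? b (decode x)) * indicator (contains? (decode x ∷ b) i)
          split : ∀ x → indicator (U? i (decode {n} x)) ≤ indicator (span? b (decode x)) + e x
          split x = indicator-split (U? i (decode x)) (span? b (decode x)) (contains? (decode x ∷ b) i)
            (λ x∈ → λ { zero → x∈ ; (suc j) → b∈ j })

        -- Counts pairs of a codeword containing `b` and a vector extending `b` inside it: each
        -- codeword has at least `q^κ - q^s` such vectors, and for each of the at most `q^n` vectors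
        -- the extended family falls under the induction hypothesis. At `r = 0` the `t` vectors lie
        -- in at most one codeword, as `t + δ` exceeds `κ`.
        bound : ∀ r s (b : Family s n) → Independent b → s + r ≡ t → containing b * extensions q κ s r ≤ (q ^ n) ^ r
        bound zero s b ind s≡t = ≡.subst (_≤ 1) (sym (ℕ.*-identityʳ _)) (∑-at-most-one (contains? b) unique)
          where
          unique : ∀ {i j} → _ → _ → i ≡ j
          unique {i} {j} b∈i b∈j with i ≟ᶠ j
          ... | yes i≡j = i≡j
          ... | no i≢j  = contradiction (codewords-separated C i≢j b ind b∈i b∈j)
            (ℕ.<⇒≱ (ℕ.≤-reflexive (sym (trans (cong (_+ δ) (trans (sym (ℕ.+-identityʳ s)) s≡t)) t+δ≡1+κ))))
        bound (suc r) s b ind s+r≡t = begin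
          containing b * (w * G)                               ≡⟨ ℕ.*-assoc (containing b) w G ⟨
          containing b * w * G
            ≡⟨ cong (_* G) (*-distribʳ-sum {M} w (indicator ∘ contains? b)) ⟩
          ∑[ i < M ] (indicator (contains? b i) * w) * G       ≤⟨ ℕ.*-monoˡ-≤ G (∑-mono (extending b ind)) ⟩
          ∑[ i < M ] (∑[ x < q ^ n ] (new x * indicator (contains? (decode x ∷ b) i))) * G
            ≡⟨ cong (_* G) (∑-comm {M} {q ^ n} (λ i x → new x * indicator (contains? (decode x ∷ b) i))) ⟩
          ∑[ x < q ^ n ] (∑[ i < M ] (new x * indicator (contains? (decode x ∷ b) i))) * G
            ≡⟨ cong (_* G) (sum-cong-≗ {q ^ n} (λ x → *-distribˡ-sum {M} (new x) (indicator ∘ contains? (decode x ∷ b)))) ⟨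
          ∑[ x < q ^ n ] (new x * containing (decode x ∷ b)) * G
            ≡⟨ *-distribʳ-sum {q ^ n} G (λ x → new x * containing (decode x ∷ b)) ⟩
          ∑[ x < q ^ n ] (new x * containing (decode x ∷ b) * G)   ≤⟨ ∑-mono each ⟩
          ∑[ x < q ^ n ] ((q ^ n) ^ r)                         ≡⟨ ∑-const (q ^ n) ((q ^ n) ^ r) ⟩
          (q ^ n) ^ suc r                                      ∎
          where
          open ℕ.≤-Reasoning
          w = q ^ κ ∸ q ^ s
          G = extensions q κ (suc s) r
          new : Fin (q ^ n) → ℕ
          new x = indicator (new? b (decode x))
          each : ∀ x → new x * containing (decode x ∷ b) * G ≤ (q ^ n) ^ r
          each x with span? b (decode x)
          ... | yes _ = z≤n
          ... | no x∉ = ≡.subst (λ N → N * G ≤ (q ^ n) ^ r) (sym (ℕ.+-identityʳ (containing (decode x ∷ b))))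
            (bound r (suc s) (decode x ∷ b) (∷-independent {b = b} ind x∉) (trans (sym (ℕ.+-suc s r)) s+r≡t))

      -- Every t-dimensional subspace lies in at most one codeword; count bases of such subspaces.
      anticode-bound : M * extensions q κ 0 t ≤ (q ^ n) ^ t
      anticode-bound = ≡.subst (λ N → N * extensions q κ 0 t ≤ (q ^ n) ^ t)
        (trans (sum-cong-≗ {M} (λ i → indicator-yes (contains? [] i) λ ())) (trans (∑-const M 1) (ℕ.*-identityʳ M)))
        (bound t 0 [] (λ _ _ ()) refl)

open import Data.Integer.Base using (+_) renaming (_≤_ to _≤ᶻ_)
open import Data.Nat.Base using (ℕ; _+_; _∸_; _^_; _≤_; _⊓_) renaming (_*_ to _*ℕ_)
open import Data.Nat.Divisibility using (_∣_)
open import Data.Nat.Properties using (m+n≤o⇒m≤o∸n)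
open import Data.Product using (_×_)
open import Data.Rational.Unnormalised.Base using (_/_; _*_; floor)
open import Function.Bundles using (_⇔_)
open import Relation.Binary.PropositionalEquality using (_≡_)
import Data.Integer.Base as ℤ
import Data.Integer.Properties as ℤ
open import Data.Nat.Base using (_<_; s≤s; z≤n)
open import Data.Nat.Divisibility using (divides)
open import Data.Nat.Solver using (module +-*-Solver)
open import Function.Bundles using (mk⇔)
open import Relation.Binary.PropositionalEquality using (refl; sym; trans; cong; subst; subst₂)
open Arithmetic
open Counting

-- Comparison of the two code sizes and of the rounded bounds.

module _ {c ℓ₁ ℓ₂ q} (F : FiniteField c ℓ₁ ℓ₂ q) where
  open ConstantDimensionCodes F
  open AnticodeBound F using (anticode-bound)

  extension : ∀ m → Extension F m
  extension m = Construction.extension F m (q ^ suc m ∸ 2)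
    (sym (trans (ℕ.+-comm 2 (q ^ suc m ∸ 2)) (ℕ.m∸n+n≡m 2≤q^m)))
    where
    2≤q^m : 2 ≤ q ^ suc m
    2≤q^m = ℕ.^-monoʳ-< q Finiteness.1<q {0} {suc m} (s≤s z≤n)

  -- With `k = suc κ`, the extension has degree `suc m = v - 1 - k`. The hypothesis `suc κ ≤ suc m`
  -- is thus `2k < v`, and it leaves room for `k` independent powers of `X`.
  A-comparison : ∀ κ m δ t → suc κ ≤ suc m → t + δ ≡ suc κ → 2 ≤ δ →
                 let a = q ^ suc κ ∸ 1; b = q ^ suc (suc m) ∸ 1; V = q ^ (suc (suc m) + suc κ) ∸ 1; n = suc κ + suc m
                 in V *ℕ A n (δ *ℕ 2) κ *ℕ b + a *ℕ b ≤ V *ℕ A n (δ *ℕ 2) (suc κ) *ℕ a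
  A-comparison κ m δ t κ≤m t+δ≡k 2≤δ = comparison q κ t (suc m) _ _ Finiteness.1<q t<κ
    (subst (λ z → A n (δ *ℕ 2) κ *ℕ extensions q κ 0 t ≤ (q ^ z) ^ t) (sym (ℕ.+-suc κ (suc m)))
      (anticode-bound {n = n} {κ} {δ} {t} (proj₁ (A-isMaximum n (δ *ℕ 2) κ)) t+δ≡k))
    (proj₂ (A-isMaximum n (δ *ℕ 2) (suc κ)) _
      (LiftedGabidulin.liftedCode (extension m) κ≤m t+δ≡k (ℕ.<⇒≤ 2≤δ)))
    where
    n = suc κ + suc m
    -- Here `4 ≤ d` enters: `δ ≥ 2` gives `t + 2 ≤ k`, the relation `q * y ≤ x` of the numerical
    -- estimate.
    t<κ : suc t ≤ κ
    t<κ = ℕ.s≤s⁻¹ (subst₂ _≤_ (ℕ.+-comm t 2) t+δ≡k (ℕ.+-monoʳ-≤ t 2≤δ))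

/-cong : ∀ {x y a b} .{{_ : NonZero a}} .{{_ : NonZero b}} → x ≡ y → a ≡ b → x ℕ./ a ≡ y ℕ./ b
/-cong refl refl = refl

-- Equality under `P` and strictness otherwise give the inequality and the equivalence at once.
dichotomy : ∀ {x y : ℕ} {p} {P : Set p} → (P → x ≡ y) → (¬ P → x < y) → Dec P →
            + x ≤ᶻ + y × (+ x ≡ + y ⇔ P)
dichotomy equal smaller (yes p) = ℤ.≤-reflexive (cong +_ (equal p)) , mk⇔ (λ _ → p) (λ _ → cong +_ (equal p))
dichotomy equal smaller (no ¬p) = ℤ.+≤+ (ℕ.<⇒≤ (smaller ¬p)) ,
  mk⇔ (λ e → contradiction (ℤ.+-injective e) (ℕ.<⇒≢ (smaller ¬p))) (λ p → contradiction p ¬p)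

proposition3 : ∀ {c ℓ₁ ℓ₂} (q : ℕ) (pp : PrimePower q) (F : FiniteField c ℓ₁ ℓ₂ q)
    (v d k : ℕ) (2≤k : 2 ≤ k) (2+k≤v : 2 + k ≤ v) →
    2 ∣ d → 4 ≤ d → d ≤ 2 *ℕ (k ⊓ (v ∸ k)) →
    2 *ℕ k ≤ v →
    let open ConstantDimensionCodes F using (A)
        instance _ = q^m∸1-nonZero pp 2≤k
        instance _ = q^m∸1-nonZero pp (m+n≤o⇒m≤o∸n 2 2+k≤v)
        lhs = floor ((+ (q ^ v ∸ 1) / (q ^ k ∸ 1)) * (+ A (v ∸ 1) d (k ∸ 1) / 1))
        rhs = floor ((+ (q ^ v ∸ 1) / (q ^ (v ∸ k) ∸ 1)) * (+ A (v ∸ 1) d k / 1))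
    in lhs ≤ᶻ rhs × (lhs ≡ rhs ⇔ v ≡ 2 *ℕ k)
proposition3 q pp F v _ k@(suc κ) 2≤k 2+k≤v (divides δ refl) 4≤d d≤ 2k≤v
  rewrite floor-*/ (q ^ v ∸ 1) (ConstantDimensionCodes.A F (v ∸ 1) (δ *ℕ 2) κ) (q ^ k ∸ 1) {{q^m∸1-nonZero pp 2≤k}}
        | floor-*/ (q ^ v ∸ 1) (ConstantDimensionCodes.A F (v ∸ 1) (δ *ℕ 2) k) (q ^ (v ∸ k) ∸ 1)
            {{q^m∸1-nonZero pp (m+n≤o⇒m≤o∸n 2 2+k≤v)}}
  = dichotomy equal smaller (v ℕ.≟ 2 *ℕ k)
  where
  open ConstantDimensionCodes F using (A)
  open LinearAlgebra F using (A-dual)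
  instance
    _ = q^m∸1-nonZero pp 2≤k
    _ = q^m∸1-nonZero pp (m+n≤o⇒m≤o∸n 2 2+k≤v)
  2≤δ : 2 ≤ δ
  2≤δ = ℕ.*-cancelʳ-≤ 2 δ 2 4≤d
  δ≤k : δ ≤ k
  δ≤k = ℕ.*-cancelˡ-≤ 2 (subst (_≤ 2 *ℕ k) (ℕ.*-comm δ 2)
    (ℕ.≤-trans d≤ (ℕ.*-monoʳ-≤ 2 (ℕ.m⊓n≤m k (v ∸ k)))))
  L R : ℕ
  L = (q ^ v ∸ 1) *ℕ A (v ∸ 1) (δ *ℕ 2) κ ℕ./ (q ^ k ∸ 1)
  R = (q ^ v ∸ 1) *ℕ A (v ∸ 1) (δ *ℕ 2) k ℕ./ (q ^ (v ∸ k) ∸ 1)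
  equal : v ≡ 2 *ℕ k → L ≡ R
  equal v≡2k = /-cong
    (cong ((q ^ v ∸ 1) *ℕ_) (A-dual (ℕ.<⇒≤ 2≤δ) (sym (trans (cong (_∸ 1) v≡2k) (cong (λ z → κ + suc z) (ℕ.+-identityʳ κ))))))
    (cong (λ z → q ^ z ∸ 1) (sym (trans (cong (_∸ k) v≡2k) (trans (ℕ.m+n∸m≡n k (k + 0)) (ℕ.+-identityʳ k)))))
  smaller : v ≢ 2 *ℕ k → L < R
  smaller v≢2k with ℕ.m≤n⇒∃[o]m+o≡n (ℕ.≤∧≢⇒< 2k≤v (v≢2k ∘ sym))
  -- Writing `v = 2k + 1 + o` gives `v - k = suc (suc (κ + o))`, so `A-comparison` applies with
  -- `m = κ + o`.
  ... | o , 1+2k+o≡v = /-strict ((q ^ v ∸ 1) *ℕ A (v ∸ 1) (δ *ℕ 2) κ) ((q ^ v ∸ 1) *ℕ A (v ∸ 1) (δ *ℕ 2) k)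
    (q ^ k ∸ 1) (q ^ (v ∸ k) ∸ 1)
    (subst₂ (λ w m → (q ^ w ∸ 1) *ℕ A (w ∸ 1) (δ *ℕ 2) κ *ℕ (q ^ m ∸ 1) + (q ^ k ∸ 1) *ℕ (q ^ m ∸ 1) ≤
                     (q ^ w ∸ 1) *ℕ A (w ∸ 1) (δ *ℕ 2) k *ℕ (q ^ k ∸ 1))
      v≡ (trans (sym (ℕ.m+n∸n≡m (suc (suc (κ + o))) k)) (cong (_∸ k) v≡))
      (subst (λ n → (q ^ (suc (suc (κ + o)) + k) ∸ 1) *ℕ A n (δ *ℕ 2) κ *ℕ (q ^ suc (suc (κ + o)) ∸ 1) +
                    (q ^ k ∸ 1) *ℕ (q ^ suc (suc (κ + o)) ∸ 1) ≤
                    (q ^ (suc (suc (κ + o)) + k) ∸ 1) *ℕ A n (δ *ℕ 2) k *ℕ (q ^ k ∸ 1))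
        (ℕ.+-comm k (suc (κ + o)))
        (A-comparison F κ (κ + o) δ (k ∸ δ) (s≤s (ℕ.m≤m+n κ o)) (ℕ.m∸n+n≡m δ≤k) 2≤δ)))
    where
    v≡ : suc (suc (κ + o)) + k ≡ v
    v≡ = trans (solve 2 (λ κ o → con 2 :+ (κ :+ o) :+ (con 1 :+ κ) := con 1 :+ (con 2 :* (con 1 :+ κ)) :+ o) refl κ o) 1+2k+o≡v
      where open +-*-Solver
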